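{- Let $G$ be a finite simple planar graph such that every 5-cycle $C$ of $G$ satisfies both of the following: (i) $C$ is not contained in a subgraph of $G$ isomorphic to the 5-wheel, and (ii) $C$ does not share exactly one edge with a 3-cycle of $G$. Then $G$ is 4-choosable.
   Context: A list assignment $L$ for a graph $G$ assigns to each vertex $v$ a set $L(v)$ of colors; it is a $k$-assignment if $|L(v)|=k$ for all $v$. $G$ is $L$-colorable if one can choose $c(v)\in L(v)$ for every $v$ with $c(u)\neq c(v)$ for every edge $uv$. $G$ is $k$-choosable if it is $L$-colorable for every $k$-assignment $L$. The 5-wheel is the graph obtained from a 5-cycle by adding one new vertex adjacent to all five vertices of the cycle; "$C$ is a subgraph of a 5-wheel" means $C$ is the rim 5-cycle or any 5-cycle of such a subgraph of $G$ (i.e., $C$ lies in some subgraph of $G$ isomorphic to the 5-wheel). -}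

module Defs where

open import Data.Nat using (ℕ; suc; _+_; _*_)
open import Data.Fin using (Fin; zero; suc)
open import Data.Fin.Permutation using (Permutation′; _⟨$⟩ʳ_)
open import Data.Bool using (Bool; true; false)
open import Data.List using (List; length)
open import Data.List.Membership.Propositional using (_∈_)
open import Data.List.Relation.Unary.Unique.Propositional using (Unique)
open import Data.Product using (Σ; ∃; _×_; _,_)
open import Data.Sum using (_⊎_)
open import Relation.Nullary using (¬_)
open import Relation.Binary.PropositionalEquality using (_≡_; _≢_)
open import Function using (_∘_; Injective)
open import Function.Bundles using (_⇔_)

record Graph : Set where
  field
    n     : ℕ
    adj   : Fin n → Fin n → Bool
    sym   : ∀ u v → adj u v ≡ adj v u
    irrefl : ∀ v → adj v v ≡ false

open Graph public

Adj : (G : Graph) → Fin (n G) → Fin (n G) → Set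
Adj G u v = adj G u v ≡ true

data Orb {d : ℕ} (f : Fin d → Fin d) (x : Fin d) : Fin d → Set where
  here : Orb f x x
  next : ∀ {y} → Orb f x y → Orb f x (f y)

data Orb2 {d : ℕ} (f g : Fin d → Fin d) (x : Fin d) : Fin d → Set where
  here  : Orb2 f g x x
  nextf : ∀ {y} → Orb2 f g x y → Orb2 f g x (f y)
  nextg : ∀ {y} → Orb2 f g x y → Orb2 f g x (g y)

NumClasses : {d : ℕ} → (Fin d → Fin d → Set) → ℕ → Set
NumClasses {d} R k =
  Σ (Fin d → Fin k) λ c →
    (∀ j → ∃ λ x → c x ≡ j) × (∀ x y → (c x ≡ c y) ⇔ R x y)

-- Combinatorial maps (rotation systems) and planarity.
-- Darts Fin d; α a fixed-point-free involution (edges = α-orbits),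
-- σ a permutation (vertices = σ-orbits, σ = rotation around a vertex),
-- faces = orbits of σ ∘ α.  The map is planar (genus 0 on every
-- component) iff  V + F = E + 2·C  (Euler's formula), C = number of
-- connected components (orbits of the group generated by α, σ).

record CombMap : Set where
  field
    d      : ℕ
    α      : Fin d → Fin d
    α-invol : ∀ x → α (α x) ≡ x
    α-nofix : ∀ x → α x ≢ x
    σ      : Permutation′ d

  σf : Fin d → Fin d
  σf x = σ ⟨$⟩ʳ x

  φf : Fin d → Fin d
  φf = σf ∘ α

open CombMap public

GenusZero : CombMap → Set
GenusZero M =
  Σ ℕ λ V → Σ ℕ λ E → Σ ℕ λ F → Σ ℕ λ C →
    NumClasses (Orb (σf M)) V × NumClasses (Orb (α M)) E ×
    NumClasses (Orb (φf M)) F × NumClasses (Orb2 (α M) (σf M)) C ×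
    (V + F ≡ E + 2 * C)

-- M is an embedding of G: vert sends each dart to its vertex; distinct
-- σ-orbits go to distinct vertices; and u,v adjacent iff some dart goes
-- from u to v.  (Isolated vertices carry no darts.)
EmbeddingOf : (G : Graph) → CombMap → Set
EmbeddingOf G M =
  Σ (Fin (d M) → Fin (n G)) λ vert →
    (∀ x y → (vert x ≡ vert y) ⇔ Orb (σf M) x y) ×
    (∀ u v → Adj G u v ⇔ (∃ λ x → vert x ≡ u × vert (α M x) ≡ v))

Planar : Graph → Set
Planar G = Σ CombMap λ M → GenusZero M × EmbeddingOf G M

IsAssignment : (G : Graph) → ℕ → (Fin (n G) → List ℕ) → Set
IsAssignment G k L = ∀ v → length (L v) ≡ k × Unique (L v)

LColorable : (G : Graph) → (Fin (n G) → List ℕ) → Set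
LColorable G L =
  Σ (Fin (n G) → ℕ) λ c →
    (∀ v → c v ∈ L v) × (∀ u v → Adj G u v → c u ≢ c v)

Choosable : Graph → ℕ → Set
Choosable G k = ∀ L → IsAssignment G k L → LColorable G L

next5 : Fin 5 → Fin 5
next5 zero = suc zero
next5 (suc zero) = suc (suc zero)
next5 (suc (suc zero)) = suc (suc (suc zero))
next5 (suc (suc (suc zero))) = suc (suc (suc (suc zero)))
next5 (suc (suc (suc (suc zero)))) = zero

record Cycle5 (G : Graph) : Set where
  field
    vtx : Fin 5 → Fin (n G)
    inj : Injective _≡_ _≡_ vtx
    adjs : ∀ i → Adj G (vtx i) (vtx (next5 i))

open Cycle5 public

EdgeOfCycle : {G : Graph} → Cycle5 G → Fin (n G) → Fin (n G) → Set
EdgeOfCycle C u v =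
  ∃ λ i → (vtx C i ≡ u × vtx C (next5 i) ≡ v) ⊎ (vtx C i ≡ v × vtx C (next5 i) ≡ u)

record Wheel5 (G : Graph) : Set where
  field
    hub    : Fin (n G)
    rim    : Fin 5 → Fin (n G)
    rim-inj : Injective _≡_ _≡_ rim
    hub-new : ∀ i → rim i ≢ hub
    rim-adj : ∀ i → Adj G (rim i) (rim (next5 i))
    spoke  : ∀ i → Adj G hub (rim i)

open Wheel5 public

EdgeOfWheel : {G : Graph} → Wheel5 G → Fin (n G) → Fin (n G) → Set
EdgeOfWheel W u v =
  (∃ λ i → (rim W i ≡ u × rim W (next5 i) ≡ v) ⊎ (rim W i ≡ v × rim W (next5 i) ≡ u))
  ⊎ (∃ λ i → (hub W ≡ u × rim W i ≡ v) ⊎ (hub W ≡ v × rim W i ≡ u))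

InWheel : {G : Graph} → Cycle5 G → Set
InWheel {G} C =
  Σ (Wheel5 G) λ W → ∀ i → EdgeOfWheel W (vtx C i) (vtx C (next5 i))

SharesOneEdgeWithTriangle : {G : Graph} → Cycle5 G → Set
SharesOneEdgeWithTriangle {G} C =
  Σ (Fin (n G)) λ a → Σ (Fin (n G)) λ b → Σ (Fin (n G)) λ c →
    Adj G a b × Adj G b c × Adj G a c ×
    EdgeOfCycle C a b × ¬ EdgeOfCycle C b c × ¬ EdgeOfCycle C a c

{-# OPTIONS --safe #-}

-- Only the second condition on 5-cycles matters: the rim of a 5-wheel shares exactly one edge with a triangle at the hub.
--
-- Take a minimal set S of vertices such that G[S] is not L-colourable, embedded in the plane.  Its degrees are at least 4,
-- and the condition keeps triangular faces apart: at most two are consecutive at a vertex, none is adjacent to a 5-face,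
-- a 4-face is adjacent to at most one, and then has no chord, and two adjacent triangles (a "diamond") meet only larger faces.
-- Colourings of G[S] minus one vertex v can be modified by moving the uncoloured vertex around a 4-face.  This shows that
-- a 4-face next to a triangle has a corner of degree ≥ 5, and that a vertex of degree 5 is the only such corner of at most
-- one of these 4-faces.
--
-- Give every vertex and face x the charge deg x − 4; the total is negative by Euler's formula.  A triangle needs 1 and gets
-- 1/3 across each side: from a face of length ≥ 6 directly; through a 4-face from the corners of degree ≥ 5 of that 4-face;
-- across the diagonal of a diamond from the ends of the diagonal, where an end of degree 4 is in turn supplied by
-- the two faces of length ≥ 6 at it.  Afterwards every charge is nonnegative.

module Submission where

open import Defs hiding (sym; n; d; α; σ; adj; irrefl; inj; adjs; here; α-invol; α-nofix)
open import Data.Bool.Base using (Bool; true; false; _∧_)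
import Data.Bool.Properties as Bool
open import Data.Empty using (⊥; ⊥-elim)
open import Data.Fin.Base using (Fin; zero; suc; toℕ; punchIn; punchOut; combine)
open import Data.Fin.Permutation using (permutation; _⟨$⟩ʳ_; _⟨$⟩ˡ_; inverseˡ; inverseʳ)
open import Data.Fin.Properties using (_≟_; any?; all?; injective⇒≤; pigeonhole; suc-injective; punchOut-injective; punchOut-punchIn; punchOut-cong; punchInᵢ≢i; toℕ-injective; combine-injective)
open import Data.List.Base as List using (List; []; _∷_; _++_; length; map; concat; tabulate; allFin; lookup)
open import Data.List.Membership.Propositional using (_∈_; find; lose)
open import Data.List.Membership.Propositional.Properties using (∈-map⁺; ∈-map⁻; ∈-++⁺ˡ; ∈-++⁺ʳ; ∈-++⁻; ∈-tabulate⁺; ∈-tabulate⁻; ∈-filter⁻; ∈-allFin; ∈-lookup)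
open import Data.List.Properties using (length-map)
open import Data.List.Relation.Unary.All as All using (_∷_)
open import Data.List.Relation.Unary.AllPairs using ([]; _∷_)
open import Data.List.Relation.Unary.Any as Any using (Any; here; there)
open import Data.List.Relation.Unary.Any.Properties using (lookup-index)
open import Data.List.Relation.Unary.Unique.Propositional using (Unique)
open import Data.List.Relation.Unary.Unique.Propositional.Properties using (filter⁺; allFin⁺)
open import Data.Nat.Base using (ℕ; zero; suc; _+_; _*_; _∸_; _⊓_; _≤_; _<_; z≤n; s≤s)
import Data.Nat.Properties as ℕ
open import Data.Nat.Solver using (module +-*-Solver)
open import Data.Product using (Σ; ∃; _×_; _,_; proj₁; proj₂)
open import Data.Sum using (_⊎_; inj₁; inj₂; [_,_]′)
open import Function using (_∘_; Injective)
open import Function.Bundles using (Equivalence)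
open import Relation.Binary.PropositionalEquality using (_≡_; _≢_; refl; sym; trans; cong; cong₂; subst; subst₂; module ≡-Reasoning)
open import Relation.Nullary using (¬_; Dec; yes; no)
open import Relation.Nullary.Decidable using (_×-dec_; _⊎-dec_; _→-dec_; ¬?; map′; decidable-stable)
open import Algebra.Properties.CommutativeMonoid.Sum ℕ.+-0-commutativeMonoid using (sum; sum-permute; ∑-distrib-+; sum-cong-≗)
open import Data.List.Membership.DecPropositional ℕ._≟_ using (_∈?_)

-- Sums over orbits and partitions

-- The reducible configurations are dictated by the rates. In sixths, a 4-face next to a triangle
-- must recover the 2 that it passes on: 1 from each corner of degree ≥ 5 if there are several, 2
-- from a single one (`Lonely`). A vertex of degree 5 has 6 to spend on five corners, enough for one
-- corner at 2 and four at 1; a vertex of degree ≥ 6 affords 2 at every corner, and a face of length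
-- ≥ 6 affords 2 at every side. So the colourings have to supply two facts: a lonely corner never
-- has degree 4, and two lonely corners never meet at a vertex of degree 5.
--
-- Both come from counting colours. Around a hole of degree 4 the four colours of its list occur
-- exactly once each, so the hole can move to any neighbour. Leading the hole around a 4-face whose
-- other three corners have degree 4 brings it back with the colours of these corners permuted
-- cyclically.

listSum : ∀ {A : Set} → (A → ℕ) → List A → ℕ
listSum w []       = 0
listSum w (x ∷ xs) = w x + listSum w xs

listSum-++ : ∀ {A : Set} (w : A → ℕ) xs ys → listSum w (xs ++ ys) ≡ listSum w xs + listSum w ys
listSum-++ w []       ys = refl
listSum-++ w (x ∷ xs) ys = trans (cong (w x +_) (listSum-++ w xs ys)) (sym (ℕ.+-assoc (w x) _ _))

listSum-cong : ∀ {A : Set} {v w : A → ℕ} {xs} → (∀ {x} → x ∈ xs → v x ≡ w x) → listSum v xs ≡ listSum w xs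
listSum-cong {xs = []}     eq = refl
listSum-cong {xs = x ∷ xs} eq = cong₂ _+_ (eq (here refl)) (listSum-cong (eq ∘ there))

listSum-one : ∀ {A : Set} (xs : List A) → listSum (λ _ → 1) xs ≡ length xs
listSum-one []       = refl
listSum-one (x ∷ xs) = cong suc (listSum-one xs)

sum-mono : ∀ {n} {v w : Fin n → ℕ} → (∀ i → v i ≤ w i) → sum v ≤ sum w
sum-mono {zero}  le = z≤n
sum-mono {suc n} le = ℕ.+-mono-≤ (le zero) (sum-mono (le ∘ suc))

sum-const : ∀ n k → sum {n} (λ _ → k) ≡ n * k
sum-const zero    k = refl
sum-const (suc n) k = cong (k +_) (sum-const n k)

sum-+ : ∀ {n} (v w : Fin n → ℕ) → sum (λ i → v i + w i) ≡ sum v + sum w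
sum-+ = ∑-distrib-+

sum-invol : ∀ {n} (f : Fin n → Fin n) → (∀ x → f (f x) ≡ x) → (w : Fin n → ℕ) → sum (w ∘ f) ≡ sum w
sum-invol f inv w = sym (sum-permute w (permutation f f inv inv))

erase : ∀ {n} → Fin n → (Fin n → ℕ) → Fin n → ℕ
erase y w x with x ≟ y
... | yes _ = 0
... | no  _ = w x

erase-≢ : ∀ {n} (y : Fin n) w {x} → x ≢ y → erase y w x ≡ w x
erase-≢ y w {x} x≢y with x ≟ y
... | yes x≡y = ⊥-elim (x≢y x≡y)
... | no  _   = refl

sum-erase : ∀ {n} (y : Fin n) w → sum w ≡ w y + sum (erase y w)
sum-erase {suc n} zero    w = cong (w zero +_) (sum-cong-≗ {n} (λ i → sym (erase-≢ zero w {suc i} λ ())))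
sum-erase {suc n} (suc y) w = begin
  w zero + sum (w ∘ suc)                                   ≡⟨ cong (w zero +_) (sum-erase y (w ∘ suc)) ⟩
  w zero + (w (suc y) + sum (erase y (w ∘ suc)))           ≡⟨ ℕ.+-comm (w zero) _ ⟩
  (w (suc y) + sum (erase y (w ∘ suc))) + w zero           ≡⟨ ℕ.+-assoc (w (suc y)) _ _ ⟩
  w (suc y) + (sum (erase y (w ∘ suc)) + w zero)           ≡⟨ cong (w (suc y) +_) (ℕ.+-comm _ (w zero)) ⟩
  w (suc y) + (w zero + sum (erase y (w ∘ suc)))           ≡⟨ cong (w (suc y) +_) (cong₂ _+_ (sym (erase-≢ (suc y) w {zero} λ ())) (sum-cong-≗ {n} shift)) ⟩
  w (suc y) + sum (erase (suc y) w)                        ∎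
  where
  open ≡-Reasoning
  shift : ∀ i → erase y (w ∘ suc) i ≡ erase (suc y) w (suc i)
  shift i with i ≟ y
  ... | yes refl = refl
  ... | no  _    = refl

unique-sum≤ : ∀ {n} (w : Fin n → ℕ) {xs} → Unique xs → listSum w xs ≤ sum w
unique-sum≤ w []                 = z≤n
unique-sum≤ w {x ∷ xs} (x∉ ∷ uq) = begin
  w x + listSum w xs             ≡⟨ cong (w x +_) (listSum-cong λ z∈ → sym (erase-≢ x w (All.lookup x∉ z∈ ∘ sym))) ⟩
  w x + listSum (erase x w) xs   ≤⟨ ℕ.+-monoʳ-≤ (w x) (unique-sum≤ (erase x w) uq) ⟩
  w x + sum (erase x w)          ≡⟨ sym (sum-erase x w) ⟩
  sum w                          ∎
  where open ℕ.≤-Reasoning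

unique-length≤ : ∀ {n} {xs : List (Fin n)} → Unique xs → length xs ≤ n
unique-length≤ {n} {xs} uq = begin
  length xs                ≡⟨ sym (listSum-one xs) ⟩
  listSum (λ _ → 1) xs     ≤⟨ unique-sum≤ (λ _ → 1) uq ⟩
  sum {n} (λ _ → 1)        ≡⟨ sum-const n 1 ⟩
  n * 1                    ≡⟨ ℕ.*-identityʳ n ⟩
  n                        ∎
  where open ℕ.≤-Reasoning

unique-++ : ∀ {A : Set} {xs ys : List A} → Unique xs → Unique ys → (∀ {z} → z ∈ xs → z ∈ ys → ⊥) → Unique (xs ++ ys)
unique-++ []         uy dis = uy
unique-++ (x∉ ∷ ux) uy dis =
  All.tabulate (λ z∈ → [ All.lookup x∉ , (λ z∈ys x≡z → dis (here refl) (subst (_∈ _) (sym x≡z) z∈ys)) ]′ (∈-++⁻ _ z∈))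
  ∷ unique-++ ux uy (dis ∘ there)

unique-concat : ∀ {A : Set} {k} (f : Fin k → List A) → (∀ i → Unique (f i)) →
                (∀ {i j z} → z ∈ f i → z ∈ f j → i ≡ j) → Unique (concat (tabulate f))
∈-concat-tabulate : ∀ {A : Set} {k} (f : Fin k → List A) {z} → z ∈ concat (tabulate f) → ∃ λ i → z ∈ f i
∈-concat-tabulate {k = suc k} f z∈ with ∈-++⁻ (f zero) z∈
... | inj₁ z∈₀ = zero , z∈₀
... | inj₂ z∈′ with ∈-concat-tabulate (f ∘ suc) z∈′
...   | i , z∈ᵢ = suc i , z∈ᵢ
unique-concat {k = zero}  f uq dis = []
unique-concat {k = suc k} f uq dis =
  unique-++ (uq zero) (unique-concat (f ∘ suc) (uq ∘ suc) (λ p q → suc-injective (dis p q)))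
    (λ z∈ z∈′ → case (∈-concat-tabulate (f ∘ suc) z∈′) z∈)
  where
  case : ∀ {z} → ∃ (λ i → z ∈ f (suc i)) → z ∈ f zero → ⊥
  case (i , z∈ᵢ) z∈ with dis z∈ z∈ᵢ
  ... | ()

sum-concat≥ : ∀ {A : Set} (w : A → ℕ) {b} {k} (f : Fin k → List A) → (∀ i → b ≤ listSum w (f i)) →
              k * b ≤ listSum w (concat (tabulate f))
sum-concat≥ w {k = zero}  f le = z≤n
sum-concat≥ w {k = suc k} f le =
  subst (_ ≤_) (sym (listSum-++ w (f zero) _)) (ℕ.+-mono-≤ (le zero) (sum-concat≥ w (f ∘ suc) (le ∘ suc)))

-- Counting the classes of a finite equivalence relation

data Gen {A : Set} (R : A → A → Set) : A → A → Set where
  gen  : ∀ {x y} → R x y → Gen R x y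
  rfl  : ∀ {x} → Gen R x x
  inv  : ∀ {x y} → Gen R x y → Gen R y x
  _∙_  : ∀ {x y z} → Gen R x y → Gen R y z → Gen R x z

Gen-map : ∀ {A B : Set} {R : A → A → Set} {R′ : B → B → Set} (ρ : A → B) →
          (∀ {x y} → R x y → Gen R′ (ρ x) (ρ y)) → ∀ {x y} → Gen R x y → Gen R′ (ρ x) (ρ y)
Gen-map ρ h (gen r)  = h r
Gen-map ρ h rfl      = rfl
Gen-map ρ h (inv p)  = inv (Gen-map ρ h p)
Gen-map ρ h (p ∙ q)  = Gen-map ρ h p ∙ Gen-map ρ h q

Gen-const : ∀ {A B : Set} {R : A → A → Set} (c : A → B) → (∀ {x y} → R x y → c x ≡ c y) →
            ∀ {x y} → Gen R x y → c x ≡ c y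
Gen-const c h (gen r) = h r
Gen-const c h rfl     = refl
Gen-const c h (inv p) = sym (Gen-const c h p)
Gen-const c h (p ∙ q) = trans (Gen-const c h p) (Gen-const c h q)

-- An invariant has to be checked on generators only, but in both directions, because of `inv`.
Gen-pred : ∀ {A : Set} {R : A → A → Set} (P : A → Set) → (∀ {x y} → R x y → (P x → P y) × (P y → P x)) →
           ∀ {x y} → Gen R x y → (P x → P y) × (P y → P x)
Gen-pred P h (gen r) = h r
Gen-pred P h rfl     = (λ p → p) , (λ p → p)
Gen-pred P h (inv p) = proj₂ (Gen-pred P h p) , proj₁ (Gen-pred P h p)
Gen-pred P h (p ∙ q) = proj₁ (Gen-pred P h q) ∘ proj₁ (Gen-pred P h p) , proj₂ (Gen-pred P h p) ∘ proj₂ (Gen-pred P h q)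

record Classes {d} (R : Fin d → Fin d → Set) (k : ℕ) : Set where
  field
    cls   : Fin d → Fin k
    rep   : Fin k → Fin d
    onto  : ∀ j → cls (rep j) ≡ j
    sound : ∀ {x y} → cls x ≡ cls y → Gen R x y
    resp  : ∀ {x y} → R x y → cls x ≡ cls y

  resp* : ∀ {x y} → Gen R x y → cls x ≡ cls y
  resp* = Gen-const cls resp

Classes-⇔ : ∀ {d k} {R R′ : Fin d → Fin d → Set} → (∀ {x y} → R x y → R′ x y) → (∀ {x y} → R′ x y → R x y) →
            Classes R k → Classes R′ k
Classes-⇔ f g C = record { cls = cls ; rep = rep ; onto = onto ; sound = Gen-map (λ z → z) (gen ∘ f) ∘ sound ; resp = resp ∘ g }
  where open Classes C

private
  Pairs : ∀ {d} → List (Fin d × Fin d) → Fin d → Fin d → Set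
  Pairs ps x y = (x , y) ∈ ps

-- A union step: if `p` and `q` lie in different classes, the class of `q` is redirected to that of
-- `p`, and `punchOut` closes the gap in the numbering.
merge : ∀ {d k} {ps : List (Fin d × Fin d)} p q → Classes (Pairs ps) k → ∃ (Classes (Pairs ((p , q) ∷ ps)))
merge {d} {k} {ps} p q C with Classes.cls C p ≟ Classes.cls C q
... | yes eq = k , record
  { cls = cls ; rep = rep ; onto = onto ; sound = Gen-map (λ z → z) (gen ∘ there) ∘ sound
  ; resp = λ { (here refl) → eq ; (there r) → resp r } }
  where open Classes C
merge {d} {zero}  {ps} p q C | no neq with Classes.cls C p
... | ()
merge {d} {suc k} {ps} p q C | no neq = k , record
  { cls = λ z → punchOut (target≢ z)
  ; rep = λ j → rep (punchIn (cls q) j)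
  ; onto = λ j → trans (punchOut-cong (cls q) (trans (target-≢ _ (λ e → punchInᵢ≢i (cls q) j (trans (sym (onto _)) e))) (onto _)))
                       (punchOut-punchIn (cls q))
  ; sound = λ {x} {y} e → sound′ x y (punchOut-injective (target≢ x) (target≢ y) e)
  ; resp = λ { (here refl) → punchOut-cong (cls q) (trans (target-≢ p neq) (sym (target-≡ q refl)))
             ; (there r) → punchOut-cong (cls q) (target-cong (resp r)) } }
  where
  open Classes C
  target : Fin d → Fin (suc k)
  target z with cls z ≟ cls q
  ... | yes _ = cls p
  ... | no  _ = cls z
  target≢ : ∀ z → cls q ≢ target z
  target≢ z e with cls z ≟ cls q
  ... | yes _ = neq (sym e)
  ... | no z≢ = z≢ (sym e)
  target-≡ : ∀ z → cls z ≡ cls q → target z ≡ cls p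
  target-≡ z e with cls z ≟ cls q
  ... | yes _ = refl
  ... | no z≢ = ⊥-elim (z≢ e)
  target-≢ : ∀ z → cls z ≢ cls q → target z ≡ cls z
  target-≢ z e with cls z ≟ cls q
  ... | yes z≡ = ⊥-elim (e z≡)
  ... | no _   = refl
  target-cong : ∀ {x y} → cls x ≡ cls y → target x ≡ target y
  target-cong {x} {y} e with cls x ≟ cls q | cls y ≟ cls q
  ... | yes _ | yes _ = refl
  ... | no _  | no _  = e
  ... | yes a | no b  = ⊥-elim (b (trans (sym e) a))
  ... | no a  | yes b = ⊥-elim (a (trans e b))
  up : ∀ {x y} → cls x ≡ cls y → Gen (Pairs ((p , q) ∷ ps)) x y
  up = Gen-map (λ z → z) (gen ∘ there) ∘ sound
  sound′ : ∀ x y → target x ≡ target y → Gen (Pairs ((p , q) ∷ ps)) x y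
  sound′ x y e with cls x ≟ cls q | cls y ≟ cls q
  ... | yes a | yes b = up (trans a (sym b))
  ... | no _  | no _  = up e
  ... | yes a | no _  = up a ∙ (inv (gen (here refl)) ∙ up e)
  ... | no _  | yes b = up e ∙ (gen (here refl) ∙ up (sym b))

pairsClasses : ∀ {d} (ps : List (Fin d × Fin d)) → ∃ (Classes (Pairs ps))
pairsClasses {d} []             = d , record { cls = λ z → z ; rep = λ z → z ; onto = λ _ → refl ; sound = λ { refl → rfl } ; resp = λ () }
pairsClasses     ((p , q) ∷ ps) = merge p q (proj₂ (pairsClasses ps))

Step : ∀ {d} → (Fin d → Fin d) → Fin d → Fin d → Set
Step f x y = y ≡ f x

Step₂ : ∀ {d} → (Fin d → Fin d) → (Fin d → Fin d) → Fin d → Fin d → Set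
Step₂ f g x y = y ≡ f x ⊎ y ≡ g x

step₂Classes : ∀ {d} (f g : Fin d → Fin d) → ∃ (Classes (Step₂ f g))
step₂Classes {d} f g = _ , Classes-⇔ to from (proj₂ (pairsClasses ps))
  where
  ps : List (Fin d × Fin d)
  ps = tabulate (λ x → x , f x) ++ tabulate (λ x → x , g x)
  to : ∀ {x y} → (x , y) ∈ ps → Step₂ f g x y
  to r with ∈-++⁻ (tabulate (λ x → x , f x)) r
  ... | inj₁ a with ∈-tabulate⁻ a
  ...   | _ , refl = inj₁ refl
  to r | inj₂ b with ∈-tabulate⁻ b
  ...   | _ , refl = inj₂ refl
  from : ∀ {x y} → Step₂ f g x y → (x , y) ∈ ps
  from {x} (inj₁ refl) = ∈-++⁺ˡ (∈-tabulate⁺ x)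
  from {x} (inj₂ refl) = ∈-++⁺ʳ (tabulate (λ x → x , f x)) (∈-tabulate⁺ x)

stepClasses : ∀ {d} (f : Fin d → Fin d) → ∃ (Classes (Step f))
stepClasses f = _ , Classes-⇔ [ (λ r → r) , (λ r → r) ]′ inj₁ (proj₂ (step₂Classes f f))

module _ {d} {R R′ : Fin d → Fin d → Set} {k k′} (C : Classes R k) (C′ : Classes R′ k′) where
  private
    open Classes C
    module C′ = Classes C′

  -- Representatives of different classes of `C` stay in different classes of `C′`.
  finer⇒≥ : (∀ {x y} → R′ x y → cls x ≡ cls y) → k ≤ k′
  finer⇒≥ h = injective⇒≤ {f = C′.cls ∘ rep} λ {i} {j} e →
    trans (sym (onto i)) (trans (Gen-const cls h (C′.sound e)) (onto j))

  -- With `p` chosen to represent its own class, `q` is one further element that no representative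
  -- is `C′`-equivalent to.
  strictlyFiner⇒> : (∀ {x y} → R′ x y → cls x ≡ cls y) → ∀ p q → cls p ≡ cls q → ¬ Gen R′ p q → suc k ≤ k′
  strictlyFiner⇒> h p q pq npq = injective⇒≤ {f = f} f-inj
    where
    rep′ : Fin k → Fin d
    rep′ j with j ≟ cls p
    ... | yes _ = p
    ... | no  _ = rep j
    onto′ : ∀ j → cls (rep′ j) ≡ j
    onto′ j with j ≟ cls p
    ... | yes e = sym e
    ... | no  _ = onto j
    rep′-p : ∀ {j} → j ≡ cls p → rep′ j ≡ p
    rep′-p {j} e with j ≟ cls p
    ... | yes _ = refl
    ... | no ne = ⊥-elim (ne e)
    q∉ : ∀ j → C′.cls (rep′ j) ≢ C′.cls q
    q∉ j e = npq (subst (λ z → Gen R′ z q) (rep′-p (trans (sym (onto′ j)) (trans (Gen-const cls h (C′.sound e)) (sym pq)))) (C′.sound e))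
    f : Fin (suc k) → Fin k′
    f zero    = C′.cls q
    f (suc j) = C′.cls (rep′ j)
    f-inj : Injective _≡_ _≡_ f
    f-inj {zero}  {zero}  e = refl
    f-inj {zero}  {suc j} e = ⊥-elim (q∉ j (sym e))
    f-inj {suc i} {zero}  e = ⊥-elim (q∉ i e)
    f-inj {suc i} {suc j} e = cong suc (trans (sym (onto′ i)) (trans (Gen-const cls h (C′.sound e)) (onto′ j)))

  module _ (p q : Fin d) where
    private
      glued : Fin d → Fin k
      glued z with cls z ≟ cls q
      ... | yes _ = cls p
      ... | no  _ = cls z

      glued-cls : ∀ {x y} → cls x ≡ cls y → glued x ≡ glued y
      glued-cls {x} {y} e with cls x ≟ cls q | cls y ≟ cls q
      ... | yes _ | yes _ = refl
      ... | no _  | no _  = e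
      ... | yes a | no b  = ⊥-elim (b (trans (sym e) a))
      ... | no a  | yes b = ⊥-elim (a (trans e b))

      glued-≢ : ∀ {x} → cls x ≢ cls q → glued x ≡ cls x
      glued-≢ {x} ne with cls x ≟ cls q
      ... | yes e = ⊥-elim (ne e)
      ... | no _  = refl

      glued-pq : glued p ≡ glued q
      glued-pq with cls p ≟ cls q | cls q ≟ cls q
      ... | yes _ | yes _ = refl
      ... | no _  | yes _ = refl
      ... | _     | no ne = ⊥-elim (ne refl)

    -- The hypothesis expresses, through test functions `g`, that `R′` lies in the equivalence
    -- generated by the classes of `C` and the one pair `p`, `q`. Such a gluing loses at most the
    -- class of `q`, which is sent to `zero`.
    oneGluing⇒≤ : (∀ (g : Fin d → Fin k) → (∀ {x y} → cls x ≡ cls y → g x ≡ g y) → g p ≡ g q →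
                     ∀ {x y} → R′ x y → g x ≡ g y) → k ≤ suc k′
    oneGluing⇒≤ h = injective⇒≤ {f = f} f-inj
      where
      f : Fin k → Fin (suc k′)
      f j with j ≟ cls q
      ... | yes _ = zero
      ... | no  _ = suc (C′.cls (rep j))
      f-inj : Injective _≡_ _≡_ f
      f-inj {i} {j} e with i ≟ cls q | j ≟ cls q
      ... | yes a | yes b = trans a (sym b)
      f-inj {i} {j} () | yes _ | no _
      f-inj {i} {j} () | no _ | yes _
      f-inj {i} {j} e | no a | no b = trans (sym (glued-rep a)) (trans (Gen-const glued (h glued glued-cls glued-pq)
                                           (C′.sound (suc-injective e))) (glued-rep b))
        where
        glued-rep : ∀ {j} → j ≢ cls q → glued (rep j) ≡ j
        glued-rep ne = trans (glued-≢ (ne ∘ trans (sym (onto _)))) (onto _)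

-- The lists need not exhaust their classes: weights are nonnegative, so distinct members of total
-- weight `b` are enough. This is what makes six darts of an arbitrarily long orbit sufficient
-- later.
orbits-sum : ∀ {d k} {R : Fin d → Fin d → Set} (C : Classes R k) (w : Fin d → ℕ) b →
             (∀ x → Σ (List (Fin d)) λ ys → Unique ys × (∀ {y} → y ∈ ys → Gen R x y) × b ≤ listSum w ys) →
             k * b ≤ sum w
orbits-sum C w b h = ℕ.≤-trans (sum-concat≥ w (proj₁ ∘ h ∘ rep) (λ j → proj₂ (proj₂ (proj₂ (h (rep j))))))
                      (unique-sum≤ w (unique-concat _ (λ j → proj₁ (proj₂ (h (rep j)))) dis))
  where
  open Classes C
  dis : ∀ {i j z} → z ∈ proj₁ (h (rep i)) → z ∈ proj₁ (h (rep j)) → i ≡ j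
  dis {i} {j} a b = trans (sym (onto i)) (trans (resp* (proj₁ (proj₂ (proj₂ (h (rep i)))) a ∙ inv (proj₁ (proj₂ (proj₂ (h (rep j)))) b))) (onto j))

-- Deleting edges from a combinatorial map

record Perm (d : ℕ) : Set where
  field
    fwd bwd : Fin d → Fin d
    fwd-bwd : ∀ x → fwd (bwd x) ≡ x
    bwd-fwd : ∀ x → bwd (fwd x) ≡ x

  fwd-inj : ∀ {x y} → fwd x ≡ fwd y → x ≡ y
  fwd-inj {x} {y} e = trans (sym (bwd-fwd x)) (trans (cong bwd e) (bwd-fwd y))

iter : ∀ {A : Set} → (A → A) → ℕ → A → A
iter f zero    x = x
iter f (suc k) x = f (iter f k x)

iter-+ : ∀ {A : Set} (f : A → A) i j x → iter f (i + j) x ≡ iter f i (iter f j x)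
iter-+ f zero    j x = refl
iter-+ f (suc i) j x = cong f (iter-+ f i j x)

iter-inj : ∀ {A : Set} {f : A → A} → (∀ {x y} → f x ≡ f y → x ≡ y) → ∀ k {x y} → iter f k x ≡ iter f k y → x ≡ y
iter-inj f-inj zero    e = e
iter-inj f-inj (suc k) e = iter-inj f-inj k (f-inj e)

Gen-iter : ∀ {d} (f : Fin d → Fin d) k x → Gen (Step f) x (iter f k x)
Gen-iter f zero    x = rfl
Gen-iter f (suc k) x = Gen-iter f k x ∙ gen refl

returns : ∀ {d} (π : Perm d) x → ∃ λ k → iter (Perm.fwd π) (suc k) x ≡ x
returns {d} π x with pigeonhole (ℕ.n<1+n d) (λ i → iter (Perm.fwd π) (toℕ i) x)
... | i , j , i<j , e = toℕ j ∸ suc (toℕ i) , iter-inj fwd-inj (toℕ i) (sym (begin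
  iter fwd (toℕ i) x                                            ≡⟨ e ⟩
  iter fwd (toℕ j) x                                            ≡⟨ cong (λ m → iter fwd m x) (sym (ℕ.m+[n∸m]≡n i<j)) ⟩
  iter fwd (suc (toℕ i) + (toℕ j ∸ suc (toℕ i))) x              ≡⟨ cong (λ m → iter fwd m x) (sym (ℕ.+-suc (toℕ i) _)) ⟩
  iter fwd (toℕ i + suc (toℕ j ∸ suc (toℕ i))) x                ≡⟨ iter-+ fwd (toℕ i) _ x ⟩
  iter fwd (toℕ i) (iter fwd (suc (toℕ j ∸ suc (toℕ i))) x)     ∎))
  where
  open Perm π
  open ≡-Reasoning

least : (P : ℕ → Set) → (∀ k → Dec (P k)) → ∀ k → P k → ∃ λ m → P m × (∀ i → i < m → ¬ P i)
least P P? k p with P? 0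
... | yes p₀ = 0 , p₀ , λ _ ()
least P P? zero    p | no ¬p₀ = ⊥-elim (¬p₀ p)
least P P? (suc k) p | no ¬p₀ with least (P ∘ suc) (P? ∘ suc) k p
... | m , pm , below = suc m , pm , λ { zero _ → ¬p₀ ; (suc i) (s≤s i<m) → below i i<m }

module Swap {d} (p q : Fin d) where
  swap : Fin d → Fin d
  swap z with z ≟ p | z ≟ q
  ... | yes _ | _     = q
  ... | no _  | yes _ = p
  ... | no _  | no _  = z

  swap-p : ∀ {z} → z ≡ p → swap z ≡ q
  swap-p {z} e with z ≟ p
  ... | yes _ = refl
  ... | no ne = ⊥-elim (ne e)

  swap-q : ∀ {z} → z ≡ q → swap z ≡ p
  swap-q {z} e with z ≟ p | z ≟ q
  ... | yes z≡p | _     = trans (sym e) z≡p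
  ... | no _    | yes _ = refl
  ... | no _    | no ne = ⊥-elim (ne e)

  swap-other : ∀ {z} → z ≢ p → z ≢ q → swap z ≡ z
  swap-other {z} np nq with z ≟ p | z ≟ q
  ... | yes e | _     = ⊥-elim (np e)
  ... | no _  | yes e = ⊥-elim (nq e)
  ... | no _  | no _  = refl

  swap-invol : ∀ z → swap (swap z) ≡ z
  swap-invol z with z ≟ p | z ≟ q
  ... | yes e | _     = trans (swap-q refl) (sym e)
  ... | no _  | yes e = trans (swap-p refl) (sym e)
  ... | no a  | no b  = swap-other a b

  swap-const : ∀ {B : Set} (c : Fin d → B) → c p ≡ c q → ∀ z → c (swap z) ≡ c z
  swap-const c e z with z ≟ p | z ≟ q
  ... | yes refl | _        = sym e
  ... | no _     | yes refl = e
  ... | no _     | no _     = refl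

  _after_ : Perm d → Perm d
  _after_ π = record
    { fwd = swap ∘ fwd ; bwd = bwd ∘ swap
    ; fwd-bwd = λ x → trans (cong swap (fwd-bwd (swap x))) (swap-invol x)
    ; bwd-fwd = λ x → trans (cong bwd (swap-invol (fwd x))) (bwd-fwd x) }
    where open Perm π

-- Follow the orbit of p under φ until it first meets p or q again: the swap redirects the end of this arc to q in the
-- first case, and closes the arc up, leaving q outside, in the second.
module _ {d} (φ : Perm d) {p q : Fin d} (p≢q : p ≢ q) where
  open Perm φ
  open Swap p q
  private
    φ′ : Fin d → Fin d
    φ′ = swap ∘ fwd

    φ′-inj : ∀ {x y} → φ′ x ≡ φ′ y → x ≡ y
    φ′-inj {x} {y} e = fwd-inj (trans (sym (swap-invol (fwd x))) (trans (cong swap e) (swap-invol (fwd y))))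

    Hit : ℕ → Set
    Hit k = iter fwd (suc k) p ≡ p ⊎ iter fwd (suc k) p ≡ q

  joinOrSplit : Gen (Step φ′) p q ⊎ (Gen (Step fwd) p q × ¬ Gen (Step φ′) p q)
  joinOrSplit with returns φ p
  ... | k , ret with least Hit (λ i → (iter fwd (suc i) p ≟ p) ⊎-dec (iter fwd (suc i) p ≟ q)) k (inj₁ ret)
  ... | m , hit , below = result hit
    where
    a : ℕ → Fin d
    a i = iter fwd i p
    φ′-a : ∀ i → i < m → φ′ (a i) ≡ a (suc i)
    φ′-a i i<m = swap-other (below i i<m ∘ inj₁) (below i i<m ∘ inj₂)
    reach : ∀ i → i ≤ m → Gen (Step φ′) p (a i)
    reach zero    _   = rfl
    reach (suc i) i<m = reach i (ℕ.<⇒≤ i<m) ∙ gen (sym (φ′-a i i<m))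
    OnArc : Fin d → Set
    OnArc z = ∃ λ i → i ≤ m × z ≡ a i
    result : Hit m → Gen (Step φ′) p q ⊎ (Gen (Step fwd) p q × ¬ Gen (Step φ′) p q)
    result (inj₁ e) = inj₁ (reach m ℕ.≤-refl ∙ gen (sym (swap-p e)))
    result (inj₂ e) = inj₂ (subst (Gen (Step fwd) p) e (Gen-iter fwd (suc m) p) , λ g → q-off (proj₁ (Gen-pred OnArc closed g) (0 , z≤n , refl)))
      where
      last : φ′ (a m) ≡ p
      last = swap-q e
      q-off : ¬ OnArc q
      q-off (zero  , _    , q≡) = p≢q (sym q≡)
      q-off (suc i , i<m , q≡) = below i i<m (inj₂ (sym q≡))
      closed : ∀ {x y} → y ≡ φ′ x → (OnArc x → OnArc y) × (OnArc y → OnArc x)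
      closed {x} refl = forth , back
        where
        forth : OnArc x → OnArc (φ′ x)
        forth (i , i≤m , refl) with ℕ.m≤n⇒m<n∨m≡n i≤m
        ... | inj₁ i<m  = suc i , i<m , φ′-a i i<m
        ... | inj₂ refl = 0 , z≤n , last
        back : OnArc (φ′ x) → OnArc x
        back (zero  , _   , eq) = m , ℕ.≤-refl , φ′-inj (trans eq (sym last))
        back (suc i , i<m , eq) = i , ℕ.<⇒≤ i<m , φ′-inj (trans eq (sym (φ′-a i i<m)))

_∘ᵖ_ : ∀ {d} → Perm d → Perm d → Perm d
π ∘ᵖ ρ = record
  { fwd = π.fwd ∘ ρ.fwd ; bwd = ρ.bwd ∘ π.bwd
  ; fwd-bwd = λ x → trans (cong π.fwd (ρ.fwd-bwd (π.bwd x))) (π.fwd-bwd x)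
  ; bwd-fwd = λ x → trans (cong ρ.bwd (π.bwd-fwd (ρ.fwd x))) (ρ.bwd-fwd x) }
  where
  module π = Perm π
  module ρ = Perm ρ

-- The inequality V + F ≥ E + 2C, unlike genus zero itself, passes to submaps without any appeal to the Jordan curve theorem.
record EulerBound {d} (α σ : Fin d → Fin d) (E : ℕ) : Set where
  field
    {V F C}    : ℕ
    vertices   : Classes (Step σ) V
    faces      : Classes (Step (σ ∘ α)) F
    components : Classes (Step₂ α σ) C
    bound      : E + 2 * C ≤ V + F

-- Removing the dart p from its vertex and making it the only dart of a new vertex.
module Cut {d} (α : Perm d) (σ : Perm d) (p : Fin d) (p≢ : p ≢ Perm.fwd σ p) where
  private
    module α = Perm α
    module σ = Perm σ
    q : Fin d
    q = σ.fwd p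
  open Swap p q

  σ′ : Perm d
  σ′ = _after_ σ

  private
    module σ′ = Perm σ′

  cut-fixes : σ′.fwd p ≡ p
  cut-fixes = swap-q refl

  cut-keeps-fixed : ∀ {z} → σ.fwd z ≡ z → σ′.fwd z ≡ z
  cut-keeps-fixed {z} e = trans (cong swap e) (swap-other z≢p z≢q)
    where
    z≢p : z ≢ p
    z≢p refl = p≢ (sym e)
    z≢q : z ≢ q
    z≢q z≡q = z≢p (σ.fwd-inj (trans e z≡q))

  cut-const : ∀ {B : Set} (c : Fin d → B) → (∀ x → c (σ.fwd x) ≡ c x) → ∀ x → c (σ′.fwd x) ≡ c x
  cut-const c h x = trans (swap-const c (sym (h p)) (σ.fwd x)) (h x)

  -- Sliding `p` onto its successor `q` turns every old rotation step into at most one new step.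
  cut-connected : ∀ {x y} → x ≢ p → y ≢ p → Gen (Step σ.fwd) x y → Gen (Step σ′.fwd) x y
  cut-connected x≢p y≢p g = subst₂ (Gen _) (slide-≢ x≢p) (slide-≢ y≢p) (Gen-map slide step g)
    where
    slide : Fin d → Fin d
    slide z with z ≟ p
    ... | yes _ = q
    ... | no  _ = z
    slide-≢ : ∀ {z} → z ≢ p → slide z ≡ z
    slide-≢ {z} ne with z ≟ p
    ... | yes e = ⊥-elim (ne e)
    ... | no _  = refl
    step : ∀ {x y} → y ≡ σ.fwd x → Gen (Step σ′.fwd) (slide x) (slide y)
    step {x} refl with x ≟ p | σ.fwd x ≟ p
    ... | yes refl | yes _ = rfl
    ... | yes refl | no  _ = rfl
    ... | no x≢ | yes e = gen (sym (swap-p e))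
    ... | no x≢ | no ne = gen (sym (swap-other ne (x≢ ∘ σ.fwd-inj)))

  -- `V` grows by one. If `p` and `q` share a face afterwards, the number of components does not
  -- grow and at most one face is lost. Otherwise they shared a face before that has been split, so
  -- `F` grows as well, which pays for at most one new component.
  cut-euler : ∀ {E} → EulerBound α.fwd σ.fwd E → EulerBound α.fwd σ′.fwd E
  cut-euler {E} M with stepClasses σ′.fwd | stepClasses (σ′.fwd ∘ α.fwd) | step₂Classes α.fwd σ′.fwd
  ... | V′ , vertices′ | F′ , faces′ | C′ , components′ = record
    { vertices = vertices′ ; faces = faces′ ; components = components′ ; bound = bound′ }
    where
    open EulerBound M
    module V = Classes vertices
    module F = Classes faces
    module C = Classes components
    module C′ = Classes components′
    isolated : ¬ Gen (Step σ′.fwd) p q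
    isolated g = p≢ (sym (proj₁ (Gen-pred (_≡ p) closed g) refl))
      where
      closed : ∀ {x y} → y ≡ σ′.fwd x → (x ≡ p → y ≡ p) × (y ≡ p → x ≡ p)
      closed refl = (λ { refl → cut-fixes }) , λ e → σ′.fwd-inj (trans e (sym cut-fixes))
    V-up : suc V ≤ V′
    V-up = strictlyFiner⇒> vertices vertices′ (λ { {x} refl → sym (cut-const V.cls (λ z → sym (V.resp refl)) x) })
             p q (V.resp refl) isolated
    bound′ : E + 2 * C′ ≤ V′ + F′
    bound′ with joinOrSplit (σ ∘ᵖ α) p≢
    ... | inj₁ joined = begin
      E + 2 * C′      ≤⟨ ℕ.+-monoʳ-≤ E (ℕ.*-monoʳ-≤ 2 C-down) ⟩
      E + 2 * C       ≤⟨ bound ⟩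
      V + F           ≤⟨ ℕ.+-monoʳ-≤ V F-down ⟩
      V + suc F′      ≡⟨ ℕ.+-suc V F′ ⟩
      suc V + F′      ≤⟨ ℕ.+-monoˡ-≤ F′ V-up ⟩
      V′ + F′         ∎
      where
      open ℕ.≤-Reasoning
      joined₂ : C′.cls p ≡ C′.cls q
      joined₂ = Gen-const C′.cls (λ { {x} refl → trans (C′.resp (inj₁ refl)) (C′.resp (inj₂ refl)) }) joined
      C-down : C′ ≤ C
      C-down = finer⇒≥ components′ components λ where
        (inj₁ refl)     → C′.resp (inj₁ refl)
        {x} (inj₂ refl) → trans (C′.resp (inj₂ refl)) (swap-const C′.cls joined₂ (σ.fwd x))
      F-down : F ≤ suc F′
      F-down = oneGluing⇒≤ faces faces′ p q λ where
        g g-cls g-pq {x} refl → trans (g-cls (F.resp refl)) (sym (swap-const g g-pq (σ.fwd (α.fwd x))))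
    ... | inj₂ (together , split) = begin
      E + 2 * C′          ≤⟨ ℕ.+-monoʳ-≤ E (ℕ.*-monoʳ-≤ 2 C-up) ⟩
      E + 2 * suc C       ≡⟨ +-*-Solver.solve 2 (λ e c → e :+ con 2 :* (con 1 :+ c) := con 2 :+ (e :+ con 2 :* c)) refl E C ⟩
      2 + (E + 2 * C)     ≤⟨ ℕ.+-monoʳ-≤ 2 bound ⟩
      2 + (V + F)         ≡⟨ +-*-Solver.solve 2 (λ v f → con 2 :+ (v :+ f) := (con 1 :+ v) :+ (con 1 :+ f)) refl V F ⟩
      suc V + suc F       ≤⟨ ℕ.+-mono-≤ V-up F-up ⟩
      V′ + F′             ∎
      where
      open ℕ.≤-Reasoning
      open +-*-Solver using (_:+_; _:*_; con; _:=_)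
      F-up : suc F ≤ F′
      F-up = strictlyFiner⇒> faces faces′
        (λ { {x} refl → trans (F.resp refl) (sym (swap-const F.cls (F.resp* together) (σ.fwd (α.fwd x)))) })
        p q (F.resp* together) split
      C-up : C′ ≤ suc C
      C-up = oneGluing⇒≤ components′ components p q λ where
        g g-cls g-pq     (inj₁ refl) → g-cls (C′.resp (inj₁ refl))
        g g-cls g-pq {x} (inj₂ refl) → trans (g-cls (C′.resp (inj₂ refl))) (swap-const g g-pq (σ.fwd x))

record Pruned {d} (α σ : Perm d) (E : ℕ) (Alive : Fin d → Set) (xs : List (Fin d)) {B : Set} (c : Fin d → B) : Set where
  field
    ρ         : Perm d
    dead-fix  : ∀ {x} → x ∈ xs → ¬ Alive x → Perm.fwd ρ x ≡ x
    same      : ∀ x → c (Perm.fwd ρ x) ≡ c x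
    connected : ∀ {x y} → Alive x → Alive y → Gen (Step (Perm.fwd σ)) x y → Gen (Step (Perm.fwd ρ)) x y
    euler     : EulerBound (Perm.fwd α) (Perm.fwd ρ) E

-- The two darts of a deleted edge are cut off separately. A dart already alone at its vertex is
-- skipped, and `cut-keeps-fixed` ensures that later cuts do not disturb the earlier ones.
prune : ∀ {d} (α σ : Perm d) {E} {Alive : Fin d → Set} → (∀ x → Dec (Alive x)) → {B : Set} (c : Fin d → B) →
        (∀ x → c (Perm.fwd σ x) ≡ c x) → EulerBound (Perm.fwd α) (Perm.fwd σ) E → ∀ xs → Pruned α σ E Alive xs c
prune α σ alive? c h eu [] = record { ρ = σ ; dead-fix = λ () ; same = h ; connected = λ _ _ g → g ; euler = eu }
prune α σ {E} {Alive} alive? c h eu (p ∷ xs) with prune α σ alive? c h eu xs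
... | P with alive? p | p ≟ Perm.fwd (Pruned.ρ P) p
... | yes ap | _     = record { Pruned P ; dead-fix = λ { (here refl) np → ⊥-elim (np ap) ; (there x∈) → Pruned.dead-fix P x∈ } }
... | no _   | yes e = record { Pruned P ; dead-fix = λ { (here refl) _ → sym e ; (there x∈) → Pruned.dead-fix P x∈ } }
... | no np  | no p≢ = record
  { ρ = σ′
  ; dead-fix = λ { (here refl) _ → cut-fixes ; (there x∈) nx → cut-keeps-fixed (dead-fix x∈ nx) }
  ; same = cut-const c same
  ; connected = λ ax ay g → cut-connected (λ { refl → np ax }) (λ { refl → np ay }) (connected ax ay g)
  ; euler = cut-euler euler }
  where
  open Pruned P
  open Cut α ρ p p≢

-- Moving the uncoloured vertex

fewer⇒⊥ : ∀ {xs ys : List ℕ} → Unique xs → (∀ {c} → c ∈ xs → c ∈ ys) → length ys < length xs → ⊥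
fewer⇒⊥ {xs} {ys} uq sub lt with pigeonhole lt (λ i → Any.index (sub (∈-lookup {xs = xs} i)))
... | i , j , i<j , e = ℕ.<-irrefl (cong toℕ (lookup-inj uq i j (trans (at i) (trans (cong (lookup ys) e) (sym (at j)))))) i<j
  where
  at : ∀ i → lookup xs i ≡ lookup ys (Any.index (sub (∈-lookup {xs = xs} i)))
  at i = lookup-index (sub (∈-lookup {xs = xs} i))
  lookup-inj : ∀ {zs : List ℕ} → Unique zs → ∀ i j → lookup zs i ≡ lookup zs j → i ≡ j
  lookup-inj (_ ∷ _)   zero    zero    e = refl
  lookup-inj (z∉ ∷ _)  zero    (suc j) e = ⊥-elim (All.lookup z∉ (∈-lookup j) e)
  lookup-inj (z∉ ∷ _)  (suc i) zero    e = ⊥-elim (All.lookup z∉ (∈-lookup i) (sym e))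
  lookup-inj (_ ∷ uq)  (suc i) (suc j) e = cong suc (lookup-inj uq i j e)

module Neighbours (G : Graph) where
  infix 4 _~_
  _~_ : Fin (Graph.n G) → Fin (Graph.n G) → Set
  _~_ = Adj G

  ~-sym : ∀ {u v} → u ~ v → v ~ u
  ~-sym {u} {v} e = trans (Graph.sym G v u) e

  ~⇒≢ : ∀ {u v} → u ~ v → u ≢ v
  ~⇒≢ {u} e refl with trans (sym e) (Graph.irrefl G u)
  ... | ()

  ≁⇒≢ : ∀ {v u w} → v ~ u → ¬ v ~ w → w ≢ u
  ≁⇒≢ e ne refl = ne e

  _~?_ : ∀ u v → Dec (u ~ v)
  u ~? v = Graph.adj G u v Bool.≟ true

  -- Degree at most 4, in the form used for counting: without any one neighbour, three vertices
  -- cover the rest, too few for the four colours of a list. `SurroundedBy5` says the same after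
  -- leaving out two neighbours.
  SurroundedBy4 : Fin (Graph.n G) → Set
  SurroundedBy4 v = ∀ {w} → v ~ w → Σ (List (Fin (Graph.n G))) λ ws → length ws ≡ 3 × (∀ {z} → v ~ z → z ≢ w → z ∈ ws)

  SurroundedBy5 : Fin (Graph.n G) → Set
  SurroundedBy5 v = ∀ {r w} → v ~ r → v ~ w → w ≢ r →
    Σ (List (Fin (Graph.n G))) λ ws → length ws ≡ 3 × (∀ {z} → v ~ z → z ≢ r → z ≢ w → z ∈ ws)

-- In a graph that is not L-colourable, a colouring of everything but one vertex v ("the hole") uses
-- every colour of L v around v; a colour occurring only once there can be moved into v, which moves the hole.
module Holes (G : Graph) (L : Fin (Graph.n G) → List ℕ) (asg : IsAssignment G 4 L) (uncolourable : ¬ LColorable G L) where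
  open Neighbours G
  private
    V : Set
    V = Fin (Graph.n G)

  record HoleAt (v : V) (φ : V → ℕ) : Set where
    field
      listed : ∀ {w} → w ≢ v → φ w ∈ L w
      proper : ∀ {w z} → w ≢ v → z ≢ v → w ~ z → φ w ≢ φ z
  open HoleAt

  private
    recolour : (V → ℕ) → V → ℕ → V → ℕ
    recolour φ v c w with w ≟ v
    ... | yes _ = c
    ... | no  _ = φ w

    recolour-≡ : ∀ φ v c → recolour φ v c v ≡ c
    recolour-≡ φ v c with v ≟ v
    ... | yes _ = refl
    ... | no ne = ⊥-elim (ne refl)

    recolour-≢ : ∀ φ v c {w} → w ≢ v → recolour φ v c w ≡ φ w
    recolour-≢ φ v c {w} ne with w ≟ v
    ... | yes e = ⊥-elim (ne e)
    ... | no _  = refl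

  opaque
    around : ∀ {v φ} → HoleAt v φ → ∀ {c} → c ∈ L v → ∃ λ w → v ~ w × φ w ≡ c
    around {v} {φ} H {c} c∈ with any? (λ w → (v ~? w) ×-dec (φ w ℕ.≟ c))
    ... | yes p = p
    ... | no np = ⊥-elim (uncolourable (recolour φ v c , inL , prop))
      where
      inL : ∀ w → recolour φ v c w ∈ L w
      inL w with w ≟ v
      ... | yes refl = c∈
      ... | no ne    = listed H ne
      prop : ∀ w z → w ~ z → recolour φ v c w ≢ recolour φ v c z
      prop w z e with w ≟ v | z ≟ v
      ... | yes refl | yes refl = λ _ → ~⇒≢ e refl
      ... | yes refl | no _     = λ c≡ → np (z , e , sym c≡)
      ... | no _     | yes refl = λ ≡c → np (w , ~-sym e , ≡c)
      ... | no a     | no b     = proper H a b e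

  -- `w` can hand its colour to `v` and become the hole. The alternative, `Spare`, is that the
  -- neighbours of `v` other than `w` already show every colour of `L v`.
  Movable : (V → ℕ) → V → V → Set
  Movable φ v w = φ w ∈ L v × (∀ {z} → v ~ z → φ z ≡ φ w → z ≡ w)

  Spare : (V → ℕ) → V → V → Set
  Spare φ v w = ∀ {c} → c ∈ L v → ∃ λ z → v ~ z × z ≢ w × φ z ≡ c

  opaque
    movable∨spare : ∀ {v φ} → HoleAt v φ → ∀ w → Movable φ v w ⊎ Spare φ v w
    movable∨spare {v} {φ} H w with φ w ∈? L v
                                 | any? (λ z → (v ~? z) ×-dec ((φ z ℕ.≟ φ w) ×-dec ¬? (z ≟ w)))
    ... | yes w∈ | no unique = inj₁ (w∈ , λ {z} v~z e → decidable-stable (z ≟ w) (λ ne → unique (z , v~z , e , ne)))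
    ... | _ | yes (z , v~z , e , ne) = inj₂ λ c∈ → case (around H c∈)
      where
      case : ∀ {c} → (∃ λ x → v ~ x × φ x ≡ c) → ∃ λ x → v ~ x × x ≢ w × φ x ≡ c
      case (x , v~x , ex) with x ≟ w
      ... | yes refl = z , v~z , ne , trans e ex
      ... | no nx    = x , v~x , nx , ex
    ... | no w∉ | no _ = inj₂ λ c∈ → case c∈ (around H c∈)
      where
      case : ∀ {c} → c ∈ L v → (∃ λ x → v ~ x × φ x ≡ c) → ∃ λ x → v ~ x × x ≢ w × φ x ≡ c
      case c∈ (x , v~x , ex) = x , v~x , (λ { refl → w∉ (subst (_∈ L v) (sym ex) c∈) }) , ex

  opaque
    -- No conflict arises at `v`: its only neighbour with the new colour is `w`, which is now the
    -- hole.
    shift : ∀ {v φ w} → HoleAt v φ → v ~ w → Movable φ v w →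
            ∃ λ φ′ → HoleAt w φ′ × φ′ v ≡ φ w × (∀ {z} → z ≢ v → φ′ z ≡ φ z)
    shift {v} {φ} {w} H v~w (w∈ , unique) =
      φ′ , record { listed = inL ; proper = prop } , recolour-≡ φ v (φ w) , recolour-≢ φ v (φ w)
      where
      φ′ : V → ℕ
      φ′ = recolour φ v (φ w)
      inL : ∀ {z} → z ≢ w → φ′ z ∈ L z
      inL {z} _ with z ≟ v
      ... | yes refl = w∈
      ... | no ne    = listed H ne
      prop : ∀ {x y} → x ≢ w → y ≢ w → x ~ y → φ′ x ≢ φ′ y
      prop {x} {y} nx ny e with x ≟ v | y ≟ v
      ... | yes refl | yes refl = λ _ → ~⇒≢ e refl
      ... | yes refl | no _     = λ c≡ → ny (unique e (sym c≡))
      ... | no _     | yes refl = λ ≡c → nx (unique (~-sym e) ≡c)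
      ... | no a     | no b     = proper H a b e

  opaque
    threeColours⇒⊥ : ∀ {v} {φ : V → ℕ} (ws : List V) → length ws ≡ 3 → (∀ {c} → c ∈ L v → ∃ λ z → z ∈ ws × φ z ≡ c) → ⊥
    threeColours⇒⊥ {v} {φ} ws len h = fewer⇒⊥ {ys = map φ ws} (proj₂ (asg v)) sub
      (subst₂ _<_ (sym (trans (length-map φ ws) len)) (sym (proj₁ (asg v))) ℕ.≤-refl)
      where
      sub : ∀ {c} → c ∈ L v → c ∈ map φ ws
      sub c∈ with h c∈
      ... | z , z∈ , refl = ∈-map⁺ φ z∈

  Tight : V → Set
  Tight v = ∀ {φ} → HoleAt v φ → ∀ {w} → v ~ w → Movable φ v w

  opaque
    -- If `w` were spare, the three vertices covering the other neighbours would show four colours.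
    tight : ∀ {v} → SurroundedBy4 v → Tight v
    tight {v} S {φ} H {w} v~w with movable∨spare H w | S v~w
    ... | inj₁ m | _ = m
    ... | inj₂ s | ws , len , covers = ⊥-elim (threeColours⇒⊥ {φ = φ} ws len λ c∈ → case (s c∈))
      where
      case : ∀ {c} → (∃ λ z → v ~ z × z ≢ w × φ z ≡ c) → ∃ λ z → z ∈ ws × φ z ≡ c
      case (z , v~z , ne , e) = z , covers v~z ne , e

  record Quad (v a q b : V) : Set where
    field
      v~a : v ~ a
      a~q : a ~ q
      q~b : q ~ b
      v~b : v ~ b
      a≢b : a ≢ b
      q≢v : q ≢ v
      v≁q : ¬ v ~ q
      a≁b : ¬ a ~ b
      tight-a : Tight a
      tight-q : Tight q
      tight-b : Tight b

  mirror : ∀ {v a q b} → Quad v a q b → Quad v b q a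
  mirror Q = record
    { v~a = v~b ; a~q = ~-sym q~b ; q~b = ~-sym a~q ; v~b = v~a ; a≢b = λ e → a≢b (sym e) ; q≢v = q≢v ; v≁q = v≁q
    ; a≁b = λ e → a≁b (~-sym e) ; tight-a = tight-b ; tight-q = tight-q ; tight-b = tight-a }
    where open Quad Q

  opaque
    -- Only the step out of `v` needs a hypothesis. From `a` and `q` the hole can always go on,
    -- since they are tight.
    moveAlong : ∀ {v a q b φ} → Quad v a q b → HoleAt v φ → Movable φ v a →
                ∃ λ φ′ → HoleAt b φ′ × φ′ v ≡ φ a × φ′ a ≡ φ q × φ′ q ≡ φ b × (∀ {z} → z ≢ v → z ≢ a → z ≢ q → φ′ z ≡ φ z)
    moveAlong {v} {a} {q} {b} Q H m with shift H (Quad.v~a Q) m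
    ... | φ₁ , H₁ , v₁ , o₁ with shift H₁ (Quad.a~q Q) (Quad.tight-a Q H₁ (Quad.a~q Q))
    ... | φ₂ , H₂ , a₂ , o₂ with shift H₂ (Quad.q~b Q) (Quad.tight-q Q H₂ (Quad.q~b Q))
    ... | φ₃ , H₃ , q₃ , o₃ = φ₃ , H₃
      , trans (o₃ (λ e → q≢v (sym e))) (trans (o₂ (~⇒≢ v~a)) v₁)
      , trans (o₃ (~⇒≢ a~q)) (trans a₂ (o₁ q≢v))
      , trans q₃ (trans (o₂ (λ e → a≢b (sym e))) (o₁ (λ e → ~⇒≢ v~b (sym e))))
      , λ nv na nq → trans (o₃ nq) (trans (o₂ na) (o₁ nv))
      where open Quad Q

  opaque
    rotate : ∀ {v a q b φ} → Quad v a q b → HoleAt v φ → Movable φ v a →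
             ∃ λ φ′ → HoleAt v φ′ × φ′ a ≡ φ q × φ′ q ≡ φ b × φ′ b ≡ φ a × (∀ {z} → z ≢ v → z ≢ a → z ≢ q → z ≢ b → φ′ z ≡ φ z)
    rotate {v} {a} {q} {b} Q H m with moveAlong Q H m
    ... | φ₃ , H₃ , v₃ , a₃ , q₃ , o₃ with shift H₃ (~-sym (Quad.v~b Q)) (Quad.tight-b Q H₃ (~-sym (Quad.v~b Q)))
    ... | φ₄ , H₄ , b₄ , o₄ = φ₄ , H₄
      , trans (o₄ a≢b) a₃
      , trans (o₄ (~⇒≢ q~b)) q₃
      , trans b₄ v₃
      , λ nv na nq nb → trans (o₄ nb) (o₃ nv na nq)
      where open Quad Q

  -- φ q ≠ φ b, so trading the colours φ a, φ b around v for φ a, φ q shows that φ b was not needed.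
  opaque
    oppositeSpare : ∀ {v a q b φ} → Quad v a q b → HoleAt v φ → Movable φ v a → Spare φ v b
    oppositeSpare {v} {a} {q} {b} {φ} Q H m {c} c∈ with rotate Q H m
    ... | φ′ , H′ , a′ , q′ , b′ , o′ with around H′ c∈
    ... | w , v~w , e with w ≟ a | w ≟ b
    ... | _ | yes refl = a , v~a , a≢b , trans (sym b′) e
      where open Quad Q
    ... | no na | no nb = w , v~w , nb , trans (sym (o′ (λ { refl → ~⇒≢ v~w refl }) na (λ { refl → v≁q v~w }) nb)) e
      where open Quad Q
    ... | yes refl | no _ with around H c∈
    ...   | z , v~z , ez = z , v~z , (λ { refl → proper H q≢v (λ e₁ → ~⇒≢ v~b (sym e₁)) q~b (trans (sym a′) (trans e (sym ez))) }) , ez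
      where open Quad Q

  opaque
    -- `b` is movable because `v` is tight, and spare because `a` is movable; its colour cannot be
    -- both unique and repeated.
    tightQuad⇒⊥ : ∀ {v a q b φ} → Quad v a q b → Tight v → HoleAt v φ → ⊥
    tightQuad⇒⊥ Q t H with t H (Quad.v~b Q)
    ... | b∈ , unique with oppositeSpare Q H (t H (Quad.v~a Q)) b∈
    ... | z , v~z , z≢b , e = z≢b (unique v~z e)

  opaque
    -- The main tool at degree 5, where four colours on five neighbours leave room for little
    -- redundancy: every quadrilateral at the hole uses some of it up.
    spareEnd : ∀ {v a q b φ} → Quad v a q b → HoleAt v φ → Spare φ v a ⊎ Spare φ v b
    spareEnd {a = a} Q H with movable∨spare H a
    ... | inj₁ m = inj₂ (oppositeSpare Q H m)
    ... | inj₂ s = inj₁ s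

  -- Several quadrilaterals at a hole of degree 5

  module _ {v : V} (S : SurroundedBy5 v) where

    opaque
      -- Apart from `r` at most four neighbours remain, and they show all four colours of `L v`. So
      -- each of them has a colour of the list, and no two have the same.
      others : ∀ {φ r w} → HoleAt v φ → Spare φ v r → v ~ r → v ~ w → w ≢ r →
               φ w ∈ L v × (∀ {z} → v ~ z → z ≢ r → φ z ≡ φ w → z ≡ w)
      others {φ} {r} {w} H s v~r v~w w≢r with S v~r v~w w≢r
      ... | ws , len , covers = w∈ , unique
        where
        w∈ : φ w ∈ L v
        w∈ with φ w ∈? L v
        ... | yes p = p
        ... | no w∉ = ⊥-elim (threeColours⇒⊥ {φ = φ} ws len λ c∈ → case c∈ (s c∈))
          where
          case : ∀ {c} → c ∈ L v → (∃ λ z → v ~ z × z ≢ r × φ z ≡ c) → ∃ λ z → z ∈ ws × φ z ≡ c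
          case c∈ (z , v~z , ne , e) = z , covers v~z ne (λ { refl → w∉ (subst (_∈ L v) (sym e) c∈) }) , e
        unique : ∀ {z} → v ~ z → z ≢ r → φ z ≡ φ w → z ≡ w
        unique {z} v~z z≢r e = decidable-stable (z ≟ w) λ z≢w →
          threeColours⇒⊥ {φ = φ} ws len λ c∈ → case z≢w (s c∈)
          where
          case : z ≢ w → ∀ {c} → (∃ λ x → v ~ x × x ≢ r × φ x ≡ c) → ∃ λ x → x ∈ ws × φ x ≡ c
          case z≢w (x , v~x , ne , ex) with x ≟ w
          ... | yes refl = z , covers v~z z≢r z≢w , trans e ex
          ... | no x≢w   = x , covers v~x ne x≢w , ex

    opaque
      othersMovable : ∀ {φ r w} → HoleAt v φ → Spare φ v r → v ~ r → v ~ w → w ≢ r → φ r ≢ φ w → Movable φ v w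
      othersMovable {φ} {r} {w} H s v~r v~w w≢r ne with others H s v~r v~w w≢r
      ... | w∈ , unique = w∈ , uq
        where
        uq : ∀ {z} → v ~ z → φ z ≡ φ w → z ≡ w
        uq {z} v~z e with z ≟ r
        ... | yes refl = ⊥-elim (ne e)
        ... | no z≢r   = unique v~z z≢r e

    opaque
      -- As `s` is spare, its colour occurs at a second neighbour, and by `others` only `r` can
      -- repeat a colour.
      sparesEqual : ∀ {φ r s} → HoleAt v φ → Spare φ v r → Spare φ v s → v ~ r → v ~ s → s ≢ r → φ r ≡ φ s
      sparesEqual {φ} {r} {s} H sr ss v~r v~s s≢r with others H sr v~r v~s s≢r
      ... | s∈ , unique with ss s∈
      ... | z , v~z , z≢s , e with z ≟ r
      ... | yes refl = e
      ... | no z≢r   = ⊥-elim (z≢s (unique v~z z≢r e))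

    private
      opaque
        -- After rotating `Q`, the vertex `b` has the only copy of `φ a` around `v`, so `Q′` must
        -- make `e` spare. The colour of `e` then occurs a second time, and only at `a`, which has
        -- received `φ q`.
        farColour : ∀ {a q b q′ e φ} → Quad v a q b → Quad v b q′ e → a ≢ e → HoleAt v φ → Spare φ v b → φ b ≢ φ a → φ q ≡ φ e
        farColour {a} {q} {b} {q′} {e} {φ} Q Q′ a≢e H s ne = result (rotate Q H ma)
          where
          open Quad Q
          ma : Movable φ v a
          ma = othersMovable H s v~b v~a a≢b ne
          e≢b : e ≢ b
          e≢b x = Quad.a≢b Q′ (sym x)
          result : (∃ λ φ′ → HoleAt v φ′ × φ′ a ≡ φ q × φ′ q ≡ φ b × φ′ b ≡ φ a × (∀ {z} → z ≢ v → z ≢ a → z ≢ q → z ≢ b → φ′ z ≡ φ z)) → φ q ≡ φ e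
          result (φ′ , H′ , a′ , q′≡ , b′ , o′) with spareEnd Q′ H′
          ... | inj₁ sb = ⊥-elim (case (sb (proj₁ ma)))
            where
            case : (∃ λ z → v ~ z × z ≢ b × φ′ z ≡ φ a) → ⊥
            case (z , v~z , z≢b , ez) with z ≟ a
            ... | yes refl = proper H (λ x → ~⇒≢ v~a (sym x)) q≢v a~q (trans (sym ez) a′)
            ... | no z≢a   = z≢a (proj₂ ma v~z (trans (sym (o′ (λ { refl → ~⇒≢ v~z refl }) z≢a (λ { refl → v≁q v~z }) z≢b)) ez))
          ... | inj₂ se with others H s v~b (Quad.v~b Q′) e≢b
          ...   | e∈ , unique with se e∈
          ...     | z , v~z , z≢e , ez with z ≟ a | z ≟ b
          ...       | yes refl | _        = trans (sym a′) ez
          ...       | no _     | yes refl = ⊥-elim (a≢e (unique v~a a≢b (trans (sym b′) ez)))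
          ...       | no z≢a   | no z≢b   =
            ⊥-elim (z≢e (unique v~z z≢b (trans (sym (o′ (λ { refl → ~⇒≢ v~z refl }) z≢a (λ { refl → v≁q v~z }) z≢b)) ez)))

      opaque
        -- If `b` shares its colour with `a` or `e`, then `farColour` for the other side gives `q′`
        -- or `q` the colour of its neighbour `b`. Otherwise `φ q` is `φ e` and `φ q′` is `φ a`;
        -- moving the hole along `Q` to `b` brings `φ a` to `v`, so the tight vertex `b` sees that
        -- colour at both `v` and `q′`.
        middleSpare⇒⊥ : ∀ {a q b q′ e φ} → Quad v a q b → Quad v b q′ e → a ≢ e → HoleAt v φ → Spare φ v b → ⊥
        middleSpare⇒⊥ {a} {q} {b} {q′} {e} {φ} Q Q′ a≢e H s with φ b ℕ.≟ φ a
        ... | yes eq = proper H Q′.q≢v (λ x → ~⇒≢ v~b (sym x)) (~-sym Q′.a~q)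
                         (trans (farColour (mirror Q′) (mirror Q) (λ x → a≢e (sym x)) H s φb≢φe) (sym eq))
          where
          open Quad Q
          module Q′ = Quad Q′
          φb≢φe : φ b ≢ φ e
          φb≢φe x = a≢e (sym (proj₂ (others H s v~b v~a a≢b) Q′.v~b (λ y → Q′.a≢b (sym y)) (trans (sym x) eq)))
        ... | no ne with φ b ℕ.≟ φ e
        ... | yes eq = proper H q≢v (λ x → ~⇒≢ v~b (sym x)) q~b (trans (farColour Q Q′ a≢e H s ne) (sym eq))
          where open Quad Q
        ... | no ne′ with moveAlong Q H (othersMovable H s (Quad.v~b Q) (Quad.v~a Q) (Quad.a≢b Q) ne)
        ... | φ₃ , H₃ , v₃ , a₃ , q₃ , o₃ =
          Q′.q≢v (sym (proj₂ (tight-b H₃ Q′.a~q) (~-sym v~b) (trans v₃ (sym (trans (o₃ Q′.q≢v (≁⇒≢ v~a Q′.v≁q) q′≢q) φq′)))))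
          where
          open Quad Q
          module Q′ = Quad Q′
          φq′ : φ q′ ≡ φ a
          φq′ = farColour (mirror Q′) (mirror Q) (λ x → a≢e (sym x)) H s ne′
          q′≢q : q′ ≢ q
          q′≢q refl = proper H q≢v (λ x → ~⇒≢ Q′.v~b (sym x)) Q′.q~b (farColour Q Q′ a≢e H s ne)

    opaque
      consecutiveQuads⇒⊥ : ∀ {a q b q′ e φ} → Quad v a q b → Quad v b q′ e → a ≢ e → HoleAt v φ → ⊥
      consecutiveQuads⇒⊥ {a} {q} {b} {q′} {e} {φ} Q Q′ a≢e H with spareEnd Q H | spareEnd Q′ H
      ... | inj₂ sb | _       = middleSpare⇒⊥ Q Q′ a≢e H sb
      ... | inj₁ _  | inj₁ sb = middleSpare⇒⊥ Q Q′ a≢e H sb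
      ... | inj₁ sa | inj₂ se = result (rotate (mirror Q) H mb)
        where
        open Quad Q
        module Q′ = Quad Q′
        e≢a : e ≢ a
        e≢a x = a≢e (sym x)
        e≢b : e ≢ b
        e≢b x = Q′.a≢b (sym x)
        a≡e : φ a ≡ φ e
        a≡e = sparesEqual H sa se v~a Q′.v~b e≢a
        φa≢φb : φ a ≢ φ b
        φa≢φb x = e≢b (proj₂ (others H sa v~a v~b (λ y → a≢b (sym y))) Q′.v~b e≢a (trans (sym a≡e) x))
        mb : Movable φ v b
        mb = othersMovable H sa v~a v~b (λ y → a≢b (sym y)) φa≢φb
        result : (∃ λ φ′ → HoleAt v φ′ × φ′ b ≡ φ q × φ′ q ≡ φ a × φ′ a ≡ φ b × (∀ {z} → z ≢ v → z ≢ b → z ≢ q → z ≢ a → φ′ z ≡ φ z)) → ⊥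
        result (φ′ , H′ , b′ , q′≡ , a′ , o′) = middleSpare⇒⊥ Q Q′ a≢e H′ λ c∈ → case (sa c∈)
          where
          case : ∀ {c} → (∃ λ z → v ~ z × z ≢ a × φ z ≡ c) → ∃ λ z → v ~ z × z ≢ b × φ′ z ≡ c
          case (z , v~z , z≢a , ez) with z ≟ b
          ... | yes refl = a , v~a , a≢b , trans a′ ez
          ... | no z≢b   = z , v~z , z≢b , trans (o′ (λ { refl → ~⇒≢ v~z refl }) z≢b (λ { refl → v≁q v~z }) z≢a) ez

    private
      module TwoSpares {r q r′ s q′ s′ φ} (Q : Quad v r q r′) (Q′ : Quad v s q′ s′)
                       (s≢r : s ≢ r) (s≢r′ : s ≢ r′) (s′≢r : s′ ≢ r) (s′≢r′ : s′ ≢ r′)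
                       (H : HoleAt v φ) (sr : Spare φ v r) (ss : Spare φ v s) where
        open Quad Q
        module Q′ = Quad Q′
        r≡s : φ r ≡ φ s
        r≡s = sparesEqual H sr ss v~a Q′.v~a s≢r
        r′≢r : r′ ≢ r
        r′≢r x = a≢b (sym x)
        s∈ : φ s ∈ L v
        s∈ = proj₁ (others H sr v~a Q′.v~a s≢r)
        only-s : ∀ {z} → v ~ z → z ≢ r → φ z ≡ φ s → z ≡ s
        only-s = proj₂ (others H sr v~a Q′.v~a s≢r)
        s′∈ : φ s′ ∈ L v
        s′∈ = proj₁ (others H sr v~a Q′.v~b s′≢r)
        only-s′ : ∀ {z} → v ~ z → z ≢ r → φ z ≡ φ s′ → z ≡ s′
        only-s′ = proj₂ (others H sr v~a Q′.v~b s′≢r)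
        φr≢φr′ : φ r ≢ φ r′
        φr≢φr′ x = s≢r′ (sym (only-s v~b r′≢r (trans (sym x) r≡s)))
        φr′≢φs′ : φ r′ ≢ φ s′
        φr′≢φs′ x = s′≢r′ (sym (only-s′ v~b r′≢r x))
        φr′≢φs : φ r′ ≢ φ s
        φr′≢φs x = s≢r′ (sym (only-s v~b r′≢r x))
        φs≢φs′ : φ s ≢ φ s′
        φs≢φs′ x = Q′.a≢b (only-s′ Q′.v~a s≢r x)
        opaque
          rotated : ∃ λ φ′ → HoleAt v φ′ × φ′ r′ ≡ φ q × φ′ q ≡ φ r × φ′ r ≡ φ r′ × (∀ {z} → z ≢ v → z ≢ r′ → z ≢ q → z ≢ r → φ′ z ≡ φ z)
          rotated = rotate (mirror Q) H (othersMovable H sr v~a v~b r′≢r φr≢φr′)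

        opaque
          -- The rotation leaves `s` with the only copy of `φ s` around `v`, so `Q′` must make `s′`
          -- spare. The second copy of `φ s′` can only be the colour `φ q` that has arrived at `r′`.
          φq≡φs′ : φ q ≡ φ s′
          φq≡φs′ with rotated
          ... | φ′ , H′ , r′≡ , _ , r≡ , o′ with spareEnd Q′ H′
          ... | inj₁ s₁ = ⊥-elim (case (s₁ s∈))
            where
            case : (∃ λ z → v ~ z × z ≢ s × φ′ z ≡ φ s) → ⊥
            case (z , v~z , z≢s , e) with z ≟ r | z ≟ r′
            ... | yes refl | _        = φr′≢φs (trans (sym r≡) e)
            ... | no _     | yes refl = proper H (λ x → ~⇒≢ v~a (sym x)) q≢v a~q (trans r≡s (trans (sym e) r′≡))
            ... | no z≢r   | no z≢r′  = z≢s (only-s v~z z≢r (trans (sym (o′ (λ { refl → ~⇒≢ v~z refl }) z≢r′ (λ { refl → v≁q v~z }) z≢r)) e))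
          ... | inj₂ s₁ with s₁ s′∈
          ... | z , v~z , z≢s′ , e with z ≟ r | z ≟ r′
          ... | yes refl | _        = ⊥-elim (φr′≢φs′ (trans (sym r≡) e))
          ... | no _     | yes refl = trans (sym r′≡) e
          ... | no z≢r   | no z≢r′  = ⊥-elim (z≢s′ (only-s′ v~z z≢r (trans (sym (o′ (λ { refl → ~⇒≢ v~z refl }) z≢r′ (λ { refl → v≁q v~z }) z≢r)) e)))

        r≁s : ¬ r ~ s
        r≁s e = proper H (λ x → ~⇒≢ v~a (sym x)) (λ x → ~⇒≢ Q′.v~a (sym x)) e r≡s

        module _ (φq′≡φr′ : φ q′ ≡ φ r′) where
          opaque
            movedToS′ : ∃ λ φ₁ → HoleAt s′ φ₁ × φ₁ v ≡ φ s′ × (∀ {z} → z ≢ v → φ₁ z ≡ φ z)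
            movedToS′ = shift H Q′.v~b (othersMovable H sr v~a Q′.v~b s′≢r (λ x → φs≢φs′ (trans (sym r≡s) x)))

          opaque
            r′∈ : φ r′ ∈ L s′
            r′∈ with movedToS′
            ... | φ₁ , H₁ , v₁ , o₁ =
              subst (_∈ L s′) (trans (o₁ Q′.q≢v) φq′≡φr′) (proj₁ (Q′.tight-b H₁ (~-sym Q′.q~b)))

          opaque
            only-q′ : ∀ {z} → s′ ~ z → z ≢ v → φ z ≡ φ r′ → z ≡ q′
            only-q′ {z} s′~z z≢v e with movedToS′
            ... | φ₁ , H₁ , v₁ , o₁ = proj₂ (Q′.tight-b H₁ (~-sym Q′.q~b)) s′~z
              (trans (o₁ z≢v) (trans e (sym (trans (o₁ Q′.q≢v) φq′≡φr′))))

          r′≁s′ : ¬ r′ ~ s′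
          r′≁s′ e = Q′.v≁q (subst (v ~_) (only-q′ (~-sym e) (λ x → ~⇒≢ v~b (sym x)) refl) v~b)

          q′≢q : q′ ≢ q
          q′≢q refl = proper H q≢v (λ x → ~⇒≢ Q′.v~b (sym x)) Q′.q~b φq≡φs′

          opaque
            -- The colour `φ r′` belongs to `L s′`, and before the moves only `q′` showed it around
            -- `s′`. Rotating `Q` and then taking the hole through `s` and `q′` to `s′` removes it
            -- from `q′` and puts it on `r`; since the hole at `s′` must still see it, `r` is a
            -- neighbour.
            r~s′ : r ~ s′
            r~s′ with rotated
            ... | φ′ , H′ , r′≡ , q≡ , r≡ , o′ = result (moveAlong Q′ H′ ms)
              where
              φ′s : φ′ s ≡ φ s
              φ′s = o′ (λ x → ~⇒≢ Q′.v~a (sym x)) s≢r′ (λ { refl → v≁q Q′.v~a }) s≢r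
              ms : Movable φ′ v s
              ms = subst (_∈ L v) (sym φ′s) s∈ , uq
                where
                uq : ∀ {z} → v ~ z → φ′ z ≡ φ′ s → z ≡ s
                uq {z} v~z e with z ≟ r | z ≟ r′
                ... | yes refl | _        = ⊥-elim (φr′≢φs (trans (sym r≡) (trans e φ′s)))
                ... | no _     | yes refl = ⊥-elim (φs≢φs′ (trans (sym φ′s) (trans (sym e) (trans r′≡ φq≡φs′))))
                ... | no z≢r   | no z≢r′  =
                  only-s v~z z≢r (trans (sym (o′ (λ { refl → ~⇒≢ v~z refl }) z≢r′ (λ { refl → v≁q v~z }) z≢r)) (trans e φ′s))
              result : (∃ λ φ₃ → HoleAt s′ φ₃ × φ₃ v ≡ φ′ s × φ₃ s ≡ φ′ q′ × φ₃ q′ ≡ φ′ s′ × (∀ {z} → z ≢ v → z ≢ s → z ≢ q′ → φ₃ z ≡ φ′ z)) → r ~ s′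
              result (φ₃ , H₃ , v₃ , s₃ , q₃ , o₃) with around H₃ r′∈
              ... | w , s′~w , e with w ≟ r
              ... | yes refl = ~-sym s′~w
              ... | no w≢r with w ≟ v
              ... | yes refl = ⊥-elim (φr′≢φs (trans (sym e) (trans v₃ φ′s)))
              ... | no w≢v with w ≟ s
              ... | yes refl = ⊥-elim (Q′.a≁b (~-sym s′~w))
              ... | no w≢s with w ≟ q′
              ... | yes refl = ⊥-elim (φr′≢φs′ (trans (sym e) (trans q₃ (o′ (λ x → ~⇒≢ Q′.v~b (sym x)) s′≢r′ (λ { refl → v≁q Q′.v~b }) s′≢r))))
              ... | no w≢q′ with w ≟ r′
              ... | yes refl = ⊥-elim (φr′≢φs′ (trans (sym e) (trans (o₃ w≢v w≢s w≢q′) (trans r′≡ φq≡φs′))))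
              ... | no w≢r′ with w ≟ q
              ... | yes refl = ⊥-elim (φr≢φr′ (trans (sym q≡) (trans (sym (o₃ w≢v w≢s w≢q′)) e)))
              ... | no w≢q = ⊥-elim (w≢q′ (only-q′ s′~w w≢v (trans (sym (o′ w≢v w≢r′ w≢q w≢r)) (trans (sym (o₃ w≢v w≢s w≢q′)) e))))

      opaque
        twoSpares : ∀ {r q r′ s q′ s′ φ} → Quad v r q r′ → Quad v s q′ s′ → s ≢ r → s ≢ r′ → s′ ≢ r → s′ ≢ r′ →
                    HoleAt v φ → Spare φ v r → Spare φ v s → r ~ s′ × r′ ~ s × ¬ r ~ s × ¬ r′ ~ s′
        twoSpares {r} {q} {r′} {s} {q′} {s′} Q Q′ n₁ n₂ n₃ n₄ H sr ss =
          A.r~s′ B.φq≡φs′ , ~-sym (B.r~s′ A.φq≡φs′) , A.r≁s , A.r′≁s′ B.φq≡φs′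
          where
          module A = TwoSpares Q Q′ n₁ n₂ n₃ n₄ H sr ss
          module B = TwoSpares Q′ Q (λ x → n₁ (sym x)) (λ x → n₃ (sym x)) (λ x → n₂ (sym x)) (λ x → n₄ (sym x)) H ss sr

    opaque
      disjointQuads : ∀ {a q b c q′ e φ} → Quad v a q b → Quad v c q′ e → c ≢ a → c ≢ b → e ≢ a → e ≢ b → HoleAt v φ →
                      (a ~ e × b ~ c × ¬ a ~ c × ¬ b ~ e) ⊎ (a ~ c × b ~ e × ¬ a ~ e × ¬ b ~ c)
      disjointQuads Q Q′ n₁ n₂ n₃ n₄ H with spareEnd Q H | spareEnd Q′ H
      ... | inj₁ sa | inj₁ sc = inj₁ (twoSpares Q Q′ n₁ n₂ n₃ n₄ H sa sc)
      ... | inj₁ sa | inj₂ se = inj₂ (twoSpares Q (mirror Q′) n₃ n₄ n₁ n₂ H sa se)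
      ... | inj₂ sb | inj₁ sc with twoSpares (mirror Q) Q′ n₂ n₁ n₄ n₃ H sb sc
      ...   | x , y , z , w = inj₂ (y , x , w , z)
      disjointQuads Q Q′ n₁ n₂ n₃ n₄ H | inj₂ sb | inj₂ se with twoSpares (mirror Q) (mirror Q′) n₄ n₃ n₂ n₁ H sb se
      ...   | x , y , z , w = inj₁ (y , x , w , z)

-- Local structure

-- Deleted edges stay in the map as dead darts, each fixed by the rotation: a dead edge is a component with V = 2 and F = 1,
-- so it does not affect V − E + F − 2C.
record PlaneMap (G : Graph) : Set₁ where
  field
    {d}      : ℕ
    α        : Fin d → Fin d
    α-inv    : ∀ x → α (α x) ≡ x
    α-fix    : ∀ x → α x ≢ x
    rotation : Perm d
    Alive    : Fin d → Set
    alive?   : ∀ x → Dec (Alive x)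
    alive-α  : ∀ {x} → Alive x → Alive (α x)
    dead-fix : ∀ {x} → ¬ Alive x → Perm.fwd rotation x ≡ x
    vert     : Fin d → Fin (Graph.n G)
    vert-σ   : ∀ x → vert (Perm.fwd rotation x) ≡ vert x
    orbit    : ∀ {x y} → Alive x → Alive y → vert x ≡ vert y → Gen (Step (Perm.fwd rotation)) x y
    simple   : ∀ {x y} → Alive x → Alive y → vert x ≡ vert y → vert (α x) ≡ vert (α y) → x ≡ y
    adj      : ∀ {x} → Alive x → Adj G (vert x) (vert (α x))
    dart     : ∀ {u v} → Adj G u v → ∃ λ x → Alive x × vert x ≡ u × vert (α x) ≡ v
    {edges}  : ℕ
    darts≤   : d ≤ 2 * edges
    euler    : EulerBound α (Perm.fwd rotation) edges

  σ σ⁻ φ φ⁻ : Fin d → Fin d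
  σ   = Perm.fwd rotation
  σ⁻  = Perm.bwd rotation
  φ x  = σ (α x)
  φ⁻ x = α (σ⁻ x)

  σσ⁻ : ∀ x → σ (σ⁻ x) ≡ x
  σσ⁻ = Perm.fwd-bwd rotation

  σ⁻σ : ∀ x → σ⁻ (σ x) ≡ x
  σ⁻σ = Perm.bwd-fwd rotation

  facePerm : Perm d
  facePerm = record
    { fwd = φ ; bwd = φ⁻
    ; fwd-bwd = λ x → trans (cong σ (α-inv (σ⁻ x))) (σσ⁻ x)
    ; bwd-fwd = λ x → trans (cong α (σ⁻σ (α x))) (α-inv x) }

  σ-inj : ∀ {x y} → σ x ≡ σ y → x ≡ y
  σ-inj = Perm.fwd-inj rotation

  φ-inj : ∀ {x y} → φ x ≡ φ y → x ≡ y
  φ-inj = Perm.fwd-inj facePerm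

  φφ⁻ : ∀ x → φ (φ⁻ x) ≡ x
  φφ⁻ = Perm.fwd-bwd facePerm

  φ⁻φ : ∀ x → φ⁻ (φ x) ≡ x
  φ⁻φ = Perm.bwd-fwd facePerm

  φα : ∀ x → φ (α x) ≡ σ x
  φα x = cong σ (α-inv x)

  head : Fin d → Fin (Graph.n G)
  head x = vert (α x)

  head-α : ∀ x → head (α x) ≡ vert x
  head-α x = cong vert (α-inv x)

  vert-φ : ∀ x → vert (φ x) ≡ head x
  vert-φ x = vert-σ (α x)

  vert-σ⁻ : ∀ x → vert (σ⁻ x) ≡ vert x
  vert-σ⁻ x = trans (sym (vert-σ (σ⁻ x))) (cong vert (σσ⁻ x))

  alive-σ : ∀ {x} → Alive x → Alive (σ x)
  alive-σ {x} a with alive? (σ x)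
  ... | yes p = p
  ... | no np = subst Alive (sym (σ-inj (dead-fix np))) a

  alive-σ⁻ : ∀ {x} → Alive x → Alive (σ⁻ x)
  alive-σ⁻ {x} a with alive? (σ⁻ x)
  ... | yes p = p
  ... | no np = ⊥-elim (np (subst Alive (trans (sym (σσ⁻ x)) (dead-fix np)) a))

  alive-φ : ∀ {x} → Alive x → Alive (φ x)
  alive-φ a = alive-σ (alive-α a)

  dead-α : ∀ {x} → ¬ Alive x → ¬ Alive (α x)
  dead-α {x} na a = na (subst Alive (α-inv x) (alive-α a))

  dead-φ : ∀ {x} → ¬ Alive x → φ x ≡ α x
  dead-φ na = dead-fix (dead-α na)

  head-≢ : ∀ {x y} → Alive x → Alive y → vert x ≡ vert y → x ≢ y → head x ≢ head y
  head-≢ ax ay e ne h = ne (simple ax ay e h)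

  -- Tri x says that the face of x is a triangle, Tri (α x) that the face on the other side of the edge of x is one.
  Tri Four Five : Fin d → Set
  Tri x  = φ (φ (φ x)) ≡ x
  Four x = φ (φ (φ (φ x))) ≡ x
  Five x = φ (φ (φ (φ (φ x)))) ≡ x

  Deg4 Deg5 : Fin d → Set
  Deg4 x = σ (σ (σ (σ x))) ≡ x
  Deg5 x = σ (σ (σ (σ (σ x)))) ≡ x

  Bad : Fin d → Set
  Bad x = Tri (α x) ⊎ Tri (α (φ x)) ⊎ Tri (α (φ (φ x))) ⊎ Tri (α (φ (φ (φ x))))

  -- Only the corner at x of a bad quadrilateral may have degree 5 or more.
  Lonely : Fin d → Set
  Lonely x = Four x × Bad x × Deg4 (φ x) × Deg4 (φ (φ x)) × Deg4 (φ (φ (φ x)))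

  Bad-φ : ∀ {x} → Four x → Bad x → Bad (φ x)
  Bad-φ f (inj₁ t) = inj₂ (inj₂ (inj₂ (subst (Tri ∘ α) (sym f) t)))
  Bad-φ f (inj₂ (inj₁ t)) = inj₁ t
  Bad-φ f (inj₂ (inj₂ (inj₁ t))) = inj₂ (inj₁ t)
  Bad-φ f (inj₂ (inj₂ (inj₂ t))) = inj₂ (inj₂ (inj₁ t))

  Tri-φ⁻ : ∀ {x} → Tri (φ x) → Tri x
  Tri-φ⁻ = φ-inj

  -- `α (σ⁻ x)` is the dart before `x` on the face of `x`.
  corner-Tri : ∀ x → Tri x → Tri (α (σ⁻ x))
  corner-Tri x t = Tri-φ⁻ (subst Tri (sym (φφ⁻ x)) t)

orbit-return : ∀ {d} (π : Perm d) k {x y} → iter (Perm.fwd π) (suc k) x ≡ x → Gen (Step (Perm.fwd π)) x y →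
               ∃ λ i → i ≤ k × y ≡ iter (Perm.fwd π) i x
orbit-return π k {x} ret g = proj₁ (Gen-pred Listed closed g) (0 , z≤n , refl)
  where
  open Perm π
  Listed : _ → Set
  Listed z = ∃ λ i → i ≤ k × z ≡ iter fwd i x
  closed : ∀ {y z} → z ≡ fwd y → (Listed y → Listed z) × (Listed z → Listed y)
  closed {y} refl = forth , back
    where
    forth : Listed y → Listed (fwd y)
    forth (i , i≤k , refl) with ℕ.m≤n⇒m<n∨m≡n i≤k
    ... | inj₁ i<k  = suc i , i<k , refl
    ... | inj₂ refl = 0 , z≤n , ret
    back : Listed (fwd y) → Listed y
    back (zero  , _   , e) = k , ℕ.≤-refl , fwd-inj (trans e (sym ret))
    back (suc i , i<k , e) = i , ℕ.<⇒≤ i<k , fwd-inj e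

-- A square `a b c d` with roof `e` over the side `a b`. The condition is applied to its outline,
-- the 5-cycle `a e b c d`.
record House (G : Graph) (a b c d e : Fin (Graph.n G)) : Set where
  open Neighbours G
  field
    a~b : a ~ b
    b~c : b ~ c
    c~d : c ~ d
    d~a : d ~ a
    a~e : a ~ e
    b~e : b ~ e
    a≢c : a ≢ c
    b≢d : b ≢ d
    e≢c : e ≢ c
    e≢d : e ≢ d

-- `w` is the apex of a triangle on `v₀ v₁`. Being different from `v₂` and `v₄` keeps its other two
-- sides off the cycle; it may coincide with `v₃`.
NoLoneSharedEdge : Graph → Set
NoLoneSharedEdge G = ∀ {v₀ v₁ v₂ v₃ v₄ w} → v₀ ~ v₁ → v₁ ~ v₂ → v₂ ~ v₃ → v₃ ~ v₄ → v₄ ~ v₀ →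
    v₀ ≢ v₂ → v₀ ≢ v₃ → v₁ ≢ v₃ → v₁ ≢ v₄ → v₂ ≢ v₄ → w ~ v₀ → w ~ v₁ → w ≢ v₂ → w ≢ v₄ → ⊥
  where open Neighbours G

module Houses (G : Graph) (noShare : NoLoneSharedEdge G) where
  open Neighbours G

  house-mirror : ∀ {a b c d e} → House G a b c d e → House G b a d c e
  house-mirror H = record
    { a~b = ~-sym a~b ; b~c = ~-sym d~a ; c~d = ~-sym c~d ; d~a = ~-sym b~c ; a~e = b~e ; b~e = a~e
    ; a≢c = b≢d ; b≢d = a≢c ; e≢c = e≢d ; e≢d = e≢c }
    where open House H

  module _ {a b c d e w : Fin (Graph.n G)} (H : House G a b c d e) where
    open House H

    -- The name is the side of the outline on which a triangle with apex `w` would stand.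
    side-bc : w ~ b → w ~ c → w ≢ d → w ≢ e → ⊥
    side-bc = noShare b~c c~d d~a a~e (~-sym b~e) b≢d (~⇒≢ (~-sym a~b)) (λ x → a≢c (sym x)) (λ x → e≢c (sym x)) (λ x → e≢d (sym x))

    side-cd : w ~ c → w ~ d → w ≢ a → w ≢ b → ⊥
    side-cd = noShare c~d d~a a~e (~-sym b~e) b~c (λ x → a≢c (sym x)) (λ x → e≢c (sym x)) (λ x → e≢d (sym x)) (λ x → b≢d (sym x)) (~⇒≢ a~b)

    side-ae : w ~ a → w ~ e → w ≢ b → w ≢ d → ⊥
    side-ae = noShare a~e (~-sym b~e) b~c c~d d~a (~⇒≢ a~b) a≢c e≢c e≢d b≢d

  side-da : ∀ {a b c d e w} → House G a b c d e → w ~ a → w ~ d → w ≢ c → w ≢ e → ⊥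
  side-da H = side-bc (house-mirror H)

  side-be : ∀ {a b c d e w} → House G a b c d e → w ~ b → w ~ e → w ≢ a → w ≢ c → ⊥
  side-be H = side-ae (house-mirror H)

  -- Given this chord, `a` itself would be the apex of a triangle standing on `b c`.
  diagonal-ac : ∀ {a b c d e} → House G a b c d e → ¬ a ~ c
  diagonal-ac H ac = side-bc H a~b ac (~⇒≢ (~-sym d~a)) (~⇒≢ a~e)
    where open House H

  diagonal-bd : ∀ {a b c d e} → House G a b c d e → ¬ b ~ d
  diagonal-bd H = diagonal-ac (house-mirror H)

-- Small faces in a plane map of minimum degree 4

module Local (G : Graph) (M : PlaneMap G) (noShare : NoLoneSharedEdge G)
             (σ≢ : ∀ {x} → PlaneMap.Alive M x → PlaneMap.σ M x ≢ x)
             (σσ≢ : ∀ {x} → PlaneMap.Alive M x → PlaneMap.σ M (PlaneMap.σ M x) ≢ x)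
             (σσσ≢ : ∀ {x} → PlaneMap.Alive M x → PlaneMap.σ M (PlaneMap.σ M (PlaneMap.σ M x)) ≢ x) where
  open PlaneMap M
  open Neighbours G
  open Houses G noShare

  adjφ : ∀ {x} → Alive x → vert x ~ vert (φ x)
  adjφ {x} a = subst (vert x ~_) (sym (vert-φ x)) (adj a)

  σ⁻≢σ : ∀ {x} → Alive x → σ⁻ x ≢ σ x
  σ⁻≢σ {x} a e = σσ≢ a (trans (cong σ (sym e)) (σσ⁻ x))

  σ⁻≢σσ : ∀ {x} → Alive x → σ⁻ x ≢ σ (σ x)
  σ⁻≢σσ {x} a e = σσσ≢ a (trans (cong σ (sym e)) (σσ⁻ x))

  -- Otherwise `α x` and `φ x` would be two different darts joining the same vertices in the same
  -- direction.
  skip-≢ : ∀ {x} → Alive x → vert x ≢ vert (φ (φ x))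
  skip-≢ {x} a e = head-≢ (alive-φ a) (alive-α a) (vert-σ (α x)) (σ≢ (alive-α a))
    (trans (sym (vert-φ (φ x))) (trans (sym e) (sym (head-α x))))

  φ≢ : ∀ {x} → Alive x → φ x ≢ x
  φ≢ a e = ~⇒≢ (adjφ a) (cong vert (sym e))

  φφ≢ : ∀ {x} → Alive x → φ (φ x) ≢ x
  φφ≢ a e = skip-≢ a (cong vert (sym e))

  corner~ : ∀ {x} → Alive x → Tri x → head (σ⁻ x) ~ head x
  corner~ {x} a t = subst₂ _~_ (cong vert (sym last)) (vert-φ x) (~-sym (adjφ (alive-φ a)))
    where
    last : φ⁻ x ≡ φ (φ x)
    last = trans (cong φ⁻ (sym t)) (φ⁻φ (φ (φ x)))

  -- If the face across the edge of `x` is a triangle, `σ x` is its side after `α x`, so this is its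
  -- third vertex.
  apex : Fin d → Fin (Graph.n G)
  apex x = head (σ x)

  vert~apex : ∀ {x} → Alive x → vert x ~ apex x
  vert~apex {x} a = subst (_~ apex x) (vert-σ x) (adj (alive-σ a))

  apex-head : ∀ {x} → Tri (α x) → apex x ≡ head (σ⁻ (α x))
  apex-head {x} t = trans (sym (vert-φ (σ x))) (cong vert (sym last))
    where
    last : φ⁻ (α x) ≡ φ (σ x)
    last = trans (cong φ⁻ (sym t)) (trans (φ⁻φ _) (cong φ (φα x)))

  head~apex : ∀ {x} → Alive x → Tri (α x) → vert (φ x) ~ apex x
  head~apex {x} a t = subst₂ _~_ (trans (vert-σ⁻ (α x)) (sym (vert-φ x))) (sym (apex-head t)) (adj (alive-σ⁻ (alive-α a)))

  -- At the head of `x` the darts towards these vertices are `σ⁻ (α x)` and `σ (α x)`, which differ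
  -- because the degree is not 2 or less.
  apex≢next : ∀ {x} → Alive x → Tri (α x) → apex x ≢ vert (φ (φ x))
  apex≢next {x} a t e = head-≢ (alive-σ⁻ (alive-α a)) (alive-φ a) (trans (vert-σ⁻ (α x)) (sym (vert-σ (α x)))) (σ⁻≢σ (alive-α a))
    (trans (sym (apex-head t)) (trans e (vert-φ (φ x))))

  apex≢prev : ∀ {x} → Alive x → apex x ≢ vert (φ⁻ x)
  apex≢prev {x} a e = head-≢ (alive-σ a) (alive-σ⁻ a) (trans (vert-σ x) (sym (vert-σ⁻ x))) (λ p → σ⁻≢σ a (sym p)) e

  fourth : ∀ {x} → Four x → φ (φ (φ x)) ≡ φ⁻ x
  fourth {x} f = trans (sym (φ⁻φ _)) (cong φ⁻ f)

  house : ∀ {x} → Alive x → Four x → Tri (α x) → House G (vert x) (vert (φ x)) (vert (φ (φ x))) (vert (φ (φ (φ x)))) (apex x)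
  house {x} a f t = record
    { a~b = adjφ a ; b~c = adjφ (alive-φ a) ; c~d = adjφ (alive-φ (alive-φ a))
    ; d~a = subst (vert (φ (φ (φ x))) ~_) (cong vert f) (adjφ (alive-φ (alive-φ (alive-φ a))))
    ; a~e = vert~apex a ; b~e = head~apex a t
    ; a≢c = skip-≢ a ; b≢d = skip-≢ (alive-φ a)
    ; e≢c = apex≢next a t ; e≢d = λ e → apex≢prev a (trans e (cong vert (fourth f))) }

  chordless : ∀ {x} → Alive x → Four x → Bad x → (¬ vert x ~ vert (φ (φ x))) × (¬ vert (φ x) ~ vert (φ (φ (φ x))))
  chordless a f (inj₁ t) = diagonal-ac (house a f t) , diagonal-bd (house a f t)
  chordless {x} a f (inj₂ (inj₁ t)) = (λ e → diagonal-bd H (~-sym (subst (_~ vert (φ (φ x))) (cong vert (sym f)) e))) , diagonal-ac H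
    where
    H : House G _ _ _ _ _
    H = house (alive-φ a) (cong φ f) t
  chordless {x} a f (inj₂ (inj₂ (inj₁ t))) =
    (λ e → diagonal-ac H (~-sym (subst (_~ vert (φ (φ x))) (cong vert (sym f)) e))) ,
    (λ e → diagonal-bd H (~-sym (subst (_~ vert (φ (φ (φ x)))) (cong (vert ∘ φ) (sym f)) e)))
    where
    H : House G _ _ _ _ _
    H = house (alive-φ (alive-φ a)) (cong (φ ∘ φ) f) t
  chordless {x} a f (inj₂ (inj₂ (inj₂ t))) =
    (λ e → diagonal-bd H (subst₂ _~_ (cong vert (sym f)) (cong (vert ∘ φ ∘ φ) (sym f)) e)) ,
    (λ e → diagonal-ac H (~-sym (subst (_~ vert (φ (φ (φ x)))) (cong (vert ∘ φ) (sym f)) e)))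
    where
    H : House G _ _ _ _ _
    H = house (alive-φ (alive-φ (alive-φ a))) (cong (φ ∘ φ ∘ φ) f) t

  -- The second triangle stands on `b c` of the house over `x`. The two apexes differ because their
  -- darts at the common corner `b` would coincide only in degree 3.
  adjacentTris⇒⊥ : ∀ {x} → Alive x → Four x → Tri (α x) → Tri (α (φ x)) → ⊥
  adjacentTris⇒⊥ {x} a f t t′ = side-bc (house a f t) (~-sym (vert~apex a′)) (~-sym (head~apex a′ t′)) (apex≢next a′ t′)
    (λ e → head-≢ (alive-σ⁻ (alive-α a)) (alive-σ a′) (trans (vert-σ⁻ (α x)) (sym (trans (vert-σ _) (vert-σ (α x))))) (σ⁻≢σσ (alive-α a))
      (trans (sym (apex-head t)) (sym e)))
    where
    a′ : Alive (φ x)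
    a′ = alive-φ a

  oppositeTris⇒⊥ : ∀ {x} → Alive x → Four x → Tri (α x) → Tri (α (φ (φ x))) → ⊥
  oppositeTris⇒⊥ {x} a f t t′ = side-cd (house a f t) (~-sym (vert~apex a′)) (~-sym (head~apex a′ t′))
    (λ e → apex≢next a′ t′ (trans e (cong vert (sym f))))
    (λ e → apex≢prev a′ (trans e (cong vert (sym (φ⁻φ (φ x))))))
    where
    a′ : Alive (φ (φ x))
    a′ = alive-φ (alive-φ a)

  -- The 5-cycle `n₁ n₂ n₃ v n₀` shares only `n₁ n₂` with the middle triangle, whose apex `v` lies
  -- on the cycle opposite that edge.
  fan⇒⊥ : ∀ {x} → Alive x → Tri x → Tri (σ x) → Tri (σ (σ x)) → ⊥
  fan⇒⊥ {x} a t₀ t₁ t₂ = noShare n₁~n₂ n₂~n₃ (~-sym v~n₃) v~n₀ (corner~ a t₀)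
    (head-≢ a a₂ (sym (trans (vert-σ _) (vert-σ x))) (λ e → σσ≢ a (sym e))) (λ e → ~⇒≢ v~n₁ (sym e)) (λ e → ~⇒≢ v~n₂ (sym e))
    (head-≢ a₁ a₋ (trans (vert-σ x) (sym (vert-σ⁻ x))) (λ e → σ⁻≢σ a (sym e)))
    (head-≢ a₂ a₋ (trans (vert-σ _) (trans (vert-σ x) (sym (vert-σ⁻ x)))) (λ e → σ⁻≢σσ a (sym e)))
    v~n₁ v~n₂ (~⇒≢ v~n₃) (~⇒≢ v~n₀)
    where
    a₁ : Alive (σ x)
    a₁ = alive-σ a
    a₂ : Alive (σ (σ x))
    a₂ = alive-σ a₁
    a₋ : Alive (σ⁻ x)
    a₋ = alive-σ⁻ a
    v~n₀ : vert x ~ head (σ⁻ x)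
    v~n₀ = subst (_~ head (σ⁻ x)) (vert-σ⁻ x) (adj a₋)
    v~n₁ : vert x ~ head x
    v~n₁ = adj a
    v~n₂ : vert x ~ head (σ x)
    v~n₂ = subst (_~ head (σ x)) (vert-σ x) (adj a₁)
    v~n₃ : vert x ~ head (σ (σ x))
    v~n₃ = subst (_~ head (σ (σ x))) (trans (vert-σ _) (vert-σ x)) (adj a₂)
    n₁~n₂ : head x ~ head (σ x)
    n₁~n₂ = subst (λ z → head z ~ head (σ x)) (σ⁻σ x) (corner~ a₁ t₁)
    n₂~n₃ : head (σ x) ~ head (σ (σ x))
    n₂~n₃ = subst (λ z → head z ~ head (σ (σ x))) (σ⁻σ (σ x)) (corner~ a₂ t₂)

  fiveTri⇒⊥ : ∀ {x} → Alive x → Five x → Tri (α x) → ⊥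
  fiveTri⇒⊥ {x} a f t = noShare (adjφ a) (adjφ a₁) (adjφ a₂) (adjφ a₃) (subst (vert (φ (φ (φ (φ x)))) ~_) (cong vert f) (adjφ a₄))
    (skip-≢ a) (λ e → skip-≢ a₃ (sym (trans (cong vert f) e))) (skip-≢ a₁)
    (λ e → skip-≢ a₄ (sym (trans (cong (vert ∘ φ) f) e))) (skip-≢ a₂)
    (~-sym (vert~apex a)) (~-sym (head~apex a t)) (apex≢next a t)
    (λ e → apex≢prev a (trans e (cong vert (trans (sym (φ⁻φ _)) (cong φ⁻ f)))))
    where
    a₁ : Alive (φ x)
    a₁ = alive-φ a
    a₂ : Alive (φ (φ x))
    a₂ = alive-φ a₁
    a₃ : Alive (φ (φ (φ x)))
    a₃ = alive-φ a₂
    a₄ : Alive (φ (φ (φ (φ x))))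
    a₄ = alive-φ a₃

  -- The 4-face and the nearer triangle form a house, and the farther triangle of the diamond stands
  -- on a side of its roof.
  diamondAfter⇒⊥ : ∀ {x} → Alive x → Tri x → Tri (σ x) → Four (α (σ x)) → ⊥
  diamondAfter⇒⊥ {x} a t t′ f = side-be (house ay f ty)
    (subst (head (σ⁻ x) ~_) (sym b≡) (~-sym (subst (_~ head (σ⁻ x)) (vert-σ⁻ x) (adj (alive-σ⁻ a)))))
    (subst (head (σ⁻ x) ~_) (sym e≡) (corner~ a t))
    (head-≢ (alive-σ⁻ a) (alive-σ a) (trans (vert-σ⁻ x) (sym (vert-σ x))) (σ⁻≢σ a))
    (λ e → head-≢ (alive-σ⁻ a) (alive-σ (alive-σ a)) (trans (vert-σ⁻ x) (sym (trans (vert-σ _) (vert-σ x)))) (σ⁻≢σσ a)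
       (trans e (trans (vert-φ _) (cong head (φα (σ x))))))
    where
    ay : Alive (α (σ x))
    ay = alive-α (alive-σ a)
    ty : Tri (α (α (σ x)))
    ty = subst Tri (sym (α-inv (σ x))) t′
    b≡ : vert (φ (α (σ x))) ≡ vert x
    b≡ = trans (cong vert (φα (σ x))) (trans (vert-σ _) (vert-σ x))
    e≡ : apex (α (σ x)) ≡ head x
    e≡ = trans (apex-head ty) (cong head (trans (cong σ⁻ (α-inv (σ x))) (σ⁻σ x)))

  diamondBefore⇒⊥ : ∀ {x} → Alive x → Tri x → Tri (σ x) → Four (σ⁻ x) → ⊥
  diamondBefore⇒⊥ {x} a t t′ f = side-ae (house ay f (corner-Tri x t))
    (~-sym (subst (_~ head (σ x)) (trans (vert-σ x) (sym (vert-σ⁻ x))) (adj (alive-σ a))))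
    (~-sym (subst (_~ head (σ x)) (cong head (trans (σ⁻σ x) (sym (σσ⁻ x)))) (corner~ (alive-σ a) t′)))
    (λ e → head-≢ (alive-σ⁻ a) (alive-σ a) (trans (vert-σ⁻ x) (sym (vert-σ x))) (σ⁻≢σ a) (sym (trans e (vert-φ (σ⁻ x)))))
    (λ e → head-≢ (alive-σ a) (alive-σ⁻ ay) (trans (vert-σ x) (sym (trans (vert-σ⁻ _) (vert-σ⁻ x))))
       (λ p → σσσ≢ ay (trans (cong (λ z → σ (σ z)) (σσ⁻ x)) (trans (cong σ p) (σσ⁻ _)))) (trans e (cong vert (fourth f))))
    where
    ay : Alive (σ⁻ x)
    ay = alive-σ⁻ a

  surrounded4 : ∀ {x} → Alive x → Deg4 x → SurroundedBy4 (vert x)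
  surrounded4 {x} a d4 v~w with dart v~w
  ... | y , ay , vy , refl = _ ∷ _ ∷ _ ∷ [] , refl , covers
    where
    d4y : Deg4 y
    d4y with orbit-return rotation 3 d4 (orbit a ay (sym vy))
    ... | 0 , _ , refl = d4
    ... | 1 , _ , refl = cong σ d4
    ... | 2 , _ , refl = cong (σ ∘ σ) d4
    ... | 3 , _ , refl = cong (σ ∘ σ ∘ σ) d4
    ... | suc (suc (suc (suc _))) , s≤s (s≤s (s≤s ())) , _
    covers : ∀ {z} → vert x ~ z → z ≢ head y → z ∈ head (σ y) ∷ head (σ (σ y)) ∷ head (σ (σ (σ y))) ∷ []
    covers v~z ne with dart v~z
    ... | y′ , ay′ , vy′ , refl with orbit-return rotation 3 d4y (orbit ay ay′ (trans vy (sym vy′)))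
    ... | 0 , _ , refl = ⊥-elim (ne refl)
    ... | 1 , _ , refl = here refl
    ... | 2 , _ , refl = there (here refl)
    ... | 3 , _ , refl = there (there (here refl))
    ... | suc (suc (suc (suc _))) , s≤s (s≤s (s≤s ())) , _

  surrounded5 : ∀ {x} → Alive x → Deg5 x → SurroundedBy5 (vert x)
  surrounded5 {x} a d5 v~r v~w w≢r with dart v~r | dart v~w
  ... | y , ay , vy , refl | y₂ , ay₂ , vy₂ , refl = result (orbit-return rotation 4 d5y (orbit ay ay₂ (trans vy (sym vy₂))))
    where
    d5y : Deg5 y
    d5y with orbit-return rotation 4 d5 (orbit a ay (sym vy))
    ... | 0 , _ , refl = d5
    ... | 1 , _ , refl = cong σ d5
    ... | 2 , _ , refl = cong (σ ∘ σ) d5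
    ... | 3 , _ , refl = cong (σ ∘ σ ∘ σ) d5
    ... | 4 , _ , refl = cong (σ ∘ σ ∘ σ ∘ σ) d5
    ... | suc (suc (suc (suc (suc _)))) , s≤s (s≤s (s≤s (s≤s ()))) , _
    five : ∀ {z} → vert x ~ z → z ≢ head y →
           z ≡ head (σ y) ⊎ z ≡ head (σ (σ y)) ⊎ z ≡ head (σ (σ (σ y))) ⊎ z ≡ head (σ (σ (σ (σ y))))
    five v~z ne with dart v~z
    ... | y′ , ay′ , vy′ , refl with orbit-return rotation 4 d5y (orbit ay ay′ (trans vy (sym vy′)))
    ... | 0 , _ , refl = ⊥-elim (ne refl)
    ... | 1 , _ , refl = inj₁ refl
    ... | 2 , _ , refl = inj₂ (inj₁ refl)
    ... | 3 , _ , refl = inj₂ (inj₂ (inj₁ refl))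
    ... | 4 , _ , refl = inj₂ (inj₂ (inj₂ refl))
    ... | suc (suc (suc (suc (suc _)))) , s≤s (s≤s (s≤s (s≤s ()))) , _
    Goal : Set
    Goal = Σ (List (Fin (Graph.n G))) λ ws → length ws ≡ 3 × (∀ {z} → vert x ~ z → z ≢ head y → z ≢ head y₂ → z ∈ ws)
    result : (∃ λ i → i ≤ 4 × y₂ ≡ iter σ i y) → Goal
    result (0 , _ , refl) = ⊥-elim (w≢r refl)
    result (1 , _ , refl) = head (σ (σ y)) ∷ head (σ (σ (σ y))) ∷ head (σ (σ (σ (σ y)))) ∷ [] , refl , λ v~z n n′ → case (five v~z n) n′
      where
      case : ∀ {z} → _ → z ≢ head (σ y) → z ∈ head (σ (σ y)) ∷ head (σ (σ (σ y))) ∷ head (σ (σ (σ (σ y)))) ∷ []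
      case (inj₁ e) n′ = ⊥-elim (n′ e)
      case (inj₂ (inj₁ e)) n′ = here e
      case (inj₂ (inj₂ (inj₁ e))) n′ = there (here e)
      case (inj₂ (inj₂ (inj₂ e))) n′ = there (there (here e))
    result (2 , _ , refl) = head (σ y) ∷ head (σ (σ (σ y))) ∷ head (σ (σ (σ (σ y)))) ∷ [] , refl , λ v~z n n′ → case (five v~z n) n′
      where
      case : ∀ {z} → _ → z ≢ head (σ (σ y)) → z ∈ head (σ y) ∷ head (σ (σ (σ y))) ∷ head (σ (σ (σ (σ y)))) ∷ []
      case (inj₁ e) n′ = here e
      case (inj₂ (inj₁ e)) n′ = ⊥-elim (n′ e)
      case (inj₂ (inj₂ (inj₁ e))) n′ = there (here e)
      case (inj₂ (inj₂ (inj₂ e))) n′ = there (there (here e))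
    result (3 , _ , refl) = head (σ y) ∷ head (σ (σ y)) ∷ head (σ (σ (σ (σ y)))) ∷ [] , refl , λ v~z n n′ → case (five v~z n) n′
      where
      case : ∀ {z} → _ → z ≢ head (σ (σ (σ y))) → z ∈ head (σ y) ∷ head (σ (σ y)) ∷ head (σ (σ (σ (σ y)))) ∷ []
      case (inj₁ e) n′ = here e
      case (inj₂ (inj₁ e)) n′ = there (here e)
      case (inj₂ (inj₂ (inj₁ e))) n′ = ⊥-elim (n′ e)
      case (inj₂ (inj₂ (inj₂ e))) n′ = there (there (here e))
    result (4 , _ , refl) = head (σ y) ∷ head (σ (σ y)) ∷ head (σ (σ (σ y))) ∷ [] , refl , λ v~z n n′ → case (five v~z n) n′
      where
      case : ∀ {z} → _ → z ≢ head (σ (σ (σ (σ y)))) → z ∈ head (σ y) ∷ head (σ (σ y)) ∷ head (σ (σ (σ y))) ∷ []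
      case (inj₁ e) n′ = here e
      case (inj₂ (inj₁ e)) n′ = there (here e)
      case (inj₂ (inj₂ (inj₁ e))) n′ = there (there (here e))
      case (inj₂ (inj₂ (inj₂ e))) n′ = ⊥-elim (n′ e)
    result (suc (suc (suc (suc (suc _)))) , s≤s (s≤s (s≤s (s≤s ()))) , _)

  -- p₂, p₃ are neighbours of the corner v = vert x of the bad quadrilateral v p₁ q p₀ traversed by x.
  crossing⇒⊥ : ∀ {x p₂ p₃} → Alive x → Four x → Bad x → p₂ ~ vert x → p₃ ~ vert x →
               vert (φ (φ (φ x))) ~ p₂ → vert (φ x) ~ p₃ → ¬ vert (φ (φ (φ x))) ~ p₃ → ¬ vert (φ x) ~ p₂ →
               p₂ ≢ vert (φ x) → p₃ ≢ vert (φ (φ (φ x))) → p₂ ≢ vert (φ (φ x)) → p₃ ≢ vert (φ (φ x)) → ⊥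
  crossing⇒⊥ a f (inj₁ t) v₂ v₃ p₀₂ p₁₃ n₀₃ n₁₂ d₂₁ d₃₀ d₂q d₃q =
    side-da H v₂ (~-sym p₀₂) d₂q (λ { refl → n₁₂ (House.b~e H) })
    where
    H : House G _ _ _ _ _
    H = house a f t
  crossing⇒⊥ a f (inj₂ (inj₁ t)) v₂ v₃ p₀₂ p₁₃ n₀₃ n₁₂ d₂₁ d₃₀ d₂q d₃q =
    side-cd (house (alive-φ a) (cong φ f) t) (~-sym p₀₂) (subst (_ ~_) (cong vert (sym f)) v₂) d₂₁ d₂q
  crossing⇒⊥ a f (inj₂ (inj₂ (inj₁ t))) v₂ v₃ p₀₂ p₁₃ n₀₃ n₁₂ d₂₁ d₃₀ d₂q d₃q =
    side-cd (house (alive-φ (alive-φ a)) (cong (φ ∘ φ) f) t) (subst (_ ~_) (cong vert (sym f)) v₃)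
      (subst (_ ~_) (cong (vert ∘ φ) (sym f)) (~-sym p₁₃)) d₃q d₃₀
  crossing⇒⊥ a f (inj₂ (inj₂ (inj₂ t))) v₂ v₃ p₀₂ p₁₃ n₀₃ n₁₂ d₂₁ d₃₀ d₂q d₃q =
    side-bc H (subst (_ ~_) (cong vert (sym f)) v₃) (subst (_ ~_) (cong (vert ∘ φ) (sym f)) (~-sym p₁₃))
      (λ e → d₃q (trans e (cong (vert ∘ φ ∘ φ) f))) (λ { refl → n₀₃ (House.a~e H) })
    where
    H : House G _ _ _ _ _
    H = house (alive-φ (alive-φ (alive-φ a))) (cong (φ ∘ φ ∘ φ) f) t

  module Reducible (L : Fin (Graph.n G) → List ℕ) (asg : IsAssignment G 4 L) (uncolourable : ¬ LColorable G L)
                   (critical : ∀ {v w} → v ~ w → ∃ (Holes.HoleAt G L asg uncolourable v)) where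
    open Holes G L asg uncolourable

    quad : ∀ {x} → Alive x → Lonely x → Quad (vert x) (head (σ⁻ x)) (vert (φ (φ x))) (head x)
    quad {x} a (f , bad , da , dq , db) = subst₂ (λ u w → Quad (vert x) u (vert (φ (φ x))) w) (cong vert (fourth f)) (vert-φ x) Q
      where
      a₁ : Alive (φ x)
      a₁ = alive-φ a
      a₂ : Alive (φ (φ x))
      a₂ = alive-φ a₁
      a₃ : Alive (φ (φ (φ x)))
      a₃ = alive-φ a₂
      Q : Quad (vert x) (vert (φ (φ (φ x)))) (vert (φ (φ x))) (vert (φ x))
      Q = record
        { v~a = ~-sym (subst (vert (φ (φ (φ x))) ~_) (cong vert f) (adjφ a₃)) ; a~q = ~-sym (adjφ a₂) ; q~b = ~-sym (adjφ a₁) ; v~b = adjφ a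
        ; a≢b = λ e → skip-≢ a₁ (sym e) ; q≢v = λ e → skip-≢ a (sym e)
        ; v≁q = proj₁ (chordless a f bad) ; a≁b = λ e → proj₂ (chordless a f bad) (~-sym e)
        ; tight-a = tight (surrounded4 a₃ db) ; tight-q = tight (surrounded4 a₂ dq) ; tight-b = tight (surrounded4 a₁ da) }

    lonelyDeg4⇒⊥ : ∀ {x} → Alive x → Lonely x → Deg4 x → ⊥
    lonelyDeg4⇒⊥ a l d4 = tightQuad⇒⊥ (quad a l) (tight (surrounded4 a d4)) (proj₂ (critical (adj a)))

    consecutiveLonely⇒⊥ : ∀ {x} → Alive x → Deg5 x → Lonely x → Lonely (σ x) → ⊥
    consecutiveLonely⇒⊥ {x} a d5 l l′ = consecutiveQuads⇒⊥ (surrounded5 a d5) (quad a l)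
      (subst₂ (λ u w → Quad u (head w) (vert (φ (φ (σ x)))) (head (σ x))) (vert-σ x) (σ⁻σ x) (quad (alive-σ a) l′))
      (head-≢ (alive-σ⁻ a) (alive-σ a) (trans (vert-σ⁻ x) (sym (vert-σ x))) (σ⁻≢σ a)) (proj₂ (critical (adj a)))

    -- The adjacencies from `disjointQuads` put a triangle of the graph, not necessarily a face, on
    -- each of the two sides at `vert x` of the quadrilateral of `x`. One of them conflicts with the
    -- triangular face that makes this quadrilateral bad, whichever side that face is on.
    disjointLonely⇒⊥ : ∀ {x} → Alive x → Deg5 x → Lonely x → Lonely (σ (σ x)) → ⊥
    disjointLonely⇒⊥ {x} a d5 l@(f , bad , _) l′ =
      result (disjointQuads (surrounded5 a d5) Q Q′ c≢a c≢b e≢a e≢b (proj₂ (critical (adj a))))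
      where
      a₁ : Alive (σ x)
      a₁ = alive-σ a
      a₂ : Alive (σ (σ x))
      a₂ = alive-σ a₁
      a₋ : Alive (σ⁻ x)
      a₋ = alive-σ⁻ a
      v₁ : vert (σ x) ≡ vert x
      v₁ = vert-σ x
      v₂ : vert (σ (σ x)) ≡ vert x
      v₂ = trans (vert-σ _) v₁
      v₋ : vert (σ⁻ x) ≡ vert x
      v₋ = vert-σ⁻ x
      Q : Quad (vert x) (head (σ⁻ x)) (vert (φ (φ x))) (head x)
      Q = quad a l
      Q′ : Quad (vert x) (head (σ x)) (vert (φ (φ (σ (σ x))))) (head (σ (σ x)))
      Q′ = subst₂ (λ u w → Quad u (head w) (vert (φ (φ (σ (σ x))))) (head (σ (σ x)))) v₂ (σ⁻σ (σ x)) (quad a₂ l′)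
      c≢a : head (σ x) ≢ head (σ⁻ x)
      c≢a = head-≢ a₁ a₋ (trans v₁ (sym v₋)) (λ e → σ⁻≢σ a (sym e))
      c≢b : head (σ x) ≢ head x
      c≢b = head-≢ a₁ a v₁ (σ≢ a)
      e≢a : head (σ (σ x)) ≢ head (σ⁻ x)
      e≢a = head-≢ a₂ a₋ (trans v₂ (sym v₋)) (λ e → σ⁻≢σσ a (sym e))
      e≢b : head (σ (σ x)) ≢ head x
      e≢b = head-≢ a₂ a v₂ (σσ≢ a)
      cross : ∀ {p₂ p₃} → vert x ~ p₂ → vert x ~ p₃ → head (σ⁻ x) ~ p₂ → head x ~ p₃ →
              ¬ head (σ⁻ x) ~ p₃ → ¬ head x ~ p₂ → p₂ ≢ head x → p₃ ≢ head (σ⁻ x) → ⊥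
      cross {p₂} {p₃} v~p₂ v~p₃ x₁ x₂ x₃ x₄ x₅ x₆ = crossing⇒⊥ a f bad (~-sym v~p₂) (~-sym v~p₃)
        (subst (_~ p₂) e₀ x₁) (subst (_~ p₃) e₁ x₂) (λ y → x₃ (subst (_~ p₃) (sym e₀) y)) (λ y → x₄ (subst (_~ p₂) (sym e₁) y))
        (λ y → x₅ (trans y (sym e₁))) (λ y → x₆ (trans y (sym e₀))) (λ { refl → Quad.v≁q Q v~p₂ }) (λ { refl → Quad.v≁q Q v~p₃ })
        where
        e₀ : head (σ⁻ x) ≡ vert (φ (φ (φ x)))
        e₀ = cong vert (sym (fourth f))
        e₁ : head x ≡ vert (φ x)
        e₁ = sym (vert-φ x)
      result : _ → ⊥
      result (inj₁ (a~e , b~c , a≁c , b≁e)) = cross (Quad.v~b Q′) (Quad.v~a Q′) a~e b~c a≁c b≁e e≢b c≢a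
      result (inj₂ (a~c , b~e , a≁e , b≁c)) = cross (Quad.v~a Q′) (Quad.v~b Q′) a~c b~e a≁e b≁c c≢b e≢a

-- Discharging

𝟙 : ∀ {P : Set} → Dec P → ℕ
𝟙 (yes _) = 1
𝟙 (no _)  = 0

𝟙-yes : ∀ {P : Set} (p? : Dec P) → P → 𝟙 p? ≡ 1
𝟙-yes (yes _) _ = refl
𝟙-yes (no np) p = ⊥-elim (np p)

𝟙-no : ∀ {P : Set} (p? : Dec P) → ¬ P → 𝟙 p? ≡ 0
𝟙-no (yes p) np = ⊥-elim (np p)
𝟙-no (no _)  _  = refl

𝟙≤1 : ∀ {P : Set} (p? : Dec P) → 𝟙 p? ≤ 1
𝟙≤1 (yes _) = ℕ.≤-refl
𝟙≤1 (no _)  = z≤n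

𝟙-⇔ : ∀ {P Q : Set} (p? : Dec P) (q? : Dec Q) → (P → Q) → (Q → P) → 𝟙 p? ≡ 𝟙 q?
𝟙-⇔ (yes p) q? f g = sym (𝟙-yes q? (f p))
𝟙-⇔ (no np) q? f g = sym (𝟙-no q? (np ∘ g))

iter-suc : ∀ {A : Set} (f : A → A) k x → iter f k (f x) ≡ f (iter f k x)
iter-suc f zero    x = refl
iter-suc f (suc k) x = cong f (iter-suc f k x)

trail : ∀ {A : Set} → (A → A) → ℕ → A → List A
trail f zero    x = []
trail f (suc k) x = x ∷ trail f k (f x)

∈-trail : ∀ {A : Set} (f : A → A) k x {z} → z ∈ trail f k x → ∃ λ j → j < k × z ≡ iter f j x
∈-trail f (suc k) x (here e)   = 0 , s≤s z≤n , e
∈-trail f (suc k) x (there z∈) with ∈-trail f k (f x) z∈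
... | j , j<k , e = suc j , s≤s j<k , trans e (iter-suc f j x)

trail-unique : ∀ {d} (π : Perm d) k x → (∀ j → suc j < k → iter (Perm.fwd π) (suc j) x ≢ x) → Unique (trail (Perm.fwd π) k x)
trail-unique π zero    x h = []
trail-unique π (suc k) x h =
  All.tabulate fresh ∷ trail-unique π k (fwd x) (λ j j<k e → h j (ℕ.m<n⇒m<1+n j<k) (fwd-inj (trans (cong fwd (sym (iter-suc fwd j x))) e)))
  where
  open Perm π
  fresh : ∀ {z} → z ∈ trail fwd k (fwd x) → x ≢ z
  fresh z∈ x≡z with ∈-trail fwd k (fwd x) z∈
  ... | j , j<k , e = h j (s≤s j<k) (trans (sym (iter-suc fwd j x)) (trans (sym e) (sym x≡z)))

trail-Gen : ∀ {d} (f : Fin d → Fin d) k x {z} → z ∈ trail f k x → Gen (Step f) x z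
trail-Gen f k x z∈ with ∈-trail f k x z∈
... | j , _ , refl = Gen-iter f j x

OrbitPart : ∀ {d} → (Fin d → Fin d) → (Fin d → ℕ) → ℕ → Fin d → Set
OrbitPart f w b x = Σ (List _) λ ys → Unique ys × (∀ {y} → y ∈ ys → Gen (Step f) x y) × b ≤ listSum w ys

trailPart : ∀ {d} (π : Perm d) {w b} k {x y} → Gen (Step (Perm.fwd π)) x y →
            (∀ j → suc j < k → iter (Perm.fwd π) (suc j) y ≢ y) →
            b ≤ listSum w (trail (Perm.fwd π) k y) → OrbitPart (Perm.fwd π) w b x
trailPart π k {y = y} g h le = trail (Perm.fwd π) k y , trail-unique π k y h , (λ z∈ → g ∙ trail-Gen (Perm.fwd π) k y z∈) , le

listSum-allFin : ∀ {n} {A : Set} (w : A → ℕ) (f : Fin n → A) → listSum w (tabulate f) ≡ sum (w ∘ f)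
listSum-allFin {zero}  w f = refl
listSum-allFin {suc n} w f = cong (w (f zero) +_) (listSum-allFin w (f ∘ suc))

listSum-filter : ∀ {A : Set} {P : A → Set} (P? : ∀ x → Dec (P x)) xs → listSum (𝟙 ∘ P?) xs ≡ length (List.filter P? xs)
listSum-filter P? []       = refl
listSum-filter P? (x ∷ xs) with P? x
... | yes _ = cong suc (listSum-filter P? xs)
... | no _  = listSum-filter P? xs

unique-map : ∀ {A B : Set} (f : A → B) {xs} → (∀ {x y} → x ∈ xs → y ∈ xs → f x ≡ f y → x ≡ y) → Unique xs → Unique (map f xs)
unique-map f h [] = []
unique-map f {x ∷ xs} h (x∉ ∷ uq) = All.tabulate fresh ∷ unique-map f (λ a b → h (there a) (there b)) uq
  where
  fresh : ∀ {z} → z ∈ map f xs → f x ≢ z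
  fresh z∈ e with ∈-map⁻ f z∈
  ... | y , y∈ , refl = All.lookup x∉ y∈ (h (here refl) (there y∈) e)

module Halves {d} (α : Fin d → Fin d) (α-inv : ∀ x → α (α x) ≡ x) (α-fix : ∀ x → α x ≢ x) where
  -- Tells the two darts of an edge apart; paired with a class number it encodes darts injectively
  -- when every class involved is a single edge.
  label : Fin d → Fin 2
  label x with toℕ x ℕ.<? toℕ (α x)
  ... | yes _ = zero
  ... | no _  = suc zero

  label-α : ∀ x → label x ≢ label (α x)
  label-α x e with toℕ x ℕ.<? toℕ (α x) | toℕ (α x) ℕ.<? toℕ (α (α x))
  label-α x () | yes _ | no _
  label-α x () | no _ | yes _
  label-α x e | yes p | yes q = ℕ.<-asym p (subst (λ z → toℕ (α x) < toℕ z) (α-inv x) q)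
  label-α x e | no p | no q = α-fix x (toℕ-injective (ℕ.≤-antisym (ℕ.≮⇒≥ p) (ℕ.≮⇒≥ (subst (λ z → ¬ toℕ (α x) < toℕ z) (α-inv x) q))))

module Discharging (G : Graph) (M : PlaneMap G) (noShare : NoLoneSharedEdge G)
    (σ≢ : ∀ {x} → PlaneMap.Alive M x → PlaneMap.σ M x ≢ x)
    (σσ≢ : ∀ {x} → PlaneMap.Alive M x → PlaneMap.σ M (PlaneMap.σ M x) ≢ x)
    (σσσ≢ : ∀ {x} → PlaneMap.Alive M x → PlaneMap.σ M (PlaneMap.σ M (PlaneMap.σ M x)) ≢ x)
    (lonely₄ : ∀ {x} → PlaneMap.Alive M x → PlaneMap.Lonely M x → PlaneMap.Deg4 M x → ⊥)
    (lonely₅ : ∀ {x} → PlaneMap.Alive M x → PlaneMap.Deg5 M x → PlaneMap.Lonely M x → PlaneMap.Lonely M (PlaneMap.σ M x) → ⊥)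
    (lonely₅′ : ∀ {x} → PlaneMap.Alive M x → PlaneMap.Deg5 M x → PlaneMap.Lonely M x → PlaneMap.Lonely M (PlaneMap.σ M (PlaneMap.σ M x)) → ⊥) where
  open PlaneMap M
  open Local G M noShare σ≢ σσ≢ σσσ≢
  open Halves α α-inv α-fix

  tri? : ∀ x → Dec (Tri x)
  tri? x = φ (φ (φ x)) ≟ x

  four? : ∀ x → Dec (Four x)
  four? x = φ (φ (φ (φ x))) ≟ x

  five? : ∀ x → Dec (Five x)
  five? x = φ (φ (φ (φ (φ x)))) ≟ x

  deg4? : ∀ x → Dec (Deg4 x)
  deg4? x = σ (σ (σ (σ x))) ≟ x

  deg5? : ∀ x → Dec (Deg5 x)
  deg5? x = σ (σ (σ (σ (σ x)))) ≟ x

  bad? : ∀ x → Dec (Bad x)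
  bad? x = tri? (α x) ⊎-dec (tri? (α (φ x)) ⊎-dec (tri? (α (φ (φ x))) ⊎-dec tri? (α (φ (φ (φ x))))))

  lonely? : ∀ x → Dec (Lonely x)
  lonely? x = four? x ×-dec (bad? x ×-dec (deg4? (φ x) ×-dec (deg4? (φ (φ x)) ×-dec deg4? (φ (φ (φ x))))))

  Big : Fin d → Set
  Big x = ¬ Tri x × ¬ Four x × ¬ Five x

  big? : ∀ x → Dec (Big x)
  big? x = ¬? (tri? x) ×-dec (¬? (four? x) ×-dec ¬? (five? x))

  -- Charge is measured in sixths; a dart x stands for the corner between σ⁻ x and x, which lies in the face of x.
  -- Across a side, a triangle gets 2 from a face that is not a triangle (side); a big face gives 1 to each end of every
  -- other side (end); a vertex gives 1 to both triangles of a diamond at the ends of its diagonal (diag, diag′), and 1 or 2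
  -- to a bad quadrilateral (help).
  side end diag diag′ help corner out : Fin d → ℕ
  side x   = 𝟙 (¬? (tri? x) ×-dec tri? (α x))
  end x    = 𝟙 (big? x ×-dec ¬? (tri? (α x)))
  diag x   = 𝟙 (tri? x ×-dec tri? (α x))
  diag′ x  = 𝟙 (tri? x ×-dec tri? (σ⁻ x))
  help x   = 𝟙 ((four? x ×-dec bad? x) ×-dec ¬? (deg4? x)) + 𝟙 (lonely? x ×-dec ¬? (deg4? x))
  corner x = diag x + diag′ x + help x
  out x    = 2 * side x + 2 * end x

  weigh : ∀ {x} → Dec (Alive x) → ℕ → ℕ → ℕ
  weigh (yes _) a b = a
  weigh (no _)  a b = b

  -- A dead dart makes up a vertex and half a face, hence the values 24 and 12.
  vertexCharge faceCharge : Fin d → ℕ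
  vertexCharge x = weigh (alive? x) (4 + (2 ∸ corner x) + end x + end (α x)) 24
  faceCharge x   = weigh (alive? x) (4 + (2 ∸ out x) + 2 * side (α x) + corner x) 12

  weigh-alive : ∀ {x a b} (a? : Dec (Alive x)) → Alive x → weigh a? a b ≡ a
  weigh-alive (yes _) _ = refl
  weigh-alive (no na) a = ⊥-elim (na a)

  weigh-dead : ∀ {x a b} (a? : Dec (Alive x)) → ¬ Alive x → weigh a? a b ≡ b
  weigh-dead (yes a) na = ⊥-elim (na a)
  weigh-dead (no _)  _  = refl

  tri-four⇒⊥ : ∀ {x} → Alive x → Tri x → Four x → ⊥
  tri-four⇒⊥ a t f = φ≢ a (trans (sym (cong φ t)) f)

  dead-φφ : ∀ {x} → ¬ Alive x → φ (φ x) ≡ x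
  dead-φφ {x} na = trans (cong φ (dead-φ na)) (trans (dead-φ (dead-α na)) (α-inv x))

  dead-¬tri : ∀ {x} → ¬ Alive x → ¬ Tri x
  dead-¬tri {x} na t = α-fix x (trans (sym (dead-φ na)) (trans (cong φ (sym (dead-φφ na))) t))

  dead-four : ∀ {x} → ¬ Alive x → Four x
  dead-four na = trans (cong (φ ∘ φ) (dead-φφ na)) (dead-φφ na)

  help-tri : ∀ {x} → Alive x → Tri x → help x ≡ 0
  help-tri {x} a t = cong₂ _+_ (𝟙-no ((four? x ×-dec bad? x) ×-dec ¬? (deg4? x)) (λ p → tri-four⇒⊥ a t (proj₁ (proj₁ p))))
                               (𝟙-no (lonely? x ×-dec ¬? (deg4? x)) (λ p → tri-four⇒⊥ a t (proj₁ (proj₁ p))))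

  help-deg4 : ∀ {x} → Deg4 x → help x ≡ 0
  help-deg4 {x} d4 = cong₂ _+_ (𝟙-no ((four? x ×-dec bad? x) ×-dec ¬? (deg4? x)) (λ p → proj₂ p d4)) (𝟙-no (lonely? x ×-dec ¬? (deg4? x)) (λ p → proj₂ p d4))

  diag-¬tri : ∀ {x} → ¬ Tri x → diag x ≡ 0
  diag-¬tri {x} nt = 𝟙-no (tri? x ×-dec tri? (α x)) (λ p → nt (proj₁ p))

  diag′-¬tri : ∀ {x} → ¬ Tri x → diag′ x ≡ 0
  diag′-¬tri {x} nt = 𝟙-no (tri? x ×-dec tri? (σ⁻ x)) (λ p → nt (proj₁ p))

  corner-¬tri : ∀ {x} → ¬ Tri x → corner x ≡ help x
  corner-¬tri {x} nt = cong₂ (λ u v → u + v + help x) (diag-¬tri nt) (diag′-¬tri nt)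

  corner≤2 : ∀ {x} → Alive x → corner x ≤ 2
  corner≤2 {x} a = case (tri? x)
    where
    case : Dec (Tri x) → corner x ≤ 2
    case (yes t) = ℕ.+-mono-≤ (ℕ.+-mono-≤ (𝟙≤1 (tri? x ×-dec tri? (α x))) (𝟙≤1 (tri? x ×-dec tri? (σ⁻ x)))) (ℕ.≤-reflexive (help-tri a t))
    case (no nt) = subst (_≤ 2) (sym (corner-¬tri nt))
      (ℕ.+-mono-≤ (𝟙≤1 ((four? x ×-dec bad? x) ×-dec ¬? (deg4? x))) (𝟙≤1 (lonely? x ×-dec ¬? (deg4? x))))

  tri-σ : ∀ {x} → Tri (α x) → Tri (σ x)
  tri-σ {x} t = subst Tri (φα x) (cong φ t)

  fan⁻⇒⊥ : ∀ {x} → Alive x → Tri (σ⁻ x) → Tri x → Tri (σ x) → ⊥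
  fan⁻⇒⊥ {x} a t₀ t₁ t₂ = fan⇒⊥ (alive-σ⁻ a) t₀ (subst Tri (sym (σσ⁻ x)) t₁) (subst (Tri ∘ σ) (sym (σσ⁻ x)) t₂)

  -- `diag` and `diag′` together would give three consecutive triangles, and a corner in a triangle
  -- gives no `help`.
  corner≤1 : ∀ {x} → Alive x → ¬ Lonely x → corner x ≤ 1
  corner≤1 {x} a nl = case (tri? x) (tri? (α x))
    where
    case : Dec (Tri x) → Dec (Tri (α x)) → corner x ≤ 1
    case (yes t) (yes t′) = ℕ.+-mono-≤ (ℕ.+-mono-≤ (𝟙≤1 (tri? x ×-dec tri? (α x)))
      (ℕ.≤-reflexive (𝟙-no (tri? x ×-dec tri? (σ⁻ x)) (λ p → fan⁻⇒⊥ a (proj₂ p) t (tri-σ t′))))) (ℕ.≤-reflexive (help-tri a t))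
    case (yes t) (no nt) = ℕ.+-mono-≤ (ℕ.+-mono-≤ (ℕ.≤-reflexive (𝟙-no (tri? x ×-dec tri? (α x)) (λ p → nt (proj₂ p))))
      (𝟙≤1 (tri? x ×-dec tri? (σ⁻ x)))) (ℕ.≤-reflexive (help-tri a t))
    case (no nt) _ = subst (_≤ 1) (sym (corner-¬tri nt))
      (ℕ.+-mono-≤ (𝟙≤1 ((four? x ×-dec bad? x) ×-dec ¬? (deg4? x))) (ℕ.≤-reflexive (𝟙-no (lonely? x ×-dec ¬? (deg4? x)) (nl ∘ proj₁))))

  out≤2 : ∀ x → out x ≤ 2
  out≤2 x = case (tri? (α x))
    where
    case : Dec (Tri (α x)) → out x ≤ 2
    case (yes t) = ℕ.+-mono-≤ (ℕ.*-monoʳ-≤ 2 (𝟙≤1 (¬? (tri? x) ×-dec tri? (α x))))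
      (ℕ.≤-reflexive (cong (2 *_) (𝟙-no (big? x ×-dec ¬? (tri? (α x))) (λ p → proj₂ p t))))
    case (no nt) = ℕ.+-mono-≤ (ℕ.≤-reflexive (cong (2 *_) (𝟙-no (¬? (tri? x) ×-dec tri? (α x)) (nt ∘ proj₂))))
      (ℕ.*-monoʳ-≤ 2 (𝟙≤1 (big? x ×-dec ¬? (tri? (α x)))))

  vertexCharge≥ : ∀ {x k} → Alive x → corner x ≤ k → 4 + (2 ∸ k) ≤ vertexCharge x
  vertexCharge≥ {x} {k} a c≤k = begin
    4 + (2 ∸ k)                                  ≤⟨ ℕ.+-monoʳ-≤ 4 (ℕ.∸-monoʳ-≤ 2 c≤k) ⟩
    4 + (2 ∸ corner x)                           ≤⟨ ℕ.m≤m+n _ (end x + end (α x)) ⟩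
    4 + (2 ∸ corner x) + (end x + end (α x))     ≡⟨ sym (ℕ.+-assoc (4 + (2 ∸ corner x)) (end x) (end (α x))) ⟩
    4 + (2 ∸ corner x) + end x + end (α x)       ≡⟨ sym (weigh-alive (alive? x) a) ⟩
    vertexCharge x                               ∎
    where open ℕ.≤-Reasoning

  faceCharge≥ : ∀ {x} → Alive x → 4 + (2 ∸ out x) + corner x ≤ faceCharge x
  faceCharge≥ {x} a = begin
    4 + (2 ∸ out x) + corner x                     ≤⟨ ℕ.+-monoˡ-≤ (corner x) (ℕ.m≤m+n (4 + (2 ∸ out x)) (2 * side (α x))) ⟩
    4 + (2 ∸ out x) + 2 * side (α x) + corner x    ≡⟨ sym (weigh-alive (alive? x) a) ⟩
    faceCharge x                                   ∎
    where open ℕ.≤-Reasoning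

  noReturn₃ : ∀ {x} → Alive x → ∀ j → suc j < 4 → iter σ (suc j) x ≢ x
  noReturn₃ a 0 _ = σ≢ a
  noReturn₃ a 1 _ = σσ≢ a
  noReturn₃ a 2 _ = σσσ≢ a
  noReturn₃ a (suc (suc (suc j))) (s≤s (s≤s (s≤s (s≤s ()))))

  noReturn₄ : ∀ {x} → Alive x → ¬ Deg4 x → ∀ j → suc j < 5 → iter σ (suc j) x ≢ x
  noReturn₄ a n₄ 3 _ = n₄
  noReturn₄ a n₄ 0 _ = σ≢ a
  noReturn₄ a n₄ 1 _ = σσ≢ a
  noReturn₄ a n₄ 2 _ = σσσ≢ a
  noReturn₄ a n₄ (suc (suc (suc (suc j)))) (s≤s (s≤s (s≤s (s≤s (s≤s ())))))

  noReturn₅ : ∀ {x} → Alive x → ¬ Deg4 x → ¬ Deg5 x → ∀ j → suc j < 6 → iter σ (suc j) x ≢ x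
  noReturn₅ a n₄ n₅ 4 _ = n₅
  noReturn₅ a n₄ n₅ 3 _ = n₄
  noReturn₅ a n₄ n₅ 0 _ = σ≢ a
  noReturn₅ a n₄ n₅ 1 _ = σσ≢ a
  noReturn₅ a n₄ n₅ 2 _ = σσσ≢ a
  noReturn₅ a n₄ n₅ (suc (suc (suc (suc (suc j))))) (s≤s (s≤s (s≤s (s≤s (s≤s (s≤s ()))))))

  deg5-¬deg4 : ∀ {x} → Alive x → Deg5 x → ¬ Deg4 x
  deg5-¬deg4 a d5 d4 = σ≢ a (trans (cong σ (sym d4)) d5)

  sumOf4 : ∀ {w : Fin d → ℕ} {f : Fin d → Fin d} {x} k₀ k₁ k₂ k₃ → k₀ ≤ w x → k₁ ≤ w (f x) → k₂ ≤ w (f (f x)) → k₃ ≤ w (f (f (f x))) →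
           k₀ + (k₁ + (k₂ + (k₃ + 0))) ≤ listSum w (trail f 4 x)
  sumOf4 _ _ _ _ a b c e = ℕ.+-mono-≤ a (ℕ.+-mono-≤ b (ℕ.+-mono-≤ c (ℕ.+-mono-≤ e z≤n)))

  sumOf5 : ∀ {w : Fin d → ℕ} {f : Fin d → Fin d} {x} k₀ k → k₀ ≤ w x → k ≤ w (f x) → k ≤ w (f (f x)) → k ≤ w (f (f (f x))) → k ≤ w (f (f (f (f x)))) →
           k₀ + (k + (k + (k + (k + 0)))) ≤ listSum w (trail f 5 x)
  sumOf5 _ _ a b c e g = ℕ.+-mono-≤ a (ℕ.+-mono-≤ b (ℕ.+-mono-≤ c (ℕ.+-mono-≤ e (ℕ.+-mono-≤ g z≤n))))

  sumOf6 : ∀ {w : Fin d → ℕ} {f : Fin d → Fin d} {x} → (∀ {y} → Gen (Step f) x y → 4 ≤ w y) → 24 ≤ listSum w (trail f 6 x)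
  sumOf6 {f = f} {x} h = ℕ.+-mono-≤ (h (g 0)) (ℕ.+-mono-≤ (h (g 1)) (ℕ.+-mono-≤ (h (g 2)) (ℕ.+-mono-≤ (h (g 3)) (ℕ.+-mono-≤ (h (g 4)) (ℕ.+-mono-≤ (h (g 5)) z≤n)))))
    where
    g : ∀ k → Gen (Step f) x (iter f k x)
    g k = Gen-iter f k x

  -- Final charges at the vertices

  Diamond : Fin d → Set
  Diamond x = Tri x × Tri (α x)

  diamond? : ∀ x → Dec (Diamond x)
  diamond? x = tri? x ×-dec tri? (α x)

  -- The corners on both sides of the diagonal pay 1 each. The dart opposite to it separates two big
  -- faces, as no third triangle, 4-face or 5-face may touch the diamond there, and receives 1 from
  -- both: `5 + 5 + 8 + 6` is 24.
  diamondEnd : ∀ {x} → Alive x → Deg4 x → Diamond x → 24 ≤ listSum vertexCharge (trail σ 4 x)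
  diamondEnd {x} a d4 (t , tα) = sumOf4 {w = vertexCharge} {f = σ} 5 5 8 6
    (vertexCharge≥ a c₀) (vertexCharge≥ a₁ c₁) c₂ (vertexCharge≥ a₃ (ℕ.≤-reflexive (trans (corner-¬tri nt₃) (help-deg4 (cong (σ ∘ σ ∘ σ) d4)))))
    where
    a₁ : Alive (σ x)
    a₁ = alive-σ a
    a₂ : Alive (σ (σ x))
    a₂ = alive-σ a₁
    a₃ : Alive (σ (σ (σ x)))
    a₃ = alive-σ a₂
    t₁ : Tri (σ x)
    t₁ = tri-σ tα
    third : σ (σ (σ x)) ≡ σ⁻ x
    third = trans (sym (σ⁻σ _)) (cong σ⁻ d4)
    nt₂ : ¬ Tri (σ (σ x))
    nt₂ = fan⇒⊥ a t t₁
    nt₋ : ¬ Tri (σ⁻ x)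
    nt₋ u = fan⁻⇒⊥ a u t t₁
    nt₃ : ¬ Tri (σ (σ (σ x)))
    nt₃ u = nt₋ (subst Tri third u)
    c₀ : corner x ≤ 1
    c₀ = ℕ.+-mono-≤ (ℕ.+-mono-≤ (𝟙≤1 (tri? x ×-dec tri? (α x))) (ℕ.≤-reflexive (𝟙-no (tri? x ×-dec tri? (σ⁻ x)) (nt₋ ∘ proj₂)))) (ℕ.≤-reflexive (help-tri a t))
    c₁ : corner (σ x) ≤ 1
    c₁ = ℕ.+-mono-≤ (ℕ.+-mono-≤ (ℕ.≤-reflexive (𝟙-no (tri? (σ x) ×-dec tri? (α (σ x))) (λ p → nt₂ (tri-σ (proj₂ p)))))
                                (𝟙≤1 (tri? (σ x) ×-dec tri? (σ⁻ (σ x))))) (ℕ.≤-reflexive (help-tri a₁ t₁))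
    tαα : Tri (α (α (σ x)))
    tαα = subst Tri (sym (α-inv (σ x))) t₁
    big₂ : Big (σ (σ x))
    big₂ = nt₂ , (λ f → diamondAfter⇒⊥ a t t₁ (φ-inj (subst Four (sym (φα (σ x))) f)))
               , (λ f → fiveTri⇒⊥ (alive-α a₁) (φ-inj (subst Five (sym (φα (σ x))) f)) tαα)
    nt₂α : ¬ Tri (α (σ (σ x)))
    nt₂α u = nt₃ (tri-σ u)
    big₂α : Big (α (σ (σ x)))
    big₂α = nt₂α
      , (λ f → diamondBefore⇒⊥ a t t₁ (subst Four third (subst Four (φα (σ (σ x))) (cong φ f))))
      , (λ f → fiveTri⇒⊥ (alive-σ⁻ a) (subst Five third (subst Five (φα (σ (σ x))) (cong φ f))) (corner-Tri x t))
    c₂ : 8 ≤ vertexCharge (σ (σ x))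
    c₂ = ℕ.≤-reflexive (sym (begin
      vertexCharge (σ (σ x))                                                    ≡⟨ weigh-alive (alive? (σ (σ x))) a₂ ⟩
      4 + (2 ∸ corner (σ (σ x))) + end (σ (σ x)) + end (α (σ (σ x)))            ≡⟨ cong₂ (λ u v → 4 + (2 ∸ u) + v + end (α (σ (σ x))))
                                                                                     (trans (corner-¬tri nt₂) (help-deg4 (cong (σ ∘ σ) d4)))
                                                                                     (𝟙-yes (big? _ ×-dec ¬? (tri? _)) (big₂ , nt₂α)) ⟩
      7 + end (α (σ (σ x)))                                                     ≡⟨ cong (7 +_) (𝟙-yes (big? _ ×-dec ¬? (tri? _)) (big₂α , (λ u → nt₂ (subst Tri (α-inv _) u)))) ⟩
      8                                                                         ∎))
      where open ≡-Reasoning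

  plainDeg4 : ∀ {x} → Alive x → Deg4 x → ¬ Diamond x → ¬ Diamond (σ⁻ x) → 6 ≤ vertexCharge x
  plainDeg4 {x} a d4 n n′ = vertexCharge≥ a (ℕ.≤-reflexive (cong₂ _+_ (cong₂ _+_ (𝟙-no (tri? x ×-dec tri? (α x)) n)
    (𝟙-no (tri? x ×-dec tri? (σ⁻ x)) (λ p → n′ (proj₂ p , corner-Tri x (proj₁ p))))) (help-deg4 d4)))

  -- 24 is what four corners at 6 hold. At degree 4 either nothing is paid or `diamondEnd` applies;
  -- at degree 5 one lonely corner leaves `4 + 4 * 5`; from degree 6 on, six corners at 4 suffice
  -- whatever they pay.
  vertexPart : ∀ x → OrbitPart σ vertexCharge 24 x
  vertexPart x with alive? x
  ... | no na = trailPart rotation 1 rfl (λ { _ (s≤s ()) }) (ℕ.≤-reflexive (sym (trans (ℕ.+-identityʳ _) (weigh-dead (alive? x) na))))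
  ... | yes a with deg4? x | deg5? x
  vertexPart x | yes a | no n₄ | no n₅ = trailPart rotation 6 rfl (noReturn₅ a n₄ n₅)
      (sumOf6 {w = vertexCharge} {f = σ} λ g → vertexCharge≥ (proj₁ (Gen-pred Alive closed g) a) (corner≤2 (proj₁ (Gen-pred Alive closed g) a)))
    where
    closed : ∀ {y z} → z ≡ σ y → (Alive y → Alive z) × (Alive z → Alive y)
    closed {y} refl = alive-σ , λ az → subst Alive (σ⁻σ y) (alive-σ⁻ az)
  vertexPart x | yes a | yes d4 | _ = case (diamond? x) (diamond? (σ x)) (diamond? (σ (σ x))) (diamond? (σ (σ (σ x))))
    where
    a₁ : Alive (σ x)
    a₁ = alive-σ a
    a₂ : Alive (σ (σ x))
    a₂ = alive-σ a₁
    a₃ : Alive (σ (σ (σ x)))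
    a₃ = alive-σ a₂
    from : ∀ k → (∀ {y} → Alive y → Alive (iter σ k y)) → Deg4 (iter σ k x) → Diamond (iter σ k x) → OrbitPart σ vertexCharge 24 x
    from k al d4 D = trailPart rotation 4 (Gen-iter σ k x) (noReturn₃ (al a)) (diamondEnd (al a) d4 D)
    case : Dec (Diamond x) → Dec (Diamond (σ x)) → Dec (Diamond (σ (σ x))) → Dec (Diamond (σ (σ (σ x)))) → OrbitPart σ vertexCharge 24 x
    case (yes D) _ _ _ = from 0 (λ y → y) d4 D
    case _ (yes D) _ _ = from 1 alive-σ (cong σ d4) D
    case _ _ (yes D) _ = from 2 (alive-σ ∘ alive-σ) (cong (σ ∘ σ) d4) D
    case _ _ _ (yes D) = from 3 (alive-σ ∘ alive-σ ∘ alive-σ) (cong (σ ∘ σ ∘ σ) d4) D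
    case (no n₀) (no n₁) (no n₂) (no n₃) = trailPart rotation 4 rfl (noReturn₃ a) (sumOf4 {w = vertexCharge} {f = σ} 6 6 6 6
      (plainDeg4 a d4 n₀ (subst (¬_ ∘ Diamond) (trans (sym (σ⁻σ _)) (cong σ⁻ d4)) n₃))
      (plainDeg4 a₁ (cong σ d4) n₁ (subst (¬_ ∘ Diamond) (sym (σ⁻σ _)) n₀))
      (plainDeg4 a₂ (cong (σ ∘ σ) d4) n₂ (subst (¬_ ∘ Diamond) (sym (σ⁻σ _)) n₁))
      (plainDeg4 a₃ (cong (σ ∘ σ ∘ σ) d4) n₃ (subst (¬_ ∘ Diamond) (sym (σ⁻σ _)) n₂)))
  vertexPart x | yes a | no _ | yes d5 =
    case (lonely? x) (lonely? (σ x)) (lonely? (σ (σ x))) (lonely? (σ (σ (σ x)))) (lonely? (σ (σ (σ (σ x)))))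
    where
    plain : ∀ {y} → Alive y → ¬ Lonely y → 5 ≤ vertexCharge y
    plain ay nl = vertexCharge≥ ay (corner≤1 ay nl)
    from : ∀ k → (∀ {y} → Alive y → Alive (iter σ k y)) → Deg5 (iter σ k x) → Lonely (iter σ k x) → OrbitPart σ vertexCharge 24 x
    from k al d5 l = trailPart rotation 5 (Gen-iter σ k x) (noReturn₄ ay (deg5-¬deg4 ay d5)) (sumOf5 {w = vertexCharge} {f = σ} 4 5
      (vertexCharge≥ ay (corner≤2 ay))
      (plain ay₁ (lonely₅ ay d5 l))
      (plain ay₂ (lonely₅′ ay d5 l))
      -- Two more rotations from here lead back to the lonely corner, so the same exclusion applies
      -- in the other direction.
      (plain ay₃ (λ l′ → lonely₅′ ay₃ (cong (σ ∘ σ ∘ σ) d5) l′ (subst Lonely (sym d5) l)))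
      (plain ay₄ (λ l′ → lonely₅ ay₄ (cong (σ ∘ σ ∘ σ ∘ σ) d5) l′ (subst Lonely (sym d5) l))))
      where
      ay : Alive (iter σ k x)
      ay = al a
      ay₁ : Alive (σ (iter σ k x))
      ay₁ = alive-σ ay
      ay₂ : Alive (σ (σ (iter σ k x)))
      ay₂ = alive-σ ay₁
      ay₃ : Alive (σ (σ (σ (iter σ k x))))
      ay₃ = alive-σ ay₂
      ay₄ : Alive (σ (σ (σ (σ (iter σ k x)))))
      ay₄ = alive-σ ay₃
    case : Dec (Lonely x) → Dec (Lonely (σ x)) → Dec (Lonely (σ (σ x))) → Dec (Lonely (σ (σ (σ x)))) → Dec (Lonely (σ (σ (σ (σ x))))) → OrbitPart σ vertexCharge 24 x
    case (yes l) _ _ _ _ = from 0 (λ y → y) d5 l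
    case _ (yes l) _ _ _ = from 1 alive-σ (cong σ d5) l
    case _ _ (yes l) _ _ = from 2 (alive-σ ∘ alive-σ) (cong (σ ∘ σ) d5) l
    case _ _ _ (yes l) _ = from 3 (alive-σ ∘ alive-σ ∘ alive-σ) (cong (σ ∘ σ ∘ σ) d5) l
    case _ _ _ _ (yes l) = from 4 (alive-σ ∘ alive-σ ∘ alive-σ ∘ alive-σ) (cong (σ ∘ σ ∘ σ ∘ σ) d5) l
    case (no n₀) (no n₁) (no n₂) (no n₃) (no n₄) = trailPart rotation 5 rfl (noReturn₄ a (deg5-¬deg4 a d5))
      (ℕ.≤-trans (ℕ.n≤1+n 24) (sumOf5 {w = vertexCharge} {f = σ} 5 5 (plain a n₀) (plain (alive-σ a) n₁) (plain (alive-σ (alive-σ a)) n₂)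
        (plain (alive-σ (alive-σ (alive-σ a))) n₃) (plain (alive-σ (alive-σ (alive-σ (alive-σ a)))) n₄)))

  -- Final charges of the faces

  out-0 : ∀ {x} → ¬ (¬ Tri x × Tri (α x)) → ¬ Big x → out x ≡ 0
  out-0 {x} ns nb = cong₂ (λ u v → 2 * u + 2 * v) (𝟙-no (¬? (tri? x) ×-dec tri? (α x)) ns) (𝟙-no (big? x ×-dec ¬? (tri? (α x))) (nb ∘ proj₁))

  faceCharge≥6 : ∀ {x} → Alive x → ¬ (¬ Tri x × Tri (α x)) → ¬ Big x → 6 + corner x ≤ faceCharge x
  faceCharge≥6 {x} a ns nb = subst (λ u → 4 + (2 ∸ u) + corner x ≤ faceCharge x) (out-0 ns nb) (faceCharge≥ a)

  faceCharge≥4 : ∀ {x} → Alive x → 4 + corner x ≤ faceCharge x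
  faceCharge≥4 {x} a = ℕ.≤-trans (ℕ.+-monoˡ-≤ (corner x) (ℕ.m≤m+n 4 (2 ∸ out x))) (faceCharge≥ a)

  help≤corner : ∀ x → help x ≤ corner x
  help≤corner x = ℕ.m≤n+m (help x) (diag x + diag′ x)

  help≥1 : ∀ {x} → Four x → Bad x → ¬ Deg4 x → 1 ≤ help x
  help≥1 {x} f b n = ℕ.≤-trans (ℕ.≤-reflexive (sym (𝟙-yes ((four? x ×-dec bad? x) ×-dec ¬? (deg4? x)) ((f , b) , n)))) (ℕ.m≤m+n _ _)

  help≥2 : ∀ {x} → Lonely x → ¬ Deg4 x → 2 ≤ help x
  help≥2 {x} l@(f , b , _) n = ℕ.+-mono-≤ (ℕ.≤-reflexive (sym (𝟙-yes ((four? x ×-dec bad? x) ×-dec ¬? (deg4? x)) ((f , b) , n))))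
                                          (ℕ.≤-reflexive (sym (𝟙-yes (lonely? x ×-dec ¬? (deg4? x)) (l , n))))

  -- Two corners of degree ≥ 5 give 1 each; a single one is lonely and gives 2; having none
  -- contradicts `lonely₄`.
  helped : ∀ {x} → Alive x → Four x → Bad x → 2 ≤ help x + (help (φ x) + (help (φ (φ x)) + help (φ (φ (φ x)))))
  helped {x} a f b = case (deg4? x) (deg4? (φ x)) (deg4? (φ (φ x))) (deg4? (φ (φ (φ x))))
    where
    f₁ : Four (φ x)
    f₁ = cong φ f
    f₂ : Four (φ (φ x))
    f₂ = cong φ f₁
    f₃ : Four (φ (φ (φ x)))
    f₃ = cong φ f₂
    b₁ : Bad (φ x)
    b₁ = Bad-φ f b
    b₂ : Bad (φ (φ x))
    b₂ = Bad-φ f₁ b₁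
    b₃ : Bad (φ (φ (φ x)))
    b₃ = Bad-φ f₂ b₂
    h₀ : ¬ Deg4 x → 1 ≤ help x
    h₀ = help≥1 f b
    h₁ : ¬ Deg4 (φ x) → 1 ≤ help (φ x)
    h₁ = help≥1 f₁ b₁
    h₂ : ¬ Deg4 (φ (φ x)) → 1 ≤ help (φ (φ x))
    h₂ = help≥1 f₂ b₂
    h₃ : ¬ Deg4 (φ (φ (φ x))) → 1 ≤ help (φ (φ (φ x)))
    h₃ = help≥1 f₃ b₃
    case : Dec (Deg4 x) → Dec (Deg4 (φ x)) → Dec (Deg4 (φ (φ x))) → Dec (Deg4 (φ (φ (φ x)))) →
           2 ≤ help x + (help (φ x) + (help (φ (φ x)) + help (φ (φ (φ x)))))
    case (yes y₀) (yes y₁) (yes y₂) (yes y₃) = ⊥-elim (lonely₄ a (f , b , y₁ , y₂ , y₃) y₀)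
    case (no n₀)  (yes y₁) (yes y₂) (yes y₃) = ℕ.+-mono-≤ (help≥2 (f , b , y₁ , y₂ , y₃) n₀) z≤n
    case (yes y₀) (no n₁)  (yes y₂) (yes y₃) = ℕ.+-mono-≤ (z≤n {help x}) (ℕ.+-mono-≤ (help≥2 (f₁ , b₁ , y₂ , y₃ , subst Deg4 (sym f) y₀) n₁) z≤n)
    case (yes y₀) (yes y₁) (no n₂)  (yes y₃) = ℕ.+-mono-≤ (z≤n {help x}) (ℕ.+-mono-≤ (z≤n {help (φ x)})
      (ℕ.+-mono-≤ (help≥2 (f₂ , b₂ , y₃ , subst Deg4 (sym f) y₀ , subst Deg4 (sym f₁) y₁) n₂) z≤n))
    case (yes y₀) (yes y₁) (yes y₂) (no n₃)  = ℕ.+-mono-≤ (z≤n {help x}) (ℕ.+-mono-≤ (z≤n {help (φ x)})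
      (ℕ.+-mono-≤ (z≤n {help (φ (φ x))}) (help≥2 (f₃ , b₃ , subst Deg4 (sym f) y₀ , subst Deg4 (sym f₁) y₁ , subst Deg4 (sym f₂) y₂) n₃)))
    case (no n₀) (no n₁) _ _ = ℕ.+-mono-≤ (h₀ n₀) (ℕ.+-mono-≤ (h₁ n₁) z≤n)
    case (no n₀) _ (no n₂) _ = ℕ.+-mono-≤ (h₀ n₀) (ℕ.+-mono-≤ (z≤n {help (φ x)}) (ℕ.+-mono-≤ (h₂ n₂) z≤n))
    case (no n₀) _ _ (no n₃) = ℕ.+-mono-≤ (h₀ n₀) (ℕ.+-mono-≤ (z≤n {help (φ x)}) (ℕ.+-mono-≤ (z≤n {help (φ (φ x))}) (h₃ n₃)))
    case _ (no n₁) (no n₂) _ = ℕ.+-mono-≤ (z≤n {help x}) (ℕ.+-mono-≤ (h₁ n₁) (ℕ.+-mono-≤ (h₂ n₂) z≤n))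
    case _ (no n₁) _ (no n₃) = ℕ.+-mono-≤ (z≤n {help x}) (ℕ.+-mono-≤ (h₁ n₁) (ℕ.+-mono-≤ (z≤n {help (φ (φ x))}) (h₃ n₃)))
    case _ _ (no n₂) (no n₃) = ℕ.+-mono-≤ (z≤n {help x}) (ℕ.+-mono-≤ (z≤n {help (φ x)}) (ℕ.+-mono-≤ (h₂ n₂) (h₃ n₃)))

  -- The triangle across `x` costs 2. No other side borders a triangle, so the corners have to
  -- return exactly these 2.
  badFace : ∀ {x} → Alive x → Four x → Tri (α x) → 24 ≤ listSum faceCharge (trail φ 4 x)
  badFace {x} a f t = ℕ.≤-trans (begin
    24                                                          ≤⟨ ℕ.+-monoʳ-≤ 22 (helped a f (inj₁ t)) ⟩
    22 + (help x + (help x₁ + (help x₂ + help x₃)))             ≡⟨ +-*-Solver.solve 4 (λ p q r s → con 22 :+ (p :+ (q :+ (r :+ s)))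
                                                                      := (con 4 :+ p) :+ ((con 6 :+ q) :+ ((con 6 :+ r) :+ ((con 6 :+ s) :+ con 0)))) refl
                                                                      (help x) (help x₁) (help x₂) (help x₃) ⟩
    (4 + help x) + ((6 + help x₁) + ((6 + help x₂) + ((6 + help x₃) + 0))) ∎)
    (sumOf4 {w = faceCharge} {f = φ} (4 + help x) (6 + help x₁) (6 + help x₂) (6 + help x₃)
      (ℕ.≤-trans (ℕ.+-monoʳ-≤ 4 (help≤corner x)) (faceCharge≥4 a))
      (six a₁ f₁ (adjacentTris⇒⊥ a f t))
      (six a₂ f₂ (oppositeTris⇒⊥ a f t))
      (six a₃ f₃ (λ t′ → adjacentTris⇒⊥ a₃ f₃ t′ (subst (Tri ∘ α) (sym f) t))))
    where
    open ℕ.≤-Reasoning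
    open +-*-Solver using (_:+_; con; _:=_)
    x₁ x₂ x₃ : Fin d
    x₁ = φ x
    x₂ = φ x₁
    x₃ = φ x₂
    f₁ : Four x₁
    f₁ = cong φ f
    f₂ : Four x₂
    f₂ = cong φ f₁
    f₃ : Four x₃
    f₃ = cong φ f₂
    a₁ : Alive x₁
    a₁ = alive-φ a
    a₂ : Alive x₂
    a₂ = alive-φ a₁
    a₃ : Alive x₃
    a₃ = alive-φ a₂
    six : ∀ {y} → Alive y → Four y → ¬ Tri (α y) → 6 + help y ≤ faceCharge y
    six {y} ay fy nt = ℕ.≤-trans (ℕ.+-monoʳ-≤ 6 (help≤corner y)) (faceCharge≥6 ay (nt ∘ proj₂) (λ b → proj₁ (proj₂ b) fy))

  goodSix : ∀ {x} → Alive x → ¬ Tri (α x) → ¬ Big x → 6 ≤ faceCharge x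
  goodSix {x} a nt nb = ℕ.≤-trans (ℕ.m≤m+n 6 (corner x)) (faceCharge≥6 a (nt ∘ proj₂) nb)

  -- A triangle holds 18 and needs 2 per side. With `u y` telling whether side `y` is a diagonal,
  -- `2 ∸ u y` arrives at its start and `u y` at its end: either 2 from across, or 1 at both ends.
  triangleFace : ∀ {x} → Alive x → Tri x → 24 ≤ listSum faceCharge (trail φ 3 x)
  triangleFace {x} a t = ℕ.≤-trans (ℕ.≤-reflexive (sym total))
      (ℕ.+-mono-≤ first (ℕ.+-mono-≤ (step a₁ t₁) (ℕ.+-mono-≤ (step a₂ t₂) z≤n)))
    where
    a₁ : Alive (φ x)
    a₁ = alive-φ a
    a₂ : Alive (φ (φ x))
    a₂ = alive-φ a₁
    t₁ : Tri (φ x)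
    t₁ = cong φ t
    t₂ : Tri (φ (φ x))
    t₂ = cong φ t₁
    u : Fin d → ℕ
    u y = 𝟙 (tri? (α y))
    bound : ∀ {y} → Alive y → Tri y → 6 + (2 ∸ u y) + u (φ⁻ y) ≤ faceCharge y
    bound {y} ay ty = begin
      6 + (2 ∸ u y) + u (φ⁻ y)                               ≤⟨ ℕ.+-mono-≤ (ℕ.+-monoʳ-≤ 6 (own (tri? (α y)))) (ℕ.≤-reflexive (𝟙-⇔ (tri? _) (tri? y ×-dec tri? (σ⁻ y)) (λ p → ty , subst Tri (α-inv _) p) (λ p → subst Tri (sym (α-inv _)) (proj₂ p)))) ⟩
      6 + (2 * side (α y) + diag y) + diag′ y                ≡⟨ +-*-Solver.solve 3 (λ p q r → con 6 :+ (p :+ q) :+ r := con 6 :+ p :+ (q :+ r)) refl (2 * side (α y)) (diag y) (diag′ y) ⟩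
      6 + 2 * side (α y) + (diag y + diag′ y)                ≤⟨ ℕ.+-monoʳ-≤ (6 + 2 * side (α y)) (ℕ.m≤m+n (diag y + diag′ y) (help y)) ⟩
      6 + 2 * side (α y) + corner y                          ≡⟨ cong (λ k → 4 + (2 ∸ k) + 2 * side (α y) + corner y) (sym (out-0 (λ p → proj₁ p ty) (λ b → proj₁ b ty))) ⟩
      4 + (2 ∸ out y) + 2 * side (α y) + corner y            ≡⟨ sym (weigh-alive (alive? y) ay) ⟩
      faceCharge y                                           ∎
      where
      open ℕ.≤-Reasoning
      open +-*-Solver using (_:+_; con; _:=_)
      own : (p? : Dec (Tri (α y))) → 2 ∸ 𝟙 p? ≤ 2 * side (α y) + diag y
      own (yes p) = ℕ.≤-trans (ℕ.≤-reflexive (sym (𝟙-yes (tri? y ×-dec tri? (α y)) (ty , p)))) (ℕ.m≤n+m _ _)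
      own (no np) = ℕ.≤-trans (ℕ.≤-reflexive (cong (2 *_) (sym (𝟙-yes (¬? (tri? (α y)) ×-dec tri? (α (α y))) (np , subst Tri (sym (α-inv y)) ty))))) (ℕ.m≤m+n _ _)
    first : 6 + (2 ∸ u x) + u (φ (φ x)) ≤ faceCharge x
    first = subst (λ z → 6 + (2 ∸ u x) + u z ≤ faceCharge x) (trans (cong φ⁻ (sym t)) (φ⁻φ _)) (bound a t)
    step : ∀ {y} → Alive (φ y) → Tri (φ y) → 6 + (2 ∸ u (φ y)) + u y ≤ faceCharge (φ y)
    step {y} ay ty = subst (λ z → 6 + (2 ∸ u (φ y)) + u z ≤ faceCharge (φ y)) (φ⁻φ y) (bound ay ty)
    two : ∀ y → u y + (2 ∸ u y) ≡ 2
    two y = ℕ.m+[n∸m]≡n (ℕ.≤-trans (𝟙≤1 (tri? (α y))) (s≤s z≤n))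
    total : (6 + (2 ∸ u x) + u (φ (φ x))) + ((6 + (2 ∸ u (φ x)) + u x) + ((6 + (2 ∸ u (φ (φ x))) + u (φ x)) + 0)) ≡ 24
    total = trans (+-*-Solver.solve 6 (λ p p′ q q′ r r′ → (con 6 :+ p′ :+ r) :+ ((con 6 :+ q′ :+ p) :+ ((con 6 :+ r′ :+ q) :+ con 0))
                      := con 18 :+ ((p :+ p′) :+ ((q :+ q′) :+ (r :+ r′)))) refl
                      (u x) (2 ∸ u x) (u (φ x)) (2 ∸ u (φ x)) (u (φ (φ x))) (2 ∸ u (φ (φ x))))
                  (cong (18 +_) (cong₂ _+_ (two x) (cong₂ _+_ (two (φ x)) (two (φ (φ x))))))
      where open +-*-Solver using (_:+_; con; _:=_)

  four-noReturn : ∀ {x} → Alive x → Four x → ∀ j → suc j < 4 → iter φ (suc j) x ≢ x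
  four-noReturn a f 0 _ = φ≢ a
  four-noReturn a f 1 _ = φφ≢ a
  four-noReturn a f 2 _ = λ t → tri-four⇒⊥ a t f
  four-noReturn a f (suc (suc (suc j))) (s≤s (s≤s (s≤s (s≤s ()))))

  -- A 5-face borders no triangle and is not big, so it pays nothing. From length 6 on, six darts
  -- keep at least 4 each.
  facePart : ∀ x → OrbitPart φ faceCharge 24 x
  facePart x with alive? x
  ... | no na = trailPart facePerm 2 rfl
      (λ { zero _ e → α-fix x (trans (sym (dead-φ na)) e) ; (suc _) (s≤s (s≤s ())) _ })
      (ℕ.≤-reflexive (sym (cong₂ (λ p q → p + (q + 0)) (weigh-dead (alive? x) na)
         (weigh-dead (alive? (φ x)) (λ aφ → dead-α na (subst Alive (dead-φ na) aφ))))))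
  ... | yes a with tri? x | four? x | five? x
  facePart x | yes a | yes t | _ | _ = trailPart facePerm 3 rfl
      (λ { 0 _ → φ≢ a ; 1 _ → φφ≢ a ; (suc (suc _)) (s≤s (s≤s (s≤s ()))) }) (triangleFace a t)
  facePart x | yes a | no _ | yes f | _ = case (tri? (α x)) (tri? (α (φ x))) (tri? (α (φ (φ x)))) (tri? (α (φ (φ (φ x)))))
    where
    from : ∀ k → (∀ {y} → Alive y → Alive (iter φ k y)) → Four (iter φ k x) → Tri (α (iter φ k x)) → OrbitPart φ faceCharge 24 x
    from k al f t = trailPart facePerm 4 (Gen-iter φ k x) (four-noReturn (al a) f) (badFace (al a) f t)
    good : ∀ {y} → Alive y → Four y → ¬ Tri (α y) → 6 ≤ faceCharge y
    good ay fy nt = goodSix ay nt (λ b → proj₁ (proj₂ b) fy)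
    case : Dec (Tri (α x)) → Dec (Tri (α (φ x))) → Dec (Tri (α (φ (φ x)))) → Dec (Tri (α (φ (φ (φ x))))) → OrbitPart φ faceCharge 24 x
    case (yes t) _ _ _ = from 0 (λ y → y) f t
    case _ (yes t) _ _ = from 1 alive-φ (cong φ f) t
    case _ _ (yes t) _ = from 2 (alive-φ ∘ alive-φ) (cong (φ ∘ φ) f) t
    case _ _ _ (yes t) = from 3 (alive-φ ∘ alive-φ ∘ alive-φ) (cong (φ ∘ φ ∘ φ) f) t
    case (no n₀) (no n₁) (no n₂) (no n₃) = trailPart facePerm 4 rfl (four-noReturn a f) (sumOf4 {w = faceCharge} {f = φ} 6 6 6 6
      (good a f n₀) (good (alive-φ a) (cong φ f) n₁) (good (alive-φ (alive-φ a)) (cong (φ ∘ φ) f) n₂)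
      (good (alive-φ (alive-φ (alive-φ a))) (cong (φ ∘ φ ∘ φ) f) n₃))
  facePart x | yes a | no nt | no nf | yes g = trailPart facePerm 5 rfl
      (λ { 0 _ → φ≢ a ; 1 _ → φφ≢ a ; 2 _ → nt ; 3 _ → nf ; (suc (suc (suc (suc _)))) (s≤s (s≤s (s≤s (s≤s (s≤s ()))))) })
      (ℕ.≤-trans (ℕ.m≤m+n 24 6) (sumOf5 {w = faceCharge} {f = φ} 6 6 (good a g) (good (alive-φ a) (cong φ g)) (good (alive-φ (alive-φ a)) (cong (φ ∘ φ) g))
        (good (alive-φ (alive-φ (alive-φ a))) (cong (φ ∘ φ ∘ φ) g)) (good (alive-φ (alive-φ (alive-φ (alive-φ a)))) (cong (φ ∘ φ ∘ φ ∘ φ) g))))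
    where
    good : ∀ {y} → Alive y → Five y → 6 ≤ faceCharge y
    good ay fy = goodSix ay (fiveTri⇒⊥ ay fy) (λ b → proj₂ (proj₂ b) fy)
  facePart x | yes a | no nt | no nf | no ng = trailPart facePerm 6 rfl
      (λ { 0 _ → φ≢ a ; 1 _ → φφ≢ a ; 2 _ → nt ; 3 _ → nf ; 4 _ → ng ; (suc (suc (suc (suc (suc _))))) (s≤s (s≤s (s≤s (s≤s (s≤s (s≤s ())))))) })
      (sumOf6 {w = faceCharge} {f = φ} λ {y} r → ℕ.≤-trans (ℕ.m≤m+n 4 (corner y)) (faceCharge≥4 (proj₁ (Gen-pred Alive closed r) a)))
    where
    closed : ∀ {y z} → z ≡ φ y → (Alive y → Alive z) × (Alive z → Alive y)
    closed {y} refl = alive-φ , λ az → subst Alive (φ⁻φ y) (alive-α (alive-σ⁻ az))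

  -- The total charge against Euler's inequality

  dead : Fin d → ℕ
  dead x = 𝟙 (¬? (alive? x))

  -- What dart `x` passes over its edge to `α x`: 2 to a triangle there, and the share of `end x`
  -- that goes to the head of `x`.
  flow : Fin d → ℕ
  flow x = 2 * side x + end x

  flow-dead : ∀ {x} → ¬ Alive x → flow x ≡ 0
  flow-dead {x} na = cong₂ (λ u v → 2 * u + v) (𝟙-no (¬? (tri? x) ×-dec tri? (α x)) (λ p → dead-¬tri (dead-α na) (proj₂ p)))
                       (𝟙-no (big? x ×-dec ¬? (tri? (α x))) (λ p → proj₁ (proj₂ (proj₁ p)) (dead-four na)))

  -- A live dart starts with 12, six for its vertex and six for its face, so that an edge carries
  -- 24. Payments at the corner of `x` cancel; those over the edge form `flow`, and cancel only in
  -- the sum, because `α` permutes the darts.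
  balance : ∀ x → vertexCharge x + faceCharge x + flow x ≡ 12 + 24 * dead x + flow (α x)
  balance x = case (alive? x)
    where
    open ≡-Reasoning
    open +-*-Solver using (_:+_; _:*_; con; _:=_)
    case : Dec (Alive x) → vertexCharge x + faceCharge x + flow x ≡ 12 + 24 * dead x + flow (α x)
    case (no na) = begin
      vertexCharge x + faceCharge x + flow x   ≡⟨ cong₂ _+_ (cong₂ _+_ (weigh-dead (alive? x) na) (weigh-dead (alive? x) na)) (flow-dead na) ⟩
      36                                       ≡⟨ cong₂ (λ k l → 12 + 24 * k + l) (sym (𝟙-yes (¬? (alive? x)) na)) (sym (flow-dead (dead-α na))) ⟩
      12 + 24 * dead x + flow (α x)            ∎
    case (yes a) = begin
      vertexCharge x + faceCharge x + flow x
        ≡⟨ cong₂ (λ u v → u + v + flow x) (weigh-alive (alive? x) a) (weigh-alive (alive? x) a) ⟩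
      (4 + (2 ∸ corner x) + end x + end (α x)) + (4 + (2 ∸ out x) + 2 * side (α x) + corner x) + flow x
        ≡⟨ +-*-Solver.solve 7 (λ c′ c o′ r r′ s s′ → (con 4 :+ c′ :+ r :+ r′) :+ (con 4 :+ o′ :+ con 2 :* s′ :+ c) :+ (con 2 :* s :+ r)
              := con 8 :+ (c :+ c′) :+ ((con 2 :* s :+ con 2 :* r) :+ o′) :+ (con 2 :* s′ :+ r′)) refl
              (2 ∸ corner x) (corner x) (2 ∸ out x) (end x) (end (α x)) (side x) (side (α x)) ⟩
      8 + (corner x + (2 ∸ corner x)) + (out x + (2 ∸ out x)) + flow (α x)
        ≡⟨ cong₂ (λ u v → 8 + u + v + flow (α x)) (ℕ.m+[n∸m]≡n (corner≤2 a)) (ℕ.m+[n∸m]≡n (out≤2 x)) ⟩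
      12 + flow (α x)
        ≡⟨ cong (λ k → 12 + 24 * k + flow (α x)) (sym (𝟙-no (¬? (alive? x)) (λ na → na a))) ⟩
      12 + 24 * dead x + flow (α x)            ∎

  sum-24* : ∀ {n} (w : Fin n → ℕ) → sum (λ i → 24 * w i) ≡ 24 * sum w
  sum-24* {zero}  w = refl
  sum-24* {suc n} w = trans (cong (24 * w zero +_) (sum-24* (w ∘ suc))) (sym (ℕ.*-distribˡ-+ 24 (w zero) (sum (w ∘ suc))))

  totalCharge : sum vertexCharge + sum faceCharge ≡ d * 12 + 24 * sum dead
  totalCharge = ℕ.+-cancelʳ-≡ (sum flow) (sum vertexCharge + sum faceCharge) (d * 12 + 24 * sum dead) (begin
    sum vertexCharge + sum faceCharge + sum flow                ≡⟨ cong (_+ sum flow) (sym (sum-+ vertexCharge faceCharge)) ⟩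
    sum (λ x → vertexCharge x + faceCharge x) + sum flow        ≡⟨ sym (sum-+ (λ x → vertexCharge x + faceCharge x) flow) ⟩
    sum (λ x → vertexCharge x + faceCharge x + flow x)          ≡⟨ sum-cong-≗ {d} balance ⟩
    sum (λ x → 12 + 24 * dead x + flow (α x))                   ≡⟨ sum-+ (λ x → 12 + 24 * dead x) (flow ∘ α) ⟩
    sum (λ x → 12 + 24 * dead x) + sum (flow ∘ α)               ≡⟨ cong₂ _+_ (sum-+ {d} (λ _ → 12) (λ x → 24 * dead x)) (sum-invol α α-inv flow) ⟩
    sum {d} (λ _ → 12) + sum (λ x → 24 * dead x) + sum flow     ≡⟨ cong₂ (λ u v → u + v + sum flow) (sum-const d 12) (sum-24* dead) ⟩
    d * 12 + 24 * sum dead + sum flow                           ∎)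
    where open ≡-Reasoning

  -- Every dead edge is a component of its own.
  module _ {C} (components : Classes (Step₂ α σ) C) where
    open Classes components
    private
      code : Fin d → Fin (C * 2)
      code x = combine (cls x) (label x)

      deadClass : ∀ {x y} → ¬ Alive x → cls x ≡ cls y → y ≡ x ⊎ y ≡ α x
      deadClass {x} na e = proj₁ (Gen-pred (λ z → z ≡ x ⊎ z ≡ α x) closed (sound e)) (inj₁ refl)
        where
        closed : ∀ {y z} → Step₂ α σ y z → (y ≡ x ⊎ y ≡ α x → z ≡ x ⊎ z ≡ α x) × (z ≡ x ⊎ z ≡ α x → y ≡ x ⊎ y ≡ α x)
        closed {y} (inj₁ refl) = [ (λ { refl → inj₂ refl }) , (λ { refl → inj₁ (α-inv x) }) ]′
                               , [ (λ e → inj₂ (trans (sym (α-inv y)) (cong α e))) , (λ e → inj₁ (trans (sym (α-inv y)) (trans (cong α e) (α-inv x)))) ]′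
        closed {y} (inj₂ refl) = [ (λ { refl → inj₁ (dead-fix na) }) , (λ { refl → inj₂ (dead-fix (dead-α na)) }) ]′
                               , [ (λ e → inj₁ (σ-inj (trans e (sym (dead-fix na))))) , (λ e → inj₂ (σ-inj (trans e (sym (dead-fix (dead-α na)))))) ]′

      deads : List (Fin d)
      deads = List.filter (λ x → ¬? (alive? x)) (allFin d)

      isDead : ∀ {x} → x ∈ deads → ¬ Alive x
      isDead x∈ = proj₂ (∈-filter⁻ (λ x → ¬? (alive? x)) {xs = allFin d} x∈)

      code-inj : ∀ {x y} → x ∈ deads → y ∈ deads → code x ≡ code y → x ≡ y
      code-inj {x} {y} x∈ y∈ e with combine-injective (cls x) (label x) (cls y) (label y) e
      ... | c≡ , l≡ with deadClass (isDead x∈) c≡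
      ... | inj₁ y≡x  = sym y≡x
      ... | inj₂ refl = ⊥-elim (label-α x l≡)

    -- Every component has two codes. Each dead edge uses those of its own component, and the
    -- component of `x₀` has two left over.
    dead-bound : ∀ {x₀} → Alive x₀ → suc (suc (sum dead)) ≤ C * 2
    dead-bound {x₀} a₀ = begin
      suc (suc (sum dead))                                                    ≡⟨ cong (2 +_) (sym count) ⟩
      length (combine (cls x₀) zero ∷ combine (cls x₀) (suc zero) ∷ codes)    ≤⟨ unique-length≤ uq ⟩
      C * 2                                                                   ∎
      where
      open ℕ.≤-Reasoning
      codes : List (Fin (C * 2))
      codes = map code deads
      count : length codes ≡ sum dead
      count = trans (length-map code deads)
                (trans (sym (listSum-filter (λ x → ¬? (alive? x)) (allFin d))) (listSum-allFin dead (λ x → x)))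
      off : ∀ l {z} → z ∈ codes → combine (cls x₀) l ≢ z
      off l z∈ e with ∈-map⁻ code z∈
      ... | x , x∈ , refl with combine-injective (cls x₀) l (cls x) (label x) e
      ... | c≡ , _ with deadClass (isDead x∈) (sym c≡)
      ... | inj₁ refl = isDead x∈ a₀
      ... | inj₂ refl = dead-α (isDead x∈) a₀
      uq : Unique (combine (cls x₀) zero ∷ combine (cls x₀) (suc zero) ∷ codes)
      uq = ((λ e → case (proj₂ (combine-injective (cls x₀) zero (cls x₀) (suc zero) e))) ∷ All.tabulate (off zero))
         ∷ All.tabulate (off (suc zero))
         ∷ unique-map code code-inj (filter⁺ (λ x → ¬? (alive? x)) (allFin⁺ d))
        where
        case : zero ≡ Fin.suc {1} zero → ⊥
        case ()

  noAliveDart : ∀ {x₀} → Alive x₀ → ⊥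
  noAliveDart {x₀} a₀ = ℕ.<-irrefl refl (begin-strict
    24 * (edges + 2 * C)                              ≤⟨ ℕ.*-monoʳ-≤ 24 bound ⟩
    24 * (V + F)                                      ≡⟨ +-*-Solver.solve 2 (λ v f → con 24 :* (v :+ f) := v :* con 24 :+ f :* con 24) refl V F ⟩
    V * 24 + F * 24                                   ≤⟨ ℕ.+-mono-≤ (orbits-sum vertices vertexCharge 24 vertexPart) (orbits-sum faces faceCharge 24 facePart) ⟩
    sum vertexCharge + sum faceCharge                 ≡⟨ totalCharge ⟩
    d * 12 + 24 * sum dead                            ≤⟨ ℕ.+-monoˡ-≤ (24 * sum dead) (ℕ.*-monoˡ-≤ 12 darts≤) ⟩
    2 * edges * 12 + 24 * sum dead                    ≡⟨ +-*-Solver.solve 2 (λ e k → con 2 :* e :* con 12 :+ con 24 :* k := con 24 :* (e :+ k)) refl edges (sum dead) ⟩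
    24 * (edges + sum dead)                           <⟨ ℕ.*-monoʳ-< 24 (ℕ.+-monoʳ-< edges (ℕ.<-≤-trans (ℕ.n<1+n (sum dead)) (ℕ.≤-trans (ℕ.n≤1+n _) (dead-bound components a₀)))) ⟩
    24 * (edges + C * 2)                              ≡⟨ cong (λ k → 24 * (edges + k)) (ℕ.*-comm C 2) ⟩
    24 * (edges + 2 * C)                              ∎)
    where
    open EulerBound euler
    open ℕ.≤-Reasoning
    open +-*-Solver using (_:+_; _:*_; con; _:=_)

-- Minimal counterexamples

-- Exhaustive search over the lists; the `ext` argument stands in for function extensionality when a
-- function is rebuilt by `cons`.
choose? : ∀ {n} (L : Fin n → List ℕ) {P : (Fin n → ℕ) → Set} → (∀ {f g} → (∀ i → f i ≡ g i) → P f → P g) → (∀ f → Dec (P f)) →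
          Dec (∃ λ f → (∀ i → f i ∈ L i) × P f)
choose? {zero}  L ext P? = map′ (λ p → none , (λ ()) , p) (λ { (f , _ , p) → ext (λ ()) p }) (P? none)
  where
  none : Fin 0 → ℕ
  none ()
choose? {suc n} L {P} ext P? = map′ to from
    (Any.any? (λ c → choose? (L ∘ suc) {P ∘ cons c} (λ e → ext λ { zero → refl ; (suc i) → e i }) (P? ∘ cons c)) (L zero))
  where
  cons : ℕ → (Fin n → ℕ) → Fin (suc n) → ℕ
  cons c f zero    = c
  cons c f (suc i) = f i
  Tail : ℕ → Set
  Tail c = ∃ λ f → (∀ i → f i ∈ L (suc i)) × P (cons c f)
  to : Any Tail (L zero) → ∃ λ f → (∀ i → f i ∈ L i) × P f
  to a with find a
  ... | c , c∈ , f , f∈ , p = cons c f , (λ { zero → c∈ ; (suc i) → f∈ i }) , p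
  from : (∃ λ f → (∀ i → f i ∈ L i) × P f) → Any Tail (L zero)
  from (f , f∈ , p) = lose (f∈ zero) (f ∘ suc , f∈ ∘ suc , ext (λ { zero → refl ; (suc i) → refl }) p)

colourable? : ∀ G L → Dec (LColorable G L)
colourable? G L = choose? L
  (λ e p u v u~v q → p u v u~v (trans (e u) (trans q (sym (e v)))))
  (λ f → all? λ u → all? λ v → (Neighbours._~?_ G u v) →-dec ¬? (f u ℕ.≟ f v))

-- Discarded vertices stay as isolated ones, so lists, colourings and the map need no renaming.
restrict : (G : Graph) → (Fin (Graph.n G) → Bool) → Graph
restrict G S = record
  { n = Graph.n G
  ; adj = λ u v → (S u ∧ S v) ∧ Graph.adj G u v
  ; sym = λ u v → cong₂ _∧_ (Bool.∧-comm (S u) (S v)) (Graph.sym G u v)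
  ; irrefl = λ v → trans (cong ((S v ∧ S v) ∧_) (Graph.irrefl G v)) (Bool.∧-zeroʳ _) }

∧-true : ∀ {a b} → a ∧ b ≡ true → a ≡ true × b ≡ true
∧-true {true} {true} refl = refl , refl

module _ {G : Graph} where
  private
    Subset : Set
    Subset = Fin (Graph.n G) → Bool

  restrict⁻ : ∀ (S : Subset) {u v} → Adj (restrict G S) u v → S u ≡ true × S v ≡ true × Adj G u v
  restrict⁻ S e with ∧-true e
  ... | s , a with ∧-true s
  ... | su , sv = su , sv , a

  restrict⁺ : ∀ (S : Subset) {u v} → S u ≡ true → S v ≡ true → Adj G u v → Adj (restrict G S) u v
  restrict⁺ S su sv a = cong₂ _∧_ (cong₂ _∧_ su sv) a

  without : Fin (Graph.n G) → Subset → Subset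
  without v S u with u ≟ v
  ... | yes _ = false
  ... | no _  = S u

  without-≢ : ∀ v (S : Subset) {u} → u ≢ v → without v S u ≡ S u
  without-≢ v S {u} ne with u ≟ v
  ... | yes e = ⊥-elim (ne e)
  ... | no _  = refl

  without⁻ : ∀ v (S : Subset) {u} → without v S u ≡ true → u ≢ v × S u ≡ true
  without⁻ v S {u} e with u ≟ v
  without⁻ _ _ () | yes _
  ... | no ne = ne , e

  module _ (L : Fin (Graph.n G) → List ℕ) where
    Colourable : Subset → Set
    Colourable S = LColorable (restrict G S) L

    colourable-⊆ : ∀ (S T : Subset) → (∀ {u} → S u ≡ true → T u ≡ true) → Colourable T → Colourable S
    colourable-⊆ S T sub (c , c∈ , p) = c , c∈ , λ u v e → let su , sv , a = restrict⁻ S e in p u v (restrict⁺ T (sub su) (sub sv) a)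

    -- One pass is enough: a vertex kept because its removal allowed a colouring remains necessary
    -- after further removals, by `colourable-⊆`.
    shrink : ∀ vs (S : Subset) → ¬ Colourable S →
             Σ Subset λ T → ¬ Colourable T × (∀ {u} → T u ≡ true → S u ≡ true) × (∀ {v} → v ∈ vs → T v ≡ true → Colourable (without v T))
    shrink []       S nc = S , nc , (λ e → e) , λ ()
    shrink (v ∷ vs) S nc with colourable? (restrict G (without v S)) L
    ... | yes col with shrink vs S nc
    ...   | T , ncT , sub , crit = T , ncT , sub , λ
      { (here refl) _ → colourable-⊆ (without v T) (without v S) (λ {u} e → let ne , t = without⁻ v T {u} e in trans (without-≢ v S ne) (sub t)) col
      ; (there v∈)    → crit v∈ }
    shrink (v ∷ vs) S nc | no nc′ with shrink vs (without v S) nc′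
    ...   | T , ncT , sub , crit = T , ncT , (λ {u} t → proj₂ (without⁻ v S {u} (sub t))) , λ
      { (here refl) t → ⊥-elim (proj₁ (without⁻ v S {v} (sub t)) refl)
      ; (there v∈)    → crit v∈ }

noLoneSharedEdge : ∀ {G} → (∀ (C : Cycle5 G) → ¬ SharesOneEdgeWithTriangle C) → NoLoneSharedEdge G
noLoneSharedEdge {G} h {v₀} {v₁} {v₂} {v₃} {v₄} {w} e₀ e₁ e₂ e₃ e₄ n₀₂ n₀₃ n₁₃ n₁₄ n₂₄ w₀ w₁ w≢v₂ w≢v₄ =
  h cycle (v₀ , v₁ , w , e₀ , ~-sym w₁ , ~-sym w₀ , (zero , inj₁ (refl , refl)) , notEdge₁ , notEdge₀)
  where
  open Neighbours G
  at : Fin 5 → Fin (Graph.n G)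
  at zero = v₀
  at (suc zero) = v₁
  at (suc (suc zero)) = v₂
  at (suc (suc (suc zero))) = v₃
  at (suc (suc (suc (suc zero)))) = v₄
  at-adj : ∀ i → at i ~ at (next5 i)
  at-adj zero = e₀
  at-adj (suc zero) = e₁
  at-adj (suc (suc zero)) = e₂
  at-adj (suc (suc (suc zero))) = e₃
  at-adj (suc (suc (suc (suc zero)))) = e₄
  at-inj : Injective _≡_ _≡_ at
  at-inj {zero} {zero} _ = refl
  at-inj {zero} {suc zero} e = ⊥-elim (~⇒≢ e₀ e)
  at-inj {zero} {suc (suc zero)} e = ⊥-elim (n₀₂ e)
  at-inj {zero} {suc (suc (suc zero))} e = ⊥-elim (n₀₃ e)
  at-inj {zero} {suc (suc (suc (suc zero)))} e = ⊥-elim (~⇒≢ e₄ (sym e))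
  at-inj {suc zero} {zero} e = ⊥-elim (~⇒≢ e₀ (sym e))
  at-inj {suc zero} {suc zero} _ = refl
  at-inj {suc zero} {suc (suc zero)} e = ⊥-elim (~⇒≢ e₁ e)
  at-inj {suc zero} {suc (suc (suc zero))} e = ⊥-elim (n₁₃ e)
  at-inj {suc zero} {suc (suc (suc (suc zero)))} e = ⊥-elim (n₁₄ e)
  at-inj {suc (suc zero)} {zero} e = ⊥-elim (n₀₂ (sym e))
  at-inj {suc (suc zero)} {suc zero} e = ⊥-elim (~⇒≢ e₁ (sym e))
  at-inj {suc (suc zero)} {suc (suc zero)} _ = refl
  at-inj {suc (suc zero)} {suc (suc (suc zero))} e = ⊥-elim (~⇒≢ e₂ e)
  at-inj {suc (suc zero)} {suc (suc (suc (suc zero)))} e = ⊥-elim (n₂₄ e)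
  at-inj {suc (suc (suc zero))} {zero} e = ⊥-elim (n₀₃ (sym e))
  at-inj {suc (suc (suc zero))} {suc zero} e = ⊥-elim (n₁₃ (sym e))
  at-inj {suc (suc (suc zero))} {suc (suc zero)} e = ⊥-elim (~⇒≢ e₂ (sym e))
  at-inj {suc (suc (suc zero))} {suc (suc (suc zero))} _ = refl
  at-inj {suc (suc (suc zero))} {suc (suc (suc (suc zero)))} e = ⊥-elim (~⇒≢ e₃ e)
  at-inj {suc (suc (suc (suc zero)))} {zero} e = ⊥-elim (~⇒≢ e₄ e)
  at-inj {suc (suc (suc (suc zero)))} {suc zero} e = ⊥-elim (n₁₄ (sym e))
  at-inj {suc (suc (suc (suc zero)))} {suc (suc zero)} e = ⊥-elim (n₂₄ (sym e))
  at-inj {suc (suc (suc (suc zero)))} {suc (suc (suc zero))} e = ⊥-elim (~⇒≢ e₃ (sym e))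
  at-inj {suc (suc (suc (suc zero)))} {suc (suc (suc (suc zero)))} _ = refl
  cycle : Cycle5 G
  cycle = record { vtx = at ; inj = at-inj ; adjs = at-adj }
  notEdge₁ : ¬ EdgeOfCycle cycle v₁ w
  notEdge₁ (zero , inj₁ (p , _)) = ~⇒≢ e₀ p
  notEdge₁ (zero , inj₂ (p , _)) = ~⇒≢ w₀ (sym p)
  notEdge₁ (suc zero , inj₁ (_ , p)) = w≢v₂ (sym p)
  notEdge₁ (suc zero , inj₂ (p , _)) = ~⇒≢ w₁ (sym p)
  notEdge₁ (suc (suc zero) , inj₁ (p , _)) = ~⇒≢ e₁ (sym p)
  notEdge₁ (suc (suc zero) , inj₂ (p , _)) = w≢v₂ (sym p)
  notEdge₁ (suc (suc (suc zero)) , inj₁ (p , _)) = n₁₃ (sym p)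
  notEdge₁ (suc (suc (suc zero)) , inj₂ (_ , p)) = n₁₄ (sym p)
  notEdge₁ (suc (suc (suc (suc zero))) , inj₁ (p , _)) = n₁₄ (sym p)
  notEdge₁ (suc (suc (suc (suc zero))) , inj₂ (p , _)) = w≢v₄ (sym p)
  notEdge₀ : ¬ EdgeOfCycle cycle v₀ w
  notEdge₀ (zero , inj₁ (_ , p)) = ~⇒≢ w₁ (sym p)
  notEdge₀ (zero , inj₂ (p , _)) = ~⇒≢ w₀ (sym p)
  notEdge₀ (suc zero , inj₁ (p , _)) = ~⇒≢ e₀ (sym p)
  notEdge₀ (suc zero , inj₂ (p , _)) = ~⇒≢ w₁ (sym p)
  notEdge₀ (suc (suc zero) , inj₁ (p , _)) = n₀₂ (sym p)
  notEdge₀ (suc (suc zero) , inj₂ (p , _)) = w≢v₂ (sym p)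
  notEdge₀ (suc (suc (suc zero)) , inj₁ (p , _)) = n₀₃ (sym p)
  notEdge₀ (suc (suc (suc zero)) , inj₂ (_ , p)) = ~⇒≢ e₄ p
  notEdge₀ (suc (suc (suc (suc zero))) , inj₁ (p , _)) = ~⇒≢ e₄ p
  notEdge₀ (suc (suc (suc (suc zero))) , inj₂ (p , _)) = w≢v₄ (sym p)

restrict-noLoneSharedEdge : ∀ {G} S → NoLoneSharedEdge G → NoLoneSharedEdge (restrict G S)
restrict-noLoneSharedEdge {G} S h e₀ e₁ e₂ e₃ e₄ n₀₂ n₀₃ n₁₃ n₁₄ n₂₄ w₀ w₁ =
  h (drop e₀) (drop e₁) (drop e₂) (drop e₃) (drop e₄) n₀₂ n₀₃ n₁₃ n₁₄ n₂₄ (drop w₀) (drop w₁)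
  where
  drop : ∀ {u v} → Adj (restrict G S) u v → Adj G u v
  drop e = proj₂ (proj₂ (restrict⁻ {G} S e))

-- From the given embedding to the plane map of a vertex subset

Orb⇒Gen : ∀ {d} {f : Fin d → Fin d} {x y} → Orb f x y → Gen (Step f) x y
Orb⇒Gen Orb.here     = rfl
Orb⇒Gen (Orb.next o) = Orb⇒Gen o ∙ gen refl

Orb2⇒Gen : ∀ {d} {f g : Fin d → Fin d} {x y} → Orb2 f g x y → Gen (Step₂ f g) x y
Orb2⇒Gen Orb2.here      = rfl
Orb2⇒Gen (Orb2.nextf o) = Orb2⇒Gen o ∙ gen (inj₁ refl)
Orb2⇒Gen (Orb2.nextg o) = Orb2⇒Gen o ∙ gen (inj₂ refl)

numClasses⇒Classes : ∀ {d k} {Q R : Fin d → Fin d → Set} → (∀ {x y} → Q x y → Gen R x y) → (∀ {x y} → R x y → Q x y) →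
                     NumClasses Q k → Classes R k
numClasses⇒Classes f g (c , onto , eq) = record
  { cls = c ; rep = proj₁ ∘ onto ; onto = proj₂ ∘ onto
  ; sound = λ {x} {y} e → f (Equivalence.to (eq x y) e) ; resp = λ {x} {y} r → Equivalence.from (eq x y) (g r) }

orbClasses : ∀ {d k} {f : Fin d → Fin d} → NumClasses (Orb f) k → Classes (Step f) k
orbClasses = numClasses⇒Classes Orb⇒Gen (λ { refl → Orb.next Orb.here })

orb2Classes : ∀ {d k} {f g : Fin d → Fin d} → NumClasses (Orb2 f g) k → Classes (Step₂ f g) k
orb2Classes = numClasses⇒Classes Orb2⇒Gen (λ { (inj₁ refl) → Orb2.nextf Orb2.here ; (inj₂ refl) → Orb2.nextg Orb2.here })

argmin : ∀ {d} (key : Fin d → ℕ) {P : Fin d → Set} → (∀ x → Dec (P x)) → ∃ P → ∃ λ x → P x × (∀ {y} → P y → key x ≤ key y)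
argmin key {P} P? (x₀ , p₀) with least (λ k → ∃ λ x → P x × key x ≡ k) (λ k → any? (λ x → P? x ×-dec (key x ℕ.≟ k))) (key x₀) (x₀ , p₀ , refl)
... | _ , (x , p , refl) , below = x , p , λ {y} py → ℕ.≮⇒≥ λ lt → below (key y) lt (y , py , refl)

-- A planar embedding may have parallel edges; among those joining the same two vertices the one with the least dart survives.
module Restrict (G : Graph) (M : CombMap) (genus : GenusZero M) (embedding : EmbeddingOf G M) (S : Fin (Graph.n G) → Bool) where
  open CombMap M using (d; α; α-invol; α-nofix)
  open Halves α α-invol α-nofix

  private
    H : Graph
    H = restrict G S
  open Neighbours H

  vertex : Fin d → Fin (Graph.n G)
  vertex = proj₁ embedding

  -- Symmetric in the two darts of an edge, so that both survive or neither does.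
  key : Fin d → ℕ
  key x = toℕ x ⊓ toℕ (α x)

  key-α : ∀ x → key (α x) ≡ key x
  key-α x = trans (cong (λ z → toℕ (α x) ⊓ toℕ z) (α-invol x)) (ℕ.⊓-comm (toℕ (α x)) (toℕ x))

  key-≡ : ∀ {x y} → key x ≡ key y → x ≡ y ⊎ x ≡ α y
  key-≡ {x} {y} e with ℕ.⊓-sel (toℕ x) (toℕ (α x)) | ℕ.⊓-sel (toℕ y) (toℕ (α y))
  ... | inj₁ a | inj₁ b = inj₁ (toℕ-injective (trans (sym a) (trans e b)))
  ... | inj₁ a | inj₂ b = inj₂ (toℕ-injective (trans (sym a) (trans e b)))
  ... | inj₂ a | inj₁ b = inj₂ (trans (sym (α-invol x)) (cong α (toℕ-injective (trans (sym a) (trans e b)))))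
  ... | inj₂ a | inj₂ b = inj₁ (trans (sym (α-invol x)) (trans (cong α (toℕ-injective (trans (sym a) (trans e b)))) (α-invol y)))

  Parallel : Fin d → Fin d → Set
  Parallel x y = vertex y ≡ vertex x × vertex (α y) ≡ vertex (α x)

  Alive : Fin d → Set
  Alive x = vertex x ~ vertex (α x) × (∀ y → Parallel x y → key x ≤ key y)

  parallel? : ∀ x y → Dec (Parallel x y)
  parallel? x y = (vertex y ≟ vertex x) ×-dec (vertex (α y) ≟ vertex (α x))

  alive? : ∀ x → Dec (Alive x)
  alive? x = (vertex x ~? vertex (α x)) ×-dec all? (λ y → parallel? x y →-dec (key x ℕ.≤? key y))

  alive-α : ∀ {x} → Alive x → Alive (α x)
  alive-α {x} (e , least) = subst (vertex (α x) ~_) (cong vertex (sym (α-invol x))) (~-sym e) ,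
    λ y (p , q) → subst₂ _≤_ (sym (key-α x)) (key-α y) (least (α y) (trans q (cong vertex (α-invol x)) , trans (cong vertex (α-invol y)) p))

  rotation : Perm d
  rotation = record
    { fwd = CombMap.σ M ⟨$⟩ʳ_ ; bwd = CombMap.σ M ⟨$⟩ˡ_
    ; fwd-bwd = λ _ → inverseʳ (CombMap.σ M) ; bwd-fwd = λ _ → inverseˡ (CombMap.σ M) }

  edgePerm : Perm d
  edgePerm = record { fwd = α ; bwd = α ; fwd-bwd = α-invol ; bwd-fwd = α-invol }

  edges : ℕ
  edges = proj₁ (proj₂ genus)

  edgeClasses : Classes (Step α) edges
  edgeClasses = let _ , _ , _ , _ , _ , ec , _ = genus in orbClasses ec

  darts≤ : d ≤ 2 * edges
  darts≤ = subst (d ≤_) (ℕ.*-comm edges 2) (injective⇒≤ {f = code} code-inj)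
    where
    open Classes edgeClasses
    code : Fin d → Fin (edges * 2)
    code x = combine (cls x) (label x)
    code-inj : Injective _≡_ _≡_ code
    code-inj {x} {y} e with combine-injective (cls x) (label x) (cls y) (label y) e
    ... | c≡ , l≡ with orbit-return edgePerm 1 (α-invol x) (sound c≡)
    ... | 0 , _ , y≡x = sym y≡x
    ... | 1 , _ , refl = ⊥-elim (label-α x l≡)
    ... | suc (suc _) , s≤s () , _

  euler₀ : EulerBound α (Perm.fwd rotation) edges
  euler₀ = let _ , _ , _ , _ , vc , _ , fc , cc , eq = genus in record
    { vertices = orbClasses vc ; faces = orbClasses fc ; components = orb2Classes cc ; bound = ℕ.≤-reflexive (sym eq) }

  pruned : Pruned edgePerm rotation edges Alive (allFin d) vertex
  pruned = prune edgePerm rotation alive? vertex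
    (λ x → sym (Equivalence.from (proj₁ (proj₂ embedding) x (Perm.fwd rotation x)) (Orb.next Orb.here))) euler₀ (allFin d)

  planeMap : PlaneMap H
  planeMap = record
    { α = α ; α-inv = α-invol ; α-fix = α-nofix ; rotation = Pruned.ρ pruned
    ; Alive = Alive ; alive? = alive? ; alive-α = alive-α ; dead-fix = λ {x} → Pruned.dead-fix pruned (∈-allFin x)
    ; vert = vertex ; vert-σ = Pruned.same pruned
    ; orbit = λ {x} {y} ax ay e → Pruned.connected pruned ax ay (Orb⇒Gen (Equivalence.to (proj₁ (proj₂ embedding) x y) e))
    ; simple = simple ; adj = proj₁ ; dart = dart
    ; darts≤ = darts≤ ; euler = Pruned.euler pruned }
    where
    simple : ∀ {x y} → Alive x → Alive y → vertex x ≡ vertex y → vertex (α x) ≡ vertex (α y) → x ≡ y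
    simple {x} {y} (ex , lx) (_ , ly) p q with key-≡ (ℕ.≤-antisym (lx y (sym p , sym q)) (ly x (p , q)))
    ... | inj₁ e    = e
    ... | inj₂ refl = ⊥-elim (~⇒≢ ex (sym q))
    dart : ∀ {u v} → u ~ v → ∃ λ x → Alive x × vertex x ≡ u × vertex (α x) ≡ v
    dart {u} {v} e with argmin key {λ x → vertex x ≡ u × vertex (α x) ≡ v} (λ x → (vertex x ≟ u) ×-dec (vertex (α x) ≟ v))
                          (Equivalence.to (proj₂ (proj₂ embedding) u v) (proj₂ (proj₂ (restrict⁻ {G} S e))))
    ... | x , (refl , refl) , le = x , (e , λ y p → le p) , refl , refl

-- Contradiction for a minimal uncolourable subgraph

firstColour : ∀ {k} (xs : List ℕ) → length xs ≡ suc k → ∃ (_∈ xs)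
firstColour (x ∷ xs) _ = x , here refl

module Critical (G : Graph) (M : PlaneMap G) (noShare : NoLoneSharedEdge G) (L : Fin (Graph.n G) → List ℕ) (asg : IsAssignment G 4 L)
                (uncolourable : ¬ LColorable G L) (critical : ∀ {v w} → Adj G v w → ∃ (Holes.HoleAt G L asg uncolourable v)) where
  open PlaneMap M
  open Holes G L asg uncolourable
  open Neighbours G

  -- At most three neighbours cannot show four colours. The same three-element list serves every
  -- `k ≤ 2`; a shorter orbit merely repeats entries.
  degree≥4 : ∀ {x} → Alive x → ∀ k → k ≤ 2 → iter σ (suc k) x ≢ x
  degree≥4 {x} a k k≤2 ret with critical (adj a)
  ... | φ , hole = threeColours⇒⊥ {φ = φ} (head x ∷ head (σ x) ∷ head (σ (σ x)) ∷ []) refl λ c∈ → case (around hole c∈)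
    where
    case : ∀ {c} → (∃ λ w → vert x ~ w × φ w ≡ c) → ∃ λ z → z ∈ head x ∷ head (σ x) ∷ head (σ (σ x)) ∷ [] × φ z ≡ c
    case (w , v~w , e) with dart v~w
    ... | y , ay , vy , refl with orbit-return rotation k ret (orbit a ay (sym vy))
    ... | 0 , _ , refl = w , here refl , e
    ... | 1 , _ , refl = w , there (here refl) , e
    ... | 2 , _ , refl = w , there (there (here refl)) , e
    ... | suc (suc (suc i)) , i≤k , _ with ℕ.≤-trans i≤k k≤2
    ...   | s≤s (s≤s ())

  σ≢ : ∀ {x} → Alive x → σ x ≢ x
  σ≢ a = degree≥4 a 0 z≤n

  σσ≢ : ∀ {x} → Alive x → σ (σ x) ≢ x
  σσ≢ a = degree≥4 a 1 (s≤s z≤n)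

  σσσ≢ : ∀ {x} → Alive x → σ (σ (σ x)) ≢ x
  σσσ≢ a = degree≥4 a 2 ℕ.≤-refl

  open Local.Reducible G M noShare σ≢ σσ≢ σσσ≢ L asg uncolourable critical

  impossible : ⊥
  impossible with any? alive?
  ... | yes (_ , a) = Discharging.noAliveDart G M noShare σ≢ σσ≢ σσσ≢ lonelyDeg4⇒⊥ consecutiveLonely⇒⊥ disjointLonely⇒⊥ a
  -- Without live darts there are no edges, and any choice from the lists is a colouring.
  ... | no none = uncolourable ((λ v → proj₁ (colour v)) , (λ v → proj₂ (colour v)) , λ u v e → ⊥-elim (none (let x , a , _ = dart e in x , a)))
    where
    colour : ∀ v → ∃ (_∈ L v)
    colour v = firstColour (L v) (proj₁ (asg v))

theorem1 : (G : Graph) → Planar G →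
    (∀ (C : Cycle5 G) → ¬ InWheel C × ¬ SharesOneEdgeWithTriangle C) →
    Choosable G 4
theorem1 G (M , genus , embedding) h L asg with colourable? G L
... | yes c = c
... | no nc with shrink {G} L (allFin _) (λ _ → true) (λ { (c , c∈ , p) → nc (c , c∈ , λ u v e → p u v (restrict⁺ {G} (λ _ → true) refl refl e)) })
... | S , uncolourable , _ , minimal =
  ⊥-elim (Critical.impossible (restrict G S) (Restrict.planeMap G M genus embedding S)
    (restrict-noLoneSharedEdge {G} S (noLoneSharedEdge {G} (proj₂ ∘ h))) L asg uncolourable critical)
  where
  critical : ∀ {v w} → Adj (restrict G S) v w → ∃ (Holes.HoleAt (restrict G S) L asg uncolourable v)
  critical {v} e with minimal (∈-allFin v) (proj₁ (restrict⁻ {G} S e))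
  ... | c , c∈ , p = c , record
    { listed = λ {w} _ → c∈ w
    ; proper = λ {w} {z} w≢v z≢v e′ → let sw , sz , a = restrict⁻ {G} S e′ in
        p w z (restrict⁺ {G} (without {G} v S) (trans (without-≢ {G} v S w≢v) sw) (trans (without-≢ {G} v S z≢v) sz) a) }
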